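{- Let $G$ be a graph of maximum degree $\Delta$, with its vertex set partitioned into $k$ blocks containing $b$ vertices each, such that $b\ge4\Delta$. Run the MT algorithm to find an independent transversal, using the natural probability distribution (selecting one vertex uniformly and independently from each block). Then the MT algorithm terminates (with probability 1) and the resulting probability distribution $\Omega'$ on independent transversals has min-entropy at least $$H_\infty(\Omega')\ \ge\ k\ln\frac{4b}{2+b/\Delta-\sqrt{b^2/\Delta^2-4b/\Delta}}.$$
   Context: For a graph with vertex partition $V=V_1\sqcup\cdots\sqcup V_k$, an independent transversal is an independent set $I$ of $G$ with $|I\cap V_i|=1$ for each $i=1,\dots,k$. MT (Moser-Tardos) algorithm in this setting: the variables are $X_1,\dots,X_k$, with $X_i$ uniform on $V_i$, independent; for each edge $\langle u,v\rangle$ of $G$ there is a bad event that $u$ and $v$ are both selected. Draw all $X_i$; while some bad event is true, choose a currently-true bad event by any fixed (possibly randomized) rule and redraw independently the variables of the blocks it involves. $\Omega'$ is the distribution of $(X_1,\dots,X_k)$ at termination. The min-entropy of a distribution $\mathcal V$ on a finite set $S$ is $H_\infty(\mathcal V)=-\ln\max_{v\in S}P_{\mathcal V}(v)$. -}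

module Defs where

open import Algebra.Apartness.Bundles using (HeytingField)
open import Algebra.Bundles using (CommutativeRing)
open import Data.Empty using (⊥-elim)
open import Data.Fin.Base as Fin using (Fin)
import Data.Fin.Properties as Fin
open import Data.Fin.Subset using (Subset; ∣_∣; _∩_; _∈_)
open import Data.Fin.Subset.Properties using (_∈?_)
open import Data.List.Base as List
  using (List; []; _∷_; allFin; cartesianProduct; cartesianProductWith; concatMap; filter; foldr; length)
open import Data.List.Extrema.Nat using (max)
open import Data.List.Membership.Propositional using (_∉_) renaming (_∈_ to _∈ˡ_)
open import Data.Nat.Base as ℕ using (ℕ; zero; suc; _!; _∸_)
import Data.Nat.Properties as ℕ
open import Data.Product.Base using (∃; _×_; _,_; proj₁; proj₂)
open import Data.Sum.Base using (_⊎_; inj₁; inj₂)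
open import Data.Vec.Base as Vec using (Vec; []; _∷_; lookup; tabulate; _[_]≔_)
import Data.Vec.Properties as Vec
open import Function.Base using (_∘_)
open import Level using (0ℓ) renaming (suc to lsuc; _⊔_ to _⊔ˡ_)
open import Relation.Binary.Core using (Rel)
open import Relation.Binary.Definitions using (Decidable; Irreflexive; Symmetric)
open import Relation.Binary.Lattice.Definitions using (Supremum)
open import Relation.Binary.PropositionalEquality.Core as ≡ using (_≡_; _≢_)
open import Relation.Binary.Structures using (IsStrictPartialOrder)
open import Relation.Nullary.Decidable.Core using (Dec; does; ¬?; _×-dec_; _→-dec_)
import Relation.Nullary.Decidable as Dec
open import Relation.Nullary.Negation.Core using (¬_)
open import Relation.Unary using (Pred) renaming (Decidable to Decidable₁)

import Algebra.Properties.Ring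
import Algebra.Properties.Semiring.Exp
import Algebra.Properties.Semiring.Mult
import Algebra.Apartness.Properties.HeytingCommutativeRing as HeytingProperties
import Algebra.Solver.Ring.NaturalCoefficients.Default as SemiringSolver
import Relation.Binary.Reasoning.Setoid as SetoidReasoning

------------------------------------------------------------------------
-- The real numbers

-- The standard library has no real numbers, so they are given axiomatically.
-- The ordered-field part below is the constructive reading of "Archimedean
-- ordered field": `<` is the primitive order and `x ≤ y` means `¬ (y < x)`.

record ArchimedeanField c ℓ₁ ℓ₂ : Set (lsuc (c ⊔ˡ ℓ₁ ⊔ˡ ℓ₂)) where
  field
    heytingField : HeytingField c ℓ₁ ℓ₂

  open HeytingField heytingField public

  commutativeRing : CommutativeRing c ℓ₁
  commutativeRing = record { isCommutativeRing = isCommutativeRing }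

  open CommutativeRing commutativeRing public
    using (ring; semiring; commutativeSemiring)
  open Algebra.Properties.Semiring.Mult semiring public using () renaming (_×_ to _×ᵣ_)
  open Algebra.Properties.Semiring.Exp semiring public using (_^_)

  infix 4 _<_ _≤_

  field
    _<_                  : Rel Carrier ℓ₂
    isStrictPartialOrder : IsStrictPartialOrder _≈_ _<_
    <⇒#                  : ∀ {x y} → x < y → x # y
    #⇒<⊎>                : ∀ {x y} → x # y → x < y ⊎ y < x
    0<1                  : 0# < 1#
    +-monoʳ-<            : ∀ z {x y} → x < y → z + x < z + y
    *-pos                : ∀ {x y} → 0# < x → 0# < y → 0# < x * y

  fromℕ : ℕ → Carrier
  fromℕ n = n ×ᵣ 1#

  field
    archimedean : ∀ x → ∃ λ n → x < fromℕ n

  open IsStrictPartialOrder isStrictPartialOrder public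
    using (<-respˡ-≈; <-respʳ-≈) renaming (irrefl to <-irrefl; trans to <-trans; asym to <-asym)

  _≤_ : Rel Carrier ℓ₂
  x ≤ y = ¬ (y < x)

  +-pos : ∀ {x y} → 0# < x → 0# < y → 0# < x + y
  +-pos {x} 0<x 0<y = <-trans 0<x (<-respˡ-≈ (+-identityʳ x) (+-monoʳ-< x 0<y))

  fromℕ-pos : ∀ n → 0# < fromℕ (suc n)
  fromℕ-pos zero    = <-respʳ-≈ (sym (+-identityʳ 1#)) 0<1
  fromℕ-pos (suc n) = +-pos 0<1 (fromℕ-pos n)

  inv : ∀ {x} → 0# < x → Carrier
  inv 0<x = proj₁ (#⇒invertible (#-sym (<⇒# 0<x)))

  -- With the convention 1/ 0 = 0.
  1/_ : ℕ → Carrier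
  1/ zero  = 0#
  1/ suc n = inv (fromℕ-pos n)

  -- Convergence of sequences

  Near : Carrier → Carrier → Carrier → Set ℓ₂
  Near ε x y = x - y < ε × y - x < ε

  _⟶_ : (ℕ → Carrier) → Carrier → Set (c ⊔ˡ ℓ₂)
  x ⟶ l = ∀ ε → 0# < ε → ∃ λ N → ∀ n → N ℕ.≤ n → Near ε (x n) l

  Cauchy : (ℕ → Carrier) → Set (c ⊔ˡ ℓ₂)
  Cauchy x = ∀ ε → 0# < ε → ∃ λ N → ∀ m n → N ℕ.≤ m → N ℕ.≤ n → Near ε (x m) (x n)

  expPartialSum : Carrier → ℕ → Carrier
  expPartialSum x zero    = 0#
  expPartialSum x (suc n) = expPartialSum x n + x ^ n * 1/ (n !)

-- A Cauchy-complete Archimedean ordered field is, up to isomorphism, ℝ.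
-- On ℝ the remaining fields are uniquely determined by their specifications
-- (binary maximum, nonnegative square root, exponential series, inverse of
-- exp), so they single out functions on ℝ and do not restrict the field.

record RealField c ℓ₁ ℓ₂ : Set (lsuc (c ⊔ˡ ℓ₁ ⊔ˡ ℓ₂)) where
  field
    archimedeanField : ArchimedeanField c ℓ₁ ℓ₂

  open ArchimedeanField archimedeanField public

  infixl 6 _⊔_

  field
    complete   : ∀ x → Cauchy x → ∃ (x ⟶_)

    _⊔_        : Carrier → Carrier → Carrier
    ⊔-supremum : Supremum _≤_ _⊔_

    √          : ∀ x → 0# ≤ x → Carrier
    √-nonNeg   : ∀ x 0≤x → 0# ≤ √ x 0≤x
    √-square   : ∀ x 0≤x → √ x 0≤x * √ x 0≤x ≈ x

    exp        : Carrier → Carrier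
    exp-series : ∀ x → expPartialSum x ⟶ exp x

    ln         : ∀ x → 0# < x → Carrier
    exp-ln     : ∀ x 0<x → exp (ln x 0<x) ≈ x

  sum : List Carrier → Carrier
  sum = foldr _+_ 0#

  module _ {a} {A : Set a} (S : List A) (P : A → Carrier) where

    record IsDistributionOn : Set (a ⊔ˡ ℓ₁ ⊔ˡ ℓ₂) where
      field
        nonNeg  : ∀ x → 0# ≤ P x
        support : ∀ x → x ∉ S → P x ≈ 0#
        total   : sum (List.map P S) ≈ 1#

    -- Starting the maximum at 0 is harmless for nonnegative P.
    maximum : Carrier
    maximum = foldr (λ x m → P x ⊔ m) 0# S

    minEntropy : 0# < maximum → Carrier
    minEntropy 0<max = - ln maximum 0<max

------------------------------------------------------------------------
-- Graphs with a vertex partition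

record Graph (n : ℕ) : Set₁ where
  infix 4 _~_ _~?_
  field
    _~_    : Rel (Fin n) 0ℓ
    _~?_   : Decidable _~_
    sym    : Symmetric _~_
    irrefl : Irreflexive _≡_ _~_

  degree : Fin n → ℕ
  degree v = length (filter (v ~?_) (allFin n))

  maxDegree : ℕ
  maxDegree = max 0 (List.map degree (allFin n))

  -- Each edge ⟨u,v⟩ is listed once, as the ordered pair with u < v.
  edges : List (Fin n × Fin n)
  edges = filter (λ (u , v) → (u Fin.<? v) ×-dec (u ~? v))
                 (cartesianProduct (allFin n) (allFin n))

  Independent : Subset n → Set
  Independent I = ∀ {u v} → u ∈ I → v ∈ I → ¬ (u ~ v)

record Partition (n k b : ℕ) : Set where
  field
    block : Fin n → Fin k

  V : Fin k → Subset n
  V i = tabulate (λ v → does (block v Fin.≟ i))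

  field
    ∣V∣≡b : ∀ i → ∣ V i ∣ ≡ b

  members : Fin k → List (Fin n)
  members i = filter (_∈? V i) (allFin n)

------------------------------------------------------------------------
-- The entropy bound

module Bound {c ℓ₁ ℓ₂} (ℛ : RealField c ℓ₁ ℓ₂)
             {b Δ : ℕ} (0<Δ : 0 ℕ.< Δ) (4Δ≤b : 4 ℕ.* Δ ℕ.≤ b) where

  open RealField ℛ

  -- α = b / Δ
  α radicand : Carrier
  α        = fromℕ b * 1/ Δ
  radicand = α * α - fromℕ 4 * α

  private
    module H = HeytingProperties heytingCommutativeRing
    module M = Algebra.Properties.Semiring.Mult semiring
    module R = Algebra.Properties.Ring ring
    open SetoidReasoning setoid

    <⇒0<- : ∀ {y} → y < 0# → 0# < - y
    <⇒0<- {y} y<0 =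
      <-respˡ-≈ (-‿inverseˡ y) (<-respʳ-≈ (+-identityʳ (- y)) (+-monoʳ-< (- y) y<0))

    inv-inverseʳ : ∀ {x} (0<x : 0# < x) → x * inv 0<x ≈ 1#
    inv-inverseʳ {x} 0<x =
      trans (*-congʳ (sym (H.x-0≈x x))) (proj₂ (proj₂ (#⇒invertible (#-sym (<⇒# 0<x)))))

    inv-pos : ∀ {x} (0<x : 0# < x) → 0# < inv 0<x
    inv-pos {x} 0<x with #⇒<⊎> (H.invertibleʳ⇒# {inv 0<x} {0#}
      (x , trans (*-congʳ (H.x-0≈x _)) (trans (*-comm _ x) (inv-inverseʳ 0<x))))
    ... | inj₂ 0<y = 0<y
    ... | inj₁ y<0 = ⊥-elim (<-irrefl (sym 1+xy≈0) (+-pos 0<1 (*-pos 0<x (<⇒0<- y<0))))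
      where
      1+xy≈0 : 1# + x * (- inv 0<x) ≈ 0#
      1+xy≈0 = begin
        1# + x * (- inv 0<x)  ≈⟨ +-congˡ (sym (R.-‿distribʳ-* x _)) ⟩
        1# - x * inv 0<x      ≈⟨ +-congˡ (-‿cong (inv-inverseʳ 0<x)) ⟩
        1# - 1#               ≈⟨ -‿inverseʳ 1# ⟩
        0#                    ∎

    pos-cancelʳ : ∀ {x y} → 0# < y → 0# < x * y → 0# < x
    pos-cancelʳ {x} {y} 0<y 0<xy = <-respʳ-≈ eq (*-pos 0<xy (inv-pos 0<y))
      where
      eq : x * y * inv 0<y ≈ x
      eq = trans (*-assoc x y _) (trans (*-congˡ (inv-inverseʳ 0<y)) (*-identityʳ x))

    pos+nonNeg : ∀ {x s} → 0# < x → 0# ≤ s → 0# < x + s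
    pos+nonNeg {x} {s} 0<x 0≤s = case (#-cotrans (<⇒# s<x+s) 0#)
      where
      s<x+s : s < x + s
      s<x+s = <-respˡ-≈ (+-identityʳ s) (<-respʳ-≈ (+-comm s x) (+-monoʳ-< s 0<x))

      case : s # 0# ⊎ 0# # (x + s) → 0# < x + s
      case (inj₁ s#0) with #⇒<⊎> s#0
      ... | inj₁ s<0 = ⊥-elim (0≤s s<0)
      ... | inj₂ 0<s = <-trans 0<s s<x+s
      case (inj₂ 0#x+s) with #⇒<⊎> 0#x+s
      ... | inj₁ 0<x+s = 0<x+s
      ... | inj₂ x+s<0 = ⊥-elim (0≤s (<-trans s<x+s x+s<0))

    pos : ∀ {n} → 0 ℕ.< n → 0# < fromℕ n
    pos {suc n} _ = fromℕ-pos n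

    1/-pos : ∀ {n} → 0 ℕ.< n → 0# < 1/ n
    1/-pos {suc n} _ = inv-pos (fromℕ-pos n)

    1/-inverseʳ : ∀ {n} → 0 ℕ.< n → fromℕ n * 1/ n ≈ 1#
    1/-inverseʳ {suc n} _ = inv-inverseʳ (fromℕ-pos n)

    0<b : 0 ℕ.< b
    0<b = ℕ.<-≤-trans 0<Δ (ℕ.≤-trans (ℕ.m≤n*m Δ 4) 4Δ≤b)

    α-pos : 0# < α
    α-pos = *-pos (pos 0<b) (1/-pos 0<Δ)

    γ : Carrier
    γ = fromℕ (b ∸ 4 ℕ.* Δ) * 1/ Δ

    α≈γ+4 : α ≈ γ + fromℕ 4
    α≈γ+4 = begin
      fromℕ b * D
        ≡⟨ ≡.cong (λ m → fromℕ m * D) (≡.sym (ℕ.m∸n+n≡m 4Δ≤b)) ⟩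
      fromℕ (b ∸ 4 ℕ.* Δ ℕ.+ 4 ℕ.* Δ) * D
        ≈⟨ *-congʳ (M.×-homo-+ 1# (b ∸ 4 ℕ.* Δ) (4 ℕ.* Δ)) ⟩
      (fromℕ (b ∸ 4 ℕ.* Δ) + fromℕ (4 ℕ.* Δ)) * D
        ≈⟨ distribʳ D _ _ ⟩
      γ + fromℕ (4 ℕ.* Δ) * D
        ≈⟨ +-congˡ (*-congʳ (M.×1-homo-* 4 Δ)) ⟩
      γ + fromℕ 4 * fromℕ Δ * D
        ≈⟨ +-congˡ (*-assoc _ _ D) ⟩
      γ + fromℕ 4 * (fromℕ Δ * D)
        ≈⟨ +-congˡ (*-congˡ (1/-inverseʳ 0<Δ)) ⟩
      γ + fromℕ 4 * 1#
        ≈⟨ +-congˡ (*-identityʳ _) ⟩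
      γ + fromℕ 4 ∎
      where D = 1/ Δ

    αα≈αγ+4α : α * α ≈ α * γ + fromℕ 4 * α
    αα≈αγ+4α = trans (*-congˡ α≈γ+4) (trans (distribˡ α γ _) (+-congˡ (*-comm α _)))

    radicand≈αγ : radicand ≈ α * γ
    radicand≈αγ = begin
      α * α - fromℕ 4 * α                  ≈⟨ +-congʳ αα≈αγ+4α ⟩
      α * γ + fromℕ 4 * α - fromℕ 4 * α    ≈⟨ +-assoc _ _ _ ⟩
      α * γ + (fromℕ 4 * α - fromℕ 4 * α)  ≈⟨ +-congˡ (-‿inverseʳ _) ⟩
      α * γ + 0#                           ≈⟨ +-identityʳ _ ⟩
      α * γ                                ∎

    0≤αγ : 0# ≤ α * γ
    0≤αγ with b ∸ 4 ℕ.* Δ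
    ... | zero  = <-irrefl (trans (*-congˡ (zeroˡ _)) (zeroʳ α))
    ... | suc m = <-asym (*-pos α-pos (*-pos (fromℕ-pos m) (1/-pos 0<Δ)))

  radicand-nonNeg : 0# ≤ radicand
  radicand-nonNeg = 0≤αγ ∘ <-respˡ-≈ radicand≈αγ

  denominator : Carrier
  denominator = fromℕ 2 + α - √ radicand radicand-nonNeg

  private
    s T : Carrier
    s = √ radicand radicand-nonNeg
    T = fromℕ 2 + α

    T≈d+s : T ≈ denominator + s
    T≈d+s = sym (trans (+-assoc T (- s) s) (trans (+-congˡ (-‿inverseˡ s)) (+-identityʳ T)))

    d[T+s]≈4+8α : denominator * (T + s) ≈ fromℕ 4 + fromℕ 8 * α
    d[T+s]≈4+8α = R.+-cancelʳ (s * s) _ _ (begin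
      d * (T + s) + s * s
        ≈⟨ +-congʳ (*-congˡ (+-congʳ T≈d+s)) ⟩
      d * (d + s + s) + s * s
        ≈⟨ solve 2 (λ d s → d :* (d :+ s :+ s) :+ s :* s := (d :+ s) :* (d :+ s)) refl d s ⟩
      (d + s) * (d + s)
        ≈⟨ *-cong T≈d+s T≈d+s ⟨
      T * T
        ≈⟨ solve 1 (λ a → (nat 2 :+ a) :* (nat 2 :+ a) := nat 4 :+ nat 4 :* a :+ a :* a) refl α ⟩
      fromℕ 4 + fromℕ 4 * α + α * α
        ≈⟨ +-congˡ αα≈αγ+4α ⟩
      fromℕ 4 + fromℕ 4 * α + (α * γ + fromℕ 4 * α)
        ≈⟨ solve 2 (λ a p → nat 4 :+ nat 4 :* a :+ (p :+ nat 4 :* a) := nat 4 :+ nat 8 :* a :+ p)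
                 refl α (α * γ) ⟩
      fromℕ 4 + fromℕ 8 * α + α * γ
        ≈⟨ +-congˡ (trans (√-square radicand radicand-nonNeg) radicand≈αγ) ⟨
      fromℕ 4 + fromℕ 8 * α + s * s ∎)
      where
      d = denominator
      open SemiringSolver commutativeSemiring

      nat : ∀ {m} → ℕ → Polynomial m
      nat zero    = con 0
      nat (suc n) = con 1 :+ nat n

  denominator-pos : 0# < denominator
  denominator-pos = pos-cancelʳ
    (pos+nonNeg (+-pos (fromℕ-pos 1) α-pos) (√-nonNeg radicand radicand-nonNeg))
    (<-respʳ-≈ (sym d[T+s]≈4+8α) (+-pos (fromℕ-pos 3) (*-pos (fromℕ-pos 7) α-pos)))

  ratio : Carrier
  ratio = fromℕ 4 * fromℕ b * inv denominator-pos

  ratio-pos : 0# < ratio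
  ratio-pos = *-pos (*-pos (fromℕ-pos 3) (pos 0<b)) (inv-pos denominator-pos)

  entropyBound : ℕ → Carrier
  entropyBound k = fromℕ k * ln ratio ratio-pos

------------------------------------------------------------------------
-- The algorithm

module MoserTardos {c ℓ₁ ℓ₂} (ℛ : RealField c ℓ₁ ℓ₂)
                   {n k b : ℕ} (G : Graph n) (𝓟 : Partition n k b) where

  open RealField ℛ hiding (sym)
  open Graph G using (_~_; _~?_; edges; Independent)
  open Partition 𝓟

  Vertex Event Selection : Set
  Vertex    = Fin n
  Event     = Vertex × Vertex
  Selection = Vec Vertex k        -- the values of (X₁ , … , X_k)

  _≟ˢ_ : (x y : Selection) → Dec (x ≡ y)
  _≟ˢ_ = Vec.≡-dec Fin._≟_

  Selected : Selection → Pred Vertex 0ℓ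
  Selected x v = lookup x (block v) ≡ v

  selected? : ∀ x → Decidable₁ (Selected x)
  selected? x v = lookup x (block v) Fin.≟ v

  selectedSet : Selection → Subset n
  selectedSet x = tabulate (λ v → does (selected? x v))

  IsIndependentTransversal : Subset n → Set
  IsIndependentTransversal I = Independent I × (∀ i → ∣ I ∩ V i ∣ ≡ 1)

  trueEvents : Selection → List Event
  trueEvents x = filter (λ (u , v) → selected? x u ×-dec selected? x v) edges

  isIndependentTransversal? : Decidable₁ IsIndependentTransversal
  isIndependentTransversal? I =
    Dec.map′ (λ f {u} {v} → f u v) (λ f u v → f {u} {v})
      (Fin.all? λ u → Fin.all? λ v → u ∈? I →-dec v ∈? I →-dec ¬? (u ~? v))
    ×-dec Fin.all? λ i → ∣ I ∩ V i ∣ ℕ.≟ 1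

  allSelections : ∀ m → List (Vec Vertex m)
  allSelections zero    = [] ∷ []
  allSelections (suc m) = cartesianProductWith _∷_ (allFin n) (allSelections m)

  -- An independent transversal I is represented by the tuple whose i-th entry
  -- is the unique vertex of I in V i, so each one occurs exactly once here.
  independentTransversals : List Selection
  independentTransversals =
    filter (isIndependentTransversal? ∘ selectedSet) (allSelections k)

  -- Finitely supported distributions: lists of outcomes with weights, in
  -- which an outcome may occur several times.

  Dist : Set → Set c
  Dist A = List (A × Carrier)

  private variable
    A B : Set

  return : A → Dist A
  return a = (a , 1#) ∷ []

  infixl 1 _>>=_
  _>>=_ : Dist A → (A → Dist B) → Dist B
  d >>= f = concatMap (λ (a , p) → List.map (λ (b , q) → b , p * q) (f a)) d

  Pr : Dist A → {P : Pred A 0ℓ} → Decidable₁ P → Carrier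
  Pr d P? = sum (List.map proj₂ (filter (P? ∘ proj₁) d))

  uniform : List A → Dist A
  uniform as = List.map (λ a → a , 1/ length as) as

  independently : ∀ {m} → Vec (Dist A) m → Dist (Vec A m)
  independently []       = return []
  independently (d ∷ ds) = d >>= λ a → independently ds >>= λ as → return (a ∷ as)

  draw : Fin k → Dist Vertex
  draw i = uniform (members i)

  -- The earlier rounds of a run, latest first: the selection at the start of
  -- the round and the bad event that was then chosen.
  Past : Set
  Past = List (Selection × Event)

  -- A randomized rule gives, for every past and current selection, a
  -- probability distribution on the bad events that are currently true.
  record Rule : Set (c ⊔ˡ ℓ₁ ⊔ˡ ℓ₂) where
    field
      weight : Past → Selection → Event → Carrier
      nonNeg : ∀ past x e → e ∈ˡ trueEvents x → 0# ≤ weight past x e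
      total  : ∀ past x → trueEvents x ≢ [] →
               sum (List.map (weight past x) (trueEvents x)) ≈ 1#

    choose : Past → Selection → Dist Event
    choose past x = List.map (λ e → e , weight past x e) (trueEvents x)

  Terminated : Pred (Past × Selection) 0ℓ
  Terminated (_ , x) = trueEvents x ≡ []

  terminated? : Decidable₁ Terminated
  terminated? (_ , x) with trueEvents x
  ... | []    = Dec.yes ≡.refl
  ... | _ ∷ _ = Dec.no λ ()

  TerminatedAt : Selection → Pred (Past × Selection) 0ℓ
  TerminatedAt y (past , x) = Terminated (past , x) × x ≡ y

  terminatedAt? : ∀ y → Decidable₁ (TerminatedAt y)
  terminatedAt? y (past , x) = terminated? (past , x) ×-dec (x ≟ˢ y)

  redraw : Event → Selection → Dist Selection
  redraw (u , v) x = draw (block u) >>= λ u′ → draw (block v) >>= λ v′ →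
                     return (x [ block u ]≔ u′ [ block v ]≔ v′)

  module _ (rule : Rule) where
    open Rule rule

    step : Past × Selection → Dist (Past × Selection)
    step (past , x) = if-terminated (terminated? (past , x))
      where
      if-terminated : Dec (Terminated (past , x)) → Dist (Past × Selection)
      if-terminated (Dec.yes _) = return (past , x)
      if-terminated (Dec.no  _) = choose past x >>= λ e → redraw e x >>= λ x′ →
                                  return ((x , e) ∷ past , x′)

    -- The run after t rounds of redrawing, or at termination if earlier.
    run : ℕ → Dist (Past × Selection)
    run zero    = independently (tabulate draw) >>= λ x → return ([] , x)
    run (suc t) = run t >>= step

    -- Termination by time t is increasing in t, so the probability that the
    -- run ever terminates (at y) is the limit of the probability that it has
    -- terminated (at y) by time t.

    TerminatesAlmostSurely : Set (c ⊔ˡ ℓ₂)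
    TerminatesAlmostSurely = (λ t → Pr (run t) terminated?) ⟶ 1#

    IsOutputDistribution : (Selection → Carrier) → Set (c ⊔ˡ ℓ₂)
    IsOutputDistribution Ω′ = ∀ y → (λ t → Pr (run t) (terminatedAt? y)) ⟶ Ω′ y

{-# OPTIONS --safe #-}
module Submission where

open import Defs
open import Algebra.Bundles using (CommutativeRing)
open import Algebra.Solver.Ring.AlmostCommutativeRing using (fromCommutativeRing; _-Raw-AlmostCommutative⟶_)
open import Data.Bool.Base using (if_then_else_; true; false)
open import Data.Empty using (⊥-elim)
open import Data.Fin.Base as Fin using (Fin; zero; suc)
import Data.Fin.Properties as Fin
open import Data.Fin.Subset using (Subset; ∣_∣; _∩_; _∈_; ⁅_⁆; inside; outside)
open import Data.Fin.Subset.Properties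
  using (_∈?_; x∈⁅y⁆⇒x≡y; x∈⁅x⁆; ∣⁅x⁆∣≡1; ⊆-antisym; x∈p∩q⁺; x∈p∩q⁻)
open import Data.Integer.Base as ℤ using (ℤ; +_; -[1+_])
import Data.Integer.Properties as ℤ
open import Data.List.Base as List
  using (List; []; _∷_; _++_; length; filter; foldr; concatMap; deduplicate; allFin; cartesianProduct)
open import Data.List.Extrema.Nat using (xs≤max)
import Data.List.Membership.DecPropositional as DecMembership
open import Data.List.Membership.Propositional using (_∉_; find) renaming (_∈_ to _∈ˡ_)
open import Data.List.Membership.Propositional.Properties
import Data.List.Properties as List
open import Data.List.Relation.Binary.Subset.Propositional using () renaming (_⊆_ to _⊆ˡ_)
open import Data.List.Relation.Unary.All as All using (All; []; _∷_)
open import Data.List.Relation.Unary.AllPairs using ([]; _∷_)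
open import Data.List.Relation.Unary.Any as Any using (Any; here; there; any?)
open import Data.List.Relation.Unary.Unique.Propositional using (Unique)
import Data.List.Relation.Unary.Unique.DecPropositional.Properties as UniqueDec
import Data.List.Relation.Unary.Unique.Propositional.Properties as Unique
open import Data.Maybe.Base using (Maybe; just; nothing)
open import Data.Nat.Base as ℕ using (ℕ; zero; suc; z≤n; s≤s; _!)
import Data.Nat.Properties as ℕ
open import Data.Product.Base using (∃; Σ-syntax; ∃-syntax; _×_; _,_; proj₁; proj₂)
import Data.Product.Properties as Product
import Data.Sign.Base as Sign
open import Data.Sum.Base using (_⊎_; inj₁; inj₂)
open import Data.Vec.Base as Vec using (Vec; []; _∷_; lookup; tabulate; _[_]≔_; updateAt)
import Data.Vec.Properties as Vec
open import Function.Base using (_∘_)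
open import Level using (Level; 0ℓ)
open import Relation.Binary.Bundles using (Preorder)
open import Relation.Binary.Definitions using (DecidableEquality; Tri; tri<; tri≈; tri>)
open import Relation.Binary.PropositionalEquality as ≡ using (_≡_; _≢_; module ≡-Reasoning)
open import Relation.Nullary.Decidable using (dec-true)
open import Relation.Nullary.Decidable.Core using (Dec; yes; no; does; ¬?; _×-dec_; _⊎-dec_)
open import Relation.Nullary.Negation.Core using (¬_)
open import Relation.Unary using (Pred) renaming (Decidable to Decidable₁)
import Algebra.Apartness.Properties.HeytingCommutativeRing
import Algebra.Properties.CommutativeSemiring.Exp
import Algebra.Properties.Ring
import Algebra.Properties.Semiring.Exp
import Algebra.Properties.Semiring.Mult
import Algebra.Properties.Semiring.Mult.TCOptimised
import Algebra.Solver.Ring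
import Relation.Binary.Reasoning.Preorder as PreorderReasoning
import Relation.Binary.Reasoning.Setoid as SetoidReasoning

-- The rounds of a run that ends at y form a heap of edges over the blocks:
-- rounds in disjoint blocks commute, and piling up the edges backwards in time
-- from y recovers the current selection x as the tops of the stacks.  So the
-- weight, with 1/b² for each edge, of all heaps on y with tops x is
-- superharmonic for the run.  Hence P(X = y) ≤ b⁻ᵏ Σ b^(−2|h|) over all heaps
-- h, and the probability of still running after t rounds, which decreases with
-- t, is bounded by a multiple of the terms |h| = t; so it is O(1/t).
--
-- Splitting off the edges at the base of a heap, and bounding what lies above
-- each of the two blocks of such an edge by z, the smaller root of
-- z² − αz + α = 0, turns the sum over heaps into one over the matchings of the
-- blocks.  As each of the at most bΔ edges at a block is shared between two
-- blocks, that sum is at most (1 + bΔ z²/(2b²))ᵏ = ((1 + z)/2)ᵏ = (b/ratio)ᵏ.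
-- Taking logarithms needs exp (x + y) = exp x exp y, from the Cauchy product.

-- Since the rule may use the whole past, only estimates that hold for every true event are of use:
-- averaging over the choice then preserves them. Plain words of chosen edges would be too many, as
-- there are |links|^m of length m and |links| can grow with `k`; identifying words up to
-- commutation leaves a growth that is local to a block. There z solves z = 1 + z²/α: on a block
-- lies nothing, or one of at most bΔ edges of weight 1/b² at the base, on whose two blocks the same
-- may lie again. This is the quadratic equation divided by α, and b ≥ 4Δ is what makes its roots
-- real. Generating functions are truncated throughout, so a solution z bounds them by induction and
-- no convergence has to be known in advance. The order of the field is not assumed decidable.
-- Bounded monotone sequences therefore need not converge, and the output distribution is obtained
-- from Cauchy completeness; the rate 1/t supplies the modulus. For the same reason signs are found
-- by apartness or cotransitivity instead of case distinction.

-- Equality in the field is undecidable; with integer coefficients the ring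
-- solver can nevertheless recognise cancellations.
module IntegerSolver {c ℓ} (R : CommutativeRing c ℓ) where
  open CommutativeRing R
  open Algebra.Properties.Ring ring
  open Algebra.Properties.Semiring.Mult.TCOptimised semiring using (×-homo-+; ×1-homo-*) renaming (_×_ to _×ᵣ_)
  open SetoidReasoning setoid

  private
    ⟦_⟧ : ℤ → Carrier
    ⟦ + n ⟧      = n ×ᵣ 1#
    ⟦ -[1+ n ] ⟧ = - (suc n ×ᵣ 1#)

    cancel-1 : ∀ x y → (1# + x) - (1# + y) ≈ x - y
    cancel-1 x y = begin
      (1# + x) - (1# + y)        ≈⟨ +-cong (+-comm 1# x) (sym (-‿+-comm 1# y)) ⟩
      (x + 1#) + (- 1# + - y)    ≈⟨ +-assoc x 1# _ ⟩
      x + (1# + (- 1# + - y))    ≈⟨ +-congˡ (+-assoc 1# (- 1#) (- y)) ⟨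
      x + (1# - 1# + - y)        ≈⟨ +-congˡ (+-congʳ (-‿inverseʳ 1#)) ⟩
      x + (0# + - y)             ≈⟨ +-congˡ (+-identityˡ _) ⟩
      x - y                      ∎

    ⊖-homo : ∀ m n → ⟦ m ℤ.⊖ n ⟧ ≈ m ×ᵣ 1# - n ×ᵣ 1#
    ⊖-homo zero    zero    = sym (-‿inverseʳ 0#)
    ⊖-homo zero    (suc n) = sym (+-identityˡ _)
    ⊖-homo (suc m) zero    = sym (trans (+-congˡ -0#≈0#) (+-identityʳ _))
    ⊖-homo (suc m) (suc n) = begin
      ⟦ suc m ℤ.⊖ suc n ⟧              ≡⟨ ≡.cong ⟦_⟧ (ℤ.[1+m]⊖[1+n]≡m⊖n m n) ⟩
      ⟦ m ℤ.⊖ n ⟧                      ≈⟨ ⊖-homo m n ⟩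
      m ×ᵣ 1# - n ×ᵣ 1#                  ≈⟨ cancel-1 _ _ ⟨
      (1# + m ×ᵣ 1#) - (1# + n ×ᵣ 1#)    ≈⟨ +-cong (×-homo-+ 1# 1 m) (-‿cong (×-homo-+ 1# 1 n)) ⟨
      suc m ×ᵣ 1# - suc n ×ᵣ 1#          ∎

    +-homo : ∀ i j → ⟦ i ℤ.+ j ⟧ ≈ ⟦ i ⟧ + ⟦ j ⟧
    +-homo (+ m)      (+ n)      = ×-homo-+ 1# m n
    +-homo (+ m)      (-[1+ n ]) = ⊖-homo m (suc n)
    +-homo (-[1+ m ]) (+ n)      = trans (⊖-homo n (suc m)) (+-comm _ _)
    +-homo (-[1+ m ]) (-[1+ n ]) = begin
      - (suc (suc (m ℕ.+ n)) ×ᵣ 1#)       ≡⟨ ≡.cong (λ l → - (l ×ᵣ 1#)) (ℕ.+-suc (suc m) n) ⟨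
      - ((suc m ℕ.+ suc n) ×ᵣ 1#)         ≈⟨ -‿cong (×-homo-+ 1# (suc m) (suc n)) ⟩
      - (suc m ×ᵣ 1# + suc n ×ᵣ 1#)        ≈⟨ -‿+-comm _ _ ⟨
      - (suc m ×ᵣ 1#) - suc n ×ᵣ 1#        ∎

    -‿homo : ∀ i → ⟦ ℤ.- i ⟧ ≈ - ⟦ i ⟧
    -‿homo (+ zero)    = sym -0#≈0#
    -‿homo (+ suc n)   = refl
    -‿homo (-[1+ n ])  = sym (-‿involutive _)

    ⟦-◃⟧ : ∀ n → ⟦ Sign.- ℤ.◃ n ⟧ ≈ - (n ×ᵣ 1#)
    ⟦-◃⟧ zero    = sym -0#≈0#
    ⟦-◃⟧ (suc n) = refl

    ⟦+◃⟧ : ∀ n → ⟦ Sign.+ ℤ.◃ n ⟧ ≈ n ×ᵣ 1#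
    ⟦+◃⟧ zero    = refl
    ⟦+◃⟧ (suc n) = refl

    *-homo : ∀ i j → ⟦ i ℤ.* j ⟧ ≈ ⟦ i ⟧ * ⟦ j ⟧
    *-homo (+ m)      (+ n)      = trans (⟦+◃⟧ (m ℕ.* n)) (×1-homo-* m n)
    *-homo (+ m)      (-[1+ n ]) =
      trans (⟦-◃⟧ (m ℕ.* suc n)) (trans (-‿cong (×1-homo-* m (suc n))) (-‿distribʳ-* _ _))
    *-homo (-[1+ m ]) (+ n)      =
      trans (⟦-◃⟧ (suc m ℕ.* n)) (trans (-‿cong (×1-homo-* (suc m) n)) (-‿distribˡ-* _ _))
    *-homo (-[1+ m ]) (-[1+ n ]) = begin
      (suc m ℕ.* suc n) ×ᵣ 1#             ≈⟨ ×1-homo-* (suc m) (suc n) ⟩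
      suc m ×ᵣ 1# * suc n ×ᵣ 1#            ≈⟨ -‿involutive _ ⟨
      - - (suc m ×ᵣ 1# * suc n ×ᵣ 1#)      ≈⟨ -‿cong (-‿distribˡ-* _ _) ⟩
      - (- (suc m ×ᵣ 1#) * suc n ×ᵣ 1#)    ≈⟨ -‿distribʳ-* _ _ ⟩
      - (suc m ×ᵣ 1#) * - (suc n ×ᵣ 1#)    ∎


    homomorphism : ℤ.+-*-rawRing -Raw-AlmostCommutative⟶ fromCommutativeRing R
    homomorphism = record
      { ⟦_⟧ = ⟦_⟧ ; +-homo = +-homo ; *-homo = *-homo ; -‿homo = -‿homo
      ; 0-homo = refl ; 1-homo = refl }

    _≟_ : ∀ i j → Maybe (⟦ i ⟧ ≈ ⟦ j ⟧)
    i ≟ j with i ℤ.≟ j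
    ... | yes ≡.refl = just refl
    ... | no  _      = nothing

  open Algebra.Solver.Ring ℤ.+-*-rawRing (fromCommutativeRing R) homomorphism _≟_ public
    using (Polynomial; solve; _:=_; _:+_; _:*_; _:-_; :-_; con)

  :1 : ∀ {m} → Polynomial m
  :1 = con (+ 1)

  nat : ∀ {m} → ℕ → Polynomial m
  nat zero    = con (+ 0)
  nat (suc n) = :1 :+ nat n

-- Order and arithmetic in a constructive ordered field

module OrderedFieldProperties {c ℓ₁ ℓ₂} (F : ArchimedeanField c ℓ₁ ℓ₂) where
  open ArchimedeanField F
  open IntegerSolver commutativeRing public
  open Algebra.Properties.Ring ring public using (-0#≈0#; -‿involutive)
  open Algebra.Properties.Semiring.Mult semiring using (×-homo-+; ×1-homo-*)
  private
    module H = Algebra.Apartness.Properties.HeytingCommutativeRing heytingCommutativeRing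

  <-cotrans : ∀ {x y} → x < y → ∀ z → x < z ⊎ z < y
  <-cotrans x<y z with #-cotrans (<⇒# x<y) z
  ... | inj₁ x#z with #⇒<⊎> x#z
  ...   | inj₁ x<z = inj₁ x<z
  ...   | inj₂ z<x = inj₂ (<-trans z<x x<y)
  <-cotrans x<y z | inj₂ z#y with #⇒<⊎> z#y
  ...   | inj₁ z<y = inj₂ z<y
  ...   | inj₂ y<z = inj₁ (<-trans x<y y<z)

  ≤-reflexive : ∀ {x y} → x ≈ y → x ≤ y
  ≤-reflexive x≈y = <-irrefl (sym x≈y)

  ≤-refl : ∀ {x} → x ≤ x
  ≤-refl = ≤-reflexive refl

  <⇒≤ : ∀ {x y} → x < y → x ≤ y
  <⇒≤ = <-asym

  ≤-trans : ∀ {x y z} → x ≤ y → y ≤ z → x ≤ z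
  ≤-trans {y = y} x≤y y≤z z<x with <-cotrans z<x y
  ... | inj₁ z<y = y≤z z<y
  ... | inj₂ y<x = x≤y y<x

  ≤-antisym : ∀ {x y} → x ≤ y → y ≤ x → x ≈ y
  ≤-antisym {x} {y} x≤y y≤x = proj₁ (tight x y) ¬x#y
    where
    ¬x#y : ¬ (x # y)
    ¬x#y x#y with #⇒<⊎> x#y
    ... | inj₁ x<y = y≤x x<y
    ... | inj₂ y<x = x≤y y<x

  <-≤-trans : ∀ {x y z} → x < y → y ≤ z → x < z
  <-≤-trans {z = z} x<y y≤z with <-cotrans x<y z
  ... | inj₁ x<z = x<z
  ... | inj₂ z<y = ⊥-elim (y≤z z<y)

  ≤-<-trans : ∀ {x y z} → x ≤ y → y < z → x < z
  ≤-<-trans {x} x≤y y<z with <-cotrans y<z x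
  ... | inj₁ y<x = ⊥-elim (x≤y y<x)
  ... | inj₂ x<z = x<z

  ≤-respˡ-≈ : ∀ {x y z} → x ≈ y → x ≤ z → y ≤ z
  ≤-respˡ-≈ x≈y = ≤-trans (≤-reflexive (sym x≈y))

  ≤-respʳ-≈ : ∀ {x y z} → x ≈ y → z ≤ x → z ≤ y
  ≤-respʳ-≈ x≈y z≤x = ≤-trans z≤x (≤-reflexive x≈y)

  ≤-preorder : Preorder c ℓ₁ ℓ₂
  ≤-preorder = record
    { _≈_ = _≈_ ; _≲_ = _≤_
    ; isPreorder = record
      { isEquivalence = isEquivalence ; reflexive = ≤-reflexive ; trans = ≤-trans } }

  module ≤-Reasoning = PreorderReasoning ≤-preorder
    renaming (step-≲ to step-≤)

  abstract
    +-cancelˡ-< : ∀ z {x y} → z + x < z + y → x < y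
    +-cancelˡ-< z {x} {y} lt = <-respˡ-≈ (eq x) (<-respʳ-≈ (eq y) (+-monoʳ-< (- z) lt))
      where
      eq : ∀ x → - z + (z + x) ≈ x
      eq x = solve 2 (λ z x → :- z :+ (z :+ x) := x) refl z x

    +-monoʳ-≤ : ∀ z {x y} → x ≤ y → z + x ≤ z + y
    +-monoʳ-≤ z x≤y lt = x≤y (+-cancelˡ-< z lt)

    +-monoˡ-≤ : ∀ z {x y} → x ≤ y → x + z ≤ y + z
    +-monoˡ-≤ z {x} {y} x≤y = ≤-respˡ-≈ (+-comm z x) (≤-respʳ-≈ (+-comm z y) (+-monoʳ-≤ z x≤y))

    +-mono-≤ : ∀ {x y u v} → x ≤ y → u ≤ v → x + u ≤ y + v
    +-mono-≤ {y = y} {u} x≤y u≤v = ≤-trans (+-monoˡ-≤ u x≤y) (+-monoʳ-≤ y u≤v)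

    +-monoˡ-< : ∀ z {x y} → x < y → x + z < y + z
    +-monoˡ-< z {x} {y} x<y = <-respˡ-≈ (+-comm z x) (<-respʳ-≈ (+-comm z y) (+-monoʳ-< z x<y))

    +-mono-< : ∀ {x y u v} → x < y → u < v → x + u < y + v
    +-mono-< {y = y} {u} x<y u<v = <-trans (+-monoˡ-< u x<y) (+-monoʳ-< y u<v)

    +-nonNeg : ∀ {x y} → 0# ≤ x → 0# ≤ y → 0# ≤ x + y
    +-nonNeg 0≤x 0≤y = ≤-respˡ-≈ (+-identityˡ 0#) (+-mono-≤ 0≤x 0≤y)

    x≤x+y : ∀ {x y} → 0# ≤ y → x ≤ x + y
    x≤x+y {x} 0≤y = ≤-respˡ-≈ (+-identityʳ x) (+-monoʳ-≤ x 0≤y)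

    x<y⇒0<y-x : ∀ {x y} → x < y → 0# < y - x
    x<y⇒0<y-x {x} x<y = <-respˡ-≈ (-‿inverseʳ x) (+-monoˡ-< (- x) x<y)

    x≤y⇒0≤y-x : ∀ {x y} → x ≤ y → 0# ≤ y - x
    x≤y⇒0≤y-x {x} x≤y = ≤-respˡ-≈ (-‿inverseʳ x) (+-monoˡ-≤ (- x) x≤y)

    y-x+x≈y : ∀ y x → y - x + x ≈ y
    y-x+x≈y = solve 2 (λ y x → y :- x :+ x := y) refl

    0<y-x⇒x<y : ∀ {x y} → 0# < y - x → x < y
    0<y-x⇒x<y {x} {y} lt = <-respˡ-≈ (+-identityˡ x) (<-respʳ-≈ (y-x+x≈y y x) (+-monoˡ-< x lt))

    0≤y-x⇒x≤y : ∀ {x y} → 0# ≤ y - x → x ≤ y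
    0≤y-x⇒x≤y {x} {y} lt = ≤-respˡ-≈ (+-identityˡ x) (≤-respʳ-≈ (y-x+x≈y y x) (+-monoˡ-≤ x lt))

    x≤z+y⇒x-y≤z : ∀ {x y z} → x ≤ z + y → x - y ≤ z
    x≤z+y⇒x-y≤z {x} {y} {z} le = ≤-respʳ-≈ (solve 2 (λ z y → z :+ y :- y := z) refl z y) (+-monoˡ-≤ (- y) le)

    neg-mono-≤ : ∀ {x y} → x ≤ y → - y ≤ - x
    neg-mono-≤ {x} {y} x≤y = 0≤y-x⇒x≤y
      (≤-respʳ-≈ (solve 2 (λ x y → y :- x := :- x :- :- y) refl x y) (x≤y⇒0≤y-x x≤y))

    *-inverseʳ : ∀ {x} (0<x : 0# < x) → x * inv 0<x ≈ 1#
    *-inverseʳ {x} 0<x = trans (*-congʳ (sym (H.x-0≈x x))) (proj₂ (proj₂ (#⇒invertible (#-sym (<⇒# 0<x)))))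

    -- A nonzero product has nonzero factors, because they are invertible.
    *-#0ˡ : ∀ {x y} → x * y # 0# → x # 0#
    *-#0ˡ {x} {y} xy#0 with #⇒invertible xy#0
    ... | w , _ , xyw≈1 = H.invertibleʳ⇒# (y * w , (begin
      (x - 0#) * (y * w)    ≈⟨ *-congʳ (H.x-0≈x x) ⟩
      x * (y * w)           ≈⟨ *-assoc x y w ⟨
      x * y * w             ≈⟨ *-congʳ (H.x-0≈x (x * y)) ⟨
      (x * y - 0#) * w      ≈⟨ xyw≈1 ⟩
      1#                    ∎))
      where open SetoidReasoning setoid

    0≤x∧x#0⇒0<x : ∀ {x} → 0# ≤ x → x # 0# → 0# < x
    0≤x∧x#0⇒0<x 0≤x x#0 with #⇒<⊎> x#0
    ... | inj₁ x<0 = ⊥-elim (0≤x x<0)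
    ... | inj₂ 0<x = 0<x

    -- The signs of the factors cannot be tested. But a negative product is apart from 0, so both
    -- factors are apart from 0 as well, hence positive, and then so is their product.
    *-nonNeg : ∀ {x y} → 0# ≤ x → 0# ≤ y → 0# ≤ x * y
    *-nonNeg {x} {y} 0≤x 0≤y xy<0 = <-asym xy<0 (*-pos
      (0≤x∧x#0⇒0<x 0≤x (*-#0ˡ (<⇒# xy<0)))
      (0≤x∧x#0⇒0<x 0≤y (*-#0ˡ (H.#-congʳ (*-comm x y) (<⇒# xy<0)))))

    *-monoˡ-≤ : ∀ {z x y} → 0# ≤ z → x ≤ y → z * x ≤ z * y
    *-monoˡ-≤ {z} {x} {y} 0≤z x≤y = 0≤y-x⇒x≤y (≤-respʳ-≈
      (solve 3 (λ z x y → z :* (y :- x) := z :* y :- z :* x) refl z x y)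
      (*-nonNeg 0≤z (x≤y⇒0≤y-x x≤y)))

    *-monoʳ-≤ : ∀ {z x y} → 0# ≤ z → x ≤ y → x * z ≤ y * z
    *-monoʳ-≤ {z} {x} {y} 0≤z x≤y =
      ≤-respˡ-≈ (*-comm z x) (≤-respʳ-≈ (*-comm z y) (*-monoˡ-≤ 0≤z x≤y))

    *-mono-≤ : ∀ {x y u v} → 0# ≤ x → 0# ≤ v → x ≤ y → u ≤ v → x * u ≤ y * v
    *-mono-≤ 0≤x 0≤v x≤y u≤v = ≤-trans (*-monoˡ-≤ 0≤x u≤v) (*-monoʳ-≤ 0≤v x≤y)

    *-monoˡ-< : ∀ {z x y} → 0# < z → x < y → z * x < z * y
    *-monoˡ-< {z} {x} {y} 0<z x<y = 0<y-x⇒x<y (<-respʳ-≈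
      (solve 3 (λ z x y → z :* (y :- x) := z :* y :- z :* x) refl z x y)
      (*-pos 0<z (x<y⇒0<y-x x<y)))

    square-nonNeg : ∀ x → 0# ≤ x * x
    square-nonNeg x xx<0 with #⇒<⊎> (*-#0ˡ (<⇒# xx<0))
    ... | inj₂ 0<x = <-asym xx<0 (*-pos 0<x 0<x)
    ... | inj₁ x<0 = <-asym xx<0 (<-respʳ-≈
      (solve 1 (λ x → (nat 0 :- x) :* (nat 0 :- x) := x :* x) refl x)
      (*-pos (x<y⇒0<y-x x<0) (x<y⇒0<y-x x<0)))

    -- The inverse `i` equals `x * (i * i)`, and the square `i * i` is apart from 0 because it
    -- divides 1.
    inv-pos : ∀ {x} (0<x : 0# < x) → 0# < inv 0<x
    inv-pos {x} 0<x = pos (inv 0<x) (*-inverseʳ 0<x)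
      where
      open SetoidReasoning setoid
      pos : ∀ i → x * i ≈ 1# → 0# < i
      pos i xi≈1 = <-respʳ-≈ (begin
        x * (i * i)    ≈⟨ *-assoc x i i ⟨
        x * i * i      ≈⟨ *-congʳ xi≈1 ⟩
        1# * i         ≈⟨ *-identityˡ i ⟩
        i              ∎) (*-pos 0<x (0≤x∧x#0⇒0<x (square-nonNeg i) (*-#0ˡ {y = x * x} (H.#-congʳ (begin
        1#                 ≈⟨ *-identityˡ 1# ⟨
        1# * 1#            ≈⟨ *-cong xi≈1 xi≈1 ⟨
        x * i * (x * i)    ≈⟨ solve 2 (λ x i → (x :* i) :* (x :* i) := i :* i :* (x :* x)) refl x i ⟩
        i * i * (x * x)    ∎) H.1#0))))

    0≤1 : 0# ≤ 1#
    0≤1 = <⇒≤ 0<1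

    fromℕ-nonNeg : ∀ n → 0# ≤ fromℕ n
    fromℕ-nonNeg zero    = ≤-refl
    fromℕ-nonNeg (suc n) = <⇒≤ (fromℕ-pos n)

    fromℕ-mono-≤ : ∀ {m n} → m ℕ.≤ n → fromℕ m ≤ fromℕ n
    fromℕ-mono-≤ {n = n} z≤n = fromℕ-nonNeg n
    fromℕ-mono-≤ (s≤s le) = +-monoʳ-≤ 1# (fromℕ-mono-≤ le)

    fromℕ-+ : ∀ m n → fromℕ (m ℕ.+ n) ≈ fromℕ m + fromℕ n
    fromℕ-+ = ×-homo-+ 1#

    fromℕ-* : ∀ m n → fromℕ (m ℕ.* n) ≈ fromℕ m * fromℕ n
    fromℕ-* = ×1-homo-*

    1/-inverseʳ : ∀ {n} → 0 ℕ.< n → fromℕ n * 1/ n ≈ 1#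
    1/-inverseʳ {suc n} _ = *-inverseʳ (fromℕ-pos n)

    1/-pos : ∀ {n} → 0 ℕ.< n → 0# < 1/ n
    1/-pos {suc n} _ = inv-pos (fromℕ-pos n)

    ^-nonNeg : ∀ {x} → 0# ≤ x → ∀ n → 0# ≤ x ^ n
    ^-nonNeg 0≤x zero    = 0≤1
    ^-nonNeg 0≤x (suc n) = *-nonNeg 0≤x (^-nonNeg 0≤x n)

  -- The library has no absolute value; x ≪ X says |x| ≤ X.
  infix 4 _≪_
  record _≪_ (x X : Carrier) : Set ℓ₂ where
    constructor _&_
    field
      upper : x ≤ X
      lower : - x ≤ X

  abstract
    ≪-resp-≈ : ∀ {x y X} → x ≈ y → x ≪ X → y ≪ X
    ≪-resp-≈ x≈y (u & l) = ≤-respˡ-≈ x≈y u & ≤-respˡ-≈ (-‿cong x≈y) l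

    ≪-≤ : ∀ {x X Y} → x ≪ X → X ≤ Y → x ≪ Y
    ≪-≤ (u & l) le = ≤-trans u le & ≤-trans l le

    0≤x⇒x≪x : ∀ {x} → 0# ≤ x → x ≪ x
    0≤x⇒x≪x {x} 0≤x = ≤-refl & ≤-trans (≤-respʳ-≈ -0#≈0# (neg-mono-≤ 0≤x)) 0≤x

    ≪-neg : ∀ {x X} → x ≪ X → - x ≪ X
    ≪-neg (u & l) = l & ≤-respˡ-≈ (sym (-‿involutive _)) u

    ≪-+ : ∀ {x y X Y} → x ≪ X → y ≪ Y → x + y ≪ X + Y
    ≪-+ {x} {y} (u & l) (u′ & l′) = +-mono-≤ u u′ &
      ≤-respˡ-≈ (solve 2 (λ x y → :- x :+ :- y := :- (x :+ y)) refl x y) (+-mono-≤ l l′)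

    private
      halve : ∀ {x} → 0# ≤ x + x → 0# ≤ x
      halve 0≤2x x<0 = 0≤2x (<-respʳ-≈ (+-identityˡ 0#) (+-mono-< x<0 x<0))

      -- XY − xy is the mean of (X − x)(Y + y) and (X + x)(Y − y).
      *-upper : ∀ {x y X Y} → x ≪ X → y ≪ Y → x * y ≤ X * Y
      *-upper {x} {y} {X} {Y} (u & l) (u′ & l′) = 0≤y-x⇒x≤y (halve (≤-respʳ-≈
        (solve 4 (λ x y X Y → (X :- x) :* (Y :- :- y) :+ (X :- :- x) :* (Y :- y)
                           := (X :* Y :- x :* y) :+ (X :* Y :- x :* y)) refl x y X Y)
        (+-nonNeg (*-nonNeg (x≤y⇒0≤y-x u) (x≤y⇒0≤y-x l′)) (*-nonNeg (x≤y⇒0≤y-x l) (x≤y⇒0≤y-x u′)))))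

    ≪-* : ∀ {x y X Y} → x ≪ X → y ≪ Y → x * y ≪ X * Y
    ≪-* {x} {y} x≪X y≪Y = *-upper x≪X y≪Y &
      ≤-respˡ-≈ (solve 2 (λ x y → :- x :* y := :- (x :* y)) refl x y) (*-upper (≪-neg x≪X) y≪Y)

    ≪-^ : ∀ {x X} → x ≪ X → ∀ n → x ^ n ≪ X ^ n
    ≪-^ x≪X zero    = 0≤x⇒x≪x 0≤1
    ≪-^ x≪X (suc n) = ≪-* x≪X (≪-^ x≪X n)

    ∃≪ : ∀ x → ∃ λ n → x ≪ fromℕ n
    ∃≪ x with archimedean x | archimedean (- x)
    ... | m , x<m | n , -x<n = m ℕ.+ n ,
      (≤-trans (<⇒≤ x<m) (fromℕ-mono-≤ (ℕ.m≤m+n m n)) &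
       ≤-trans (<⇒≤ -x<n) (fromℕ-mono-≤ (ℕ.m≤n+m n m)))

-- Limits and Cauchy sequences

module LimitProperties {c ℓ₁ ℓ₂} (F : ArchimedeanField c ℓ₁ ℓ₂) where
  open ArchimedeanField F
  open OrderedFieldProperties F

  half : Carrier → Carrier
  half ε = ε * 1/ 2

  abstract
    half-pos : ∀ {ε} → 0# < ε → 0# < half ε
    half-pos 0<ε = *-pos 0<ε (1/-pos {2} (s≤s z≤n))

    half+half : ∀ ε → half ε + half ε ≈ ε
    half+half ε = begin
      ε * 1/ 2 + ε * 1/ 2    ≈⟨ solve 2 (λ e h → e :* h :+ e :* h := e :* (nat 2 :* h)) refl ε (1/ 2) ⟩
      ε * (fromℕ 2 * 1/ 2)   ≈⟨ *-congˡ (1/-inverseʳ {2} (s≤s z≤n)) ⟩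
      ε * 1#                 ≈⟨ *-identityʳ ε ⟩
      ε                      ∎
      where open SetoidReasoning setoid

  Near⇒≪ : ∀ {ε x y} → Near ε x y → x - y ≪ ε
  Near⇒≪ {x = x} {y} (u , l) = <⇒≤ u & ≤-respˡ-≈ (solve 2 (λ x y → y :- x := :- (x :- y)) refl x y) (<⇒≤ l)

  ≪⇒Near : ∀ {δ ε x y} → x - y ≪ δ → δ < ε → Near ε x y
  ≪⇒Near {x = x} {y} (u & l) lt = ≤-<-trans u lt ,
    ≤-<-trans (≤-respˡ-≈ (solve 2 (λ x y → :- (x :- y) := y :- x) refl x y) l) lt

  ⟶-const : ∀ l → (λ _ → l) ⟶ l
  ⟶-const l ε 0<ε = 0 , λ _ _ → l-l<ε , l-l<ε
    where l-l<ε = <-respˡ-≈ (sym (-‿inverseʳ l)) 0<ε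

  ⟶-resp-≈ : ∀ {x y l m} → (∀ n → x n ≈ y n) → l ≈ m → x ⟶ l → y ⟶ m
  ⟶-resp-≈ x≈y l≈m x⟶l ε 0<ε with x⟶l ε 0<ε
  ... | N , near = N , λ n N≤n →
    <-respˡ-≈ (+-cong (x≈y n) (-‿cong l≈m)) (proj₁ (near n N≤n)) ,
    <-respˡ-≈ (+-cong l≈m (-‿cong (x≈y n))) (proj₂ (near n N≤n))

  ⟶-subsequence : ∀ {x l} (φ : ℕ → ℕ) → (∀ n → n ℕ.≤ φ n) → x ⟶ l → (x ∘ φ) ⟶ l
  ⟶-subsequence φ n≤φn x⟶l ε 0<ε with x⟶l ε 0<ε
  ... | N , near = N , λ n N≤n → near (φ n) (ℕ.≤-trans N≤n (n≤φn n))

  ⟶-squeeze : ∀ {x y u l} → (∀ n → x n - y n ≪ u n) → u ⟶ 0# → y ⟶ l → x ⟶ l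
  ⟶-squeeze {x} {y} {u} {l} x-y≪u u⟶0 y⟶l ε 0<ε
    with u⟶0 (half ε) (half-pos 0<ε) | y⟶l (half ε) (half-pos 0<ε)
  ... | M , u≈0 | N , y≈l = M ℕ.+ N , λ n le →
    let u<ε/2 = <-respˡ-≈ (solve 1 (λ u → u :- nat 0 := u) refl (u n)) (proj₁ (u≈0 n (ℕ.m+n≤o⇒m≤o M le)))
    in ≪⇒Near
      (≪-resp-≈ (solve 3 (λ x y l → (x :- y) :+ (y :- l) := x :- l) refl (x n) (y n) l)
        (≪-+ (x-y≪u n) (Near⇒≪ (y≈l n (ℕ.m+n≤o⇒n≤o M le)))))
      (<-respʳ-≈ (half+half ε) (+-monoˡ-< (half ε) u<ε/2))

  ⟶-+ : ∀ {x y l m} → x ⟶ l → y ⟶ m → (λ n → x n + y n) ⟶ (l + m)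
  ⟶-+ {x} {y} {l} {m} x⟶l y⟶m ε 0<ε
    with x⟶l (half ε) (half-pos 0<ε) | y⟶m (half ε) (half-pos 0<ε)
  ... | M , x≈l | N , y≈m = M ℕ.+ N , λ n le →
    let p , q = x≈l n (ℕ.m+n≤o⇒m≤o M le)
        r , s = y≈m n (ℕ.m+n≤o⇒n≤o M le)
    in <-respˡ-≈ (rearrange (x n) l (y n) m) (<-respʳ-≈ (half+half ε) (+-mono-< p r)) ,
       <-respˡ-≈ (rearrange l (x n) m (y n)) (<-respʳ-≈ (half+half ε) (+-mono-< q s))
    where
    rearrange : ∀ x l y m → (x - l) + (y - m) ≈ (x + y) - (l + m)
    rearrange = solve 4 (λ x l y m → (x :- l) :+ (y :- m) := (x :+ y) :- (l :+ m)) refl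

  -- xy − lm = (x − l) y + l (y − m), where y is eventually bounded by |m| + 1.
  ⟶-* : ∀ {x y l m} → x ⟶ l → y ⟶ m → (λ n → x n * y n) ⟶ (l * m)
  ⟶-* {x} {y} {l} {m} x⟶l y⟶m ε 0<ε with ∃≪ l | ∃≪ m
  ... | A , l≪A | B , m≪B with x⟶l δ 0<δ | y⟶m δ 0<δ | y⟶m 1# 0<1
    where
    δ   = ε * 1/ (suc (suc B ℕ.+ A))
    0<δ = *-pos 0<ε (1/-pos {suc (suc B ℕ.+ A)} (s≤s z≤n))
  ... | M , x≈l | N , y≈m | L , y≈m′ = M ℕ.+ (N ℕ.+ L) , λ n le →
    let M≤n   = ℕ.m+n≤o⇒m≤o M le
        N+L≤n = ℕ.m+n≤o⇒n≤o M le
        N≤n   = ℕ.m+n≤o⇒m≤o N N+L≤n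
        L≤n   = ℕ.m+n≤o⇒n≤o N N+L≤n
        y≪    = ≪-resp-≈ (y-x+x≈y (y n) m) (≪-+ (Near⇒≪ (y≈m′ n L≤n)) m≪B)
    in ≪⇒Near
      (≪-resp-≈
        (solve 4 (λ x l y m → (x :- l) :* y :+ l :* (y :- m) := x :* y :- l :* m) refl (x n) l (y n) m)
        (≪-+ (≪-* (Near⇒≪ (x≈l n M≤n)) y≪) (≪-* l≪A (Near⇒≪ (y≈m n N≤n)))))
      bound
    where
    -- The error is at most `δ * fromℕ (suc B) + fromℕ A * δ`, which is `K` times `δ`; dividing `ε`
    -- by `suc K` leaves one spare `δ` that makes the bound strict.
    K   = suc B ℕ.+ A
    δ   = ε * 1/ (suc K)
    0<δ = *-pos 0<ε (1/-pos {suc K} (s≤s z≤n))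
    eq₁ : fromℕ K * δ ≈ δ * fromℕ (suc B) + fromℕ A * δ
    eq₁ = trans (*-congʳ (fromℕ-+ (suc B) A))
      (solve 3 (λ b a d → (b :+ a) :* d := d :* b :+ a :* d) refl (fromℕ (suc B)) (fromℕ A) δ)
    eq₂ : δ + fromℕ K * δ ≈ ε
    eq₂ = begin
      δ + fromℕ K * δ
        ≈⟨ solve 3 (λ e i k → e :* i :+ k :* (e :* i) := e :* ((:1 :+ k) :* i)) refl ε (1/ (suc K)) (fromℕ K) ⟩
      ε * (fromℕ (suc K) * 1/ (suc K))  ≈⟨ *-congˡ (1/-inverseʳ {suc K} (s≤s z≤n)) ⟩
      ε * 1#                            ≈⟨ *-identityʳ ε ⟩
      ε                                 ∎
      where
      open SetoidReasoning setoid
    bound : δ * fromℕ (suc B) + fromℕ A * δ < ε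
    bound = <-respˡ-≈ (trans (+-identityˡ _) eq₁) (<-respʳ-≈ eq₂ (+-monoˡ-< (fromℕ K * δ) 0<δ))

  -- If `m < l`, both sequences eventually stay within half the gap of their limits, so that
  -- `y n < x n`. The threshold `N` admits inequalities that fail at the start, as for the partial
  -- sums of `exp`.
  ⟶-mono-≤ : ∀ {x y l m} N → (∀ n → N ℕ.≤ n → x n ≤ y n) → x ⟶ l → y ⟶ m → l ≤ m
  ⟶-mono-≤ {x} {y} {l} {m} N x≤y x⟶l y⟶m m<l
    with x⟶l (half (l - m)) (half-pos (x<y⇒0<y-x m<l)) | y⟶m (half (l - m)) (half-pos (x<y⇒0<y-x m<l))
  ... | A , x≈l | B , y≈m = x≤y n (ℕ.m≤m+n N (A ℕ.+ B)) y<x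
    where
    n = N ℕ.+ (A ℕ.+ B)
    le = ℕ.m≤n+m (A ℕ.+ B) N
    y<x : y n < x n
    y<x = 0<y-x⇒x<y (<-respʳ-≈
      (solve 4 (λ x l y m → (l :- m) :- ((l :- x) :+ (y :- m)) := x :- y) refl (x n) l (y n) m)
      (x<y⇒0<y-x (<-respʳ-≈ (half+half (l - m))
        (+-mono-< (proj₂ (x≈l n (ℕ.m+n≤o⇒m≤o A le))) (proj₁ (y≈m n (ℕ.m+n≤o⇒n≤o A le)))))))

  ⟶-unique : ∀ {x l m} → x ⟶ l → x ⟶ m → l ≈ m
  ⟶-unique p q = ≤-antisym (⟶-mono-≤ 0 (λ _ _ → ≤-refl) p q) (⟶-mono-≤ 0 (λ _ _ → ≤-refl) q p)

  vanishing⇒⟶0 : ∀ {x} → (∀ n → 0# ≤ x n) → (∀ ε → 0# < ε → ∃ λ N → ∀ n → N ℕ.≤ n → x n < ε) → x ⟶ 0#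
  vanishing⇒⟶0 {x} 0≤x small ε 0<ε with small ε 0<ε
  ... | N , x<ε = N , λ n N≤n →
    ≪⇒Near (≪-resp-≈ (solve 1 (λ x → x := x :- nat 0) refl (x n)) (0≤x⇒x≪x (0≤x n))) (x<ε n N≤n)

  -- Replaces monotone convergence: the sequence increases, and `u m` bounds all that it can still
  -- gain after `m`, so the smallness of `u` is a Cauchy modulus.
  bounded-growth⇒Cauchy : ∀ {x u : ℕ → Carrier} → (∀ {m n} → m ℕ.≤ n → x m ≤ x n × x n ≤ x m + u m) →
                          (∀ ε → 0# < ε → ∃ λ N → ∀ n → N ℕ.≤ n → u n < ε) → Cauchy x
  bounded-growth⇒Cauchy {x} {u} growth small ε 0<ε with small ε 0<ε
  ... | N , u<ε = N , λ m n N≤m N≤n → near m n N≤m N≤n (ℕ.≤-total m n)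
    where
    ordered : ∀ m n → N ℕ.≤ m → m ℕ.≤ n → Near ε (x m) (x n)
    ordered m n N≤m m≤n =
      ≤-<-trans (≤-respʳ-≈ (-‿inverseʳ (x n)) (+-monoˡ-≤ (- x n) (proj₁ (growth m≤n)))) 0<ε ,
      ≤-<-trans (x≤z+y⇒x-y≤z (≤-respʳ-≈ (+-comm _ _) (proj₂ (growth m≤n)))) (u<ε m N≤m)
    near : ∀ m n → N ℕ.≤ m → N ℕ.≤ n → m ℕ.≤ n ⊎ n ℕ.≤ m → Near ε (x m) (x n)
    near m n N≤m N≤n (inj₁ m≤n) = ordered m n N≤m m≤n
    near m n N≤m N≤n (inj₂ n≤m) = proj₂ (ordered n m N≤n n≤m) , proj₁ (ordered n m N≤n n≤m)

  antitone : ∀ {x : ℕ → Carrier} → (∀ n → x (suc n) ≤ x n) → ∀ {m n} → m ℕ.≤ n → x n ≤ x m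
  antitone {x} x↓ {m} m≤n = go (ℕ.≤⇒≤′ m≤n)
    where
    go : ∀ {n} → m ℕ.≤′ n → x n ≤ x m
    go ℕ.≤′-refl              = ≤-refl
    go (ℕ.≤′-step {n = n} le) = ≤-trans (x↓ n) (go le)

  eventually-small : ∀ {x : ℕ → Carrier} {C} → (∀ n → fromℕ n * x n ≤ C) →
                     ∀ ε → 0# < ε → ∃ λ N → ∀ n → N ℕ.≤ n → x n < ε
  eventually-small {x} {C} nx≤C ε 0<ε with archimedean (C * inv 0<ε)
  -- `suc N` instead of `N` ensures that `n` is positive, so that the inequality can be divided by
  -- it.
  ... | N , C/ε<N = suc N , λ { (suc n) (s≤s N≤n) → below (suc n) (s≤s z≤n) (ℕ.m≤n⇒m≤1+n N≤n) }
    where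
    C<Nε : C < ε * fromℕ N
    C<Nε = <-respˡ-≈ (trans (solve 3 (λ e c i → e :* (c :* i) := c :* (e :* i)) refl ε C (inv 0<ε))
                            (trans (*-congˡ (*-inverseʳ 0<ε)) (*-identityʳ C)))
                     (*-monoˡ-< 0<ε C/ε<N)
    below : ∀ n → 0 ℕ.< n → N ℕ.≤ n → x n < ε
    below n 0<n N≤n = <-respˡ-≈ (eq (x n)) (<-respʳ-≈ (eq ε) (*-monoˡ-< (1/-pos 0<n) nx<nε))
      where
      nx<nε : fromℕ n * x n < fromℕ n * ε
      nx<nε = ≤-<-trans (nx≤C n) (<-≤-trans C<Nε
        (≤-respˡ-≈ (*-comm _ ε) (*-monoʳ-≤ (<⇒≤ 0<ε) (fromℕ-mono-≤ N≤n))))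
      eq : ∀ z → 1/ n * (fromℕ n * z) ≈ z
      eq z = trans (solve 3 (λ i n z → i :* (n :* z) := (n :* i) :* z) refl (1/ n) (fromℕ n) z)
                   (trans (*-congʳ (1/-inverseʳ 0<n)) (*-identityˡ z))

-- The exponential series, its functional equation, and logarithms

module ExponentialProperties {c ℓ₁ ℓ₂} (ℛ : RealField c ℓ₁ ℓ₂) where
  open RealField ℛ
  open OrderedFieldProperties archimedeanField
  open LimitProperties archimedeanField
  open Algebra.Properties.Semiring.Exp semiring using (^-congˡ)

  partialSum : (ℕ → Carrier) → ℕ → Carrier
  partialSum f zero    = 0#
  partialSum f (suc n) = partialSum f n + f n

  partialSum-cong : ∀ {f g} → (∀ i → f i ≈ g i) → ∀ n → partialSum f n ≈ partialSum g n
  partialSum-cong f≈g zero    = refl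
  partialSum-cong f≈g (suc n) = +-cong (partialSum-cong f≈g n) (f≈g n)

  partialSum-mono-terms : ∀ {f g} → (∀ i → f i ≤ g i) → ∀ n → partialSum f n ≤ partialSum g n
  partialSum-mono-terms f≤g zero    = ≤-refl
  partialSum-mono-terms f≤g (suc n) = +-mono-≤ (partialSum-mono-terms f≤g n) (f≤g n)

  partialSum-*ˡ : ∀ z f n → partialSum (λ i → z * f i) n ≈ z * partialSum f n
  partialSum-*ˡ z f zero    = sym (zeroʳ z)
  partialSum-*ˡ z f (suc n) = trans (+-congʳ (partialSum-*ˡ z f n)) (sym (distribˡ z _ _))

  -- Each of the `n` summands is at least `f n`. A bound on the partial sums thus becomes a rate of
  -- decay 1/n.
  antitone⇒*≤partialSum : ∀ {f : ℕ → Carrier} → (∀ i → f (suc i) ≤ f i) → ∀ n → fromℕ n * f n ≤ partialSum f n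
  antitone⇒*≤partialSum {f} f↓ zero    = ≤-reflexive (zeroˡ (f 0))
  antitone⇒*≤partialSum {f} f↓ (suc n) = ≤-trans
    (*-monoˡ-≤ (fromℕ-nonNeg (suc n)) (f↓ n))
    (≤-respˡ-≈ (solve 2 (λ n f → n :* f :+ f := (:1 :+ n) :* f) refl (fromℕ n) (f n))
      (+-monoˡ-≤ (f n) (antitone⇒*≤partialSum f↓ n)))

  partialSum-first : ∀ f n → partialSum f (suc n) ≈ f 0 + partialSum (f ∘ suc) n
  partialSum-first f zero    = +-comm 0# (f 0)
  partialSum-first f (suc n) = trans (+-congʳ (partialSum-first f n)) (+-assoc _ _ _)

  partialSum-mono : ∀ {f} → (∀ i → 0# ≤ f i) → ∀ {m n} → m ℕ.≤ n → partialSum f m ≤ partialSum f n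
  partialSum-mono 0≤f {m} le = go (ℕ.≤⇒≤′ le)
    where
    go : ∀ {n} → m ℕ.≤′ n → partialSum _ m ≤ partialSum _ n
    go ℕ.≤′-refl              = ≤-refl
    go (ℕ.≤′-step {n = n} le) = ≤-trans (go le) (x≤x+y (0≤f n))

  partialSum-≪ : ∀ {f F} → (∀ i → f i ≪ F i) → ∀ {m n} → m ℕ.≤ n →
                 partialSum f n - partialSum f m ≪ partialSum F n - partialSum F m
  partialSum-≪ {f} {F} f≪F {m} le = go (ℕ.≤⇒≤′ le)
    where
    shift : ∀ f n → (partialSum f n - partialSum f m) + f n ≈ partialSum f (suc n) - partialSum f m
    shift f n = solve 3 (λ s t u → (s :- t) :+ u := s :+ u :- t) refl (partialSum f n) (partialSum f m) (f n)
    go : ∀ {n} → m ℕ.≤′ n → partialSum f n - partialSum f m ≪ partialSum F n - partialSum F m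
    go ℕ.≤′-refl = ≪-resp-≈ (sym (-‿inverseʳ _))
      (≪-≤ (0≤x⇒x≪x ≤-refl) (≤-reflexive (sym (-‿inverseʳ _))))
    go (ℕ.≤′-step {n = n} le) =
      ≪-resp-≈ (shift f n) (≪-≤ (≪-+ (go le) (f≪F n)) (≤-reflexive (shift F n)))

  convolution : (f g : ℕ → Carrier) → ℕ → Carrier
  convolution f g zero    = f 0 * g 0
  convolution f g (suc n) = f 0 * g (suc n) + convolution (f ∘ suc) g n

  -- The sum of `f i * g j` over i + j < n, taken by rows; `triangle-suc` adds the antidiagonal i +
  -- j = n.
  triangle : (f g : ℕ → Carrier) → ℕ → Carrier
  triangle f g zero    = 0#
  triangle f g (suc n) = f 0 * partialSum g (suc n) + triangle (f ∘ suc) g n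

  triangle-suc : ∀ f g n → triangle f g (suc n) ≈ triangle f g n + convolution f g n
  triangle-suc f g zero = solve 2 (λ a b → a :* (nat 0 :+ b) :+ nat 0 := nat 0 :+ a :* b) refl (f 0) (g 0)
  triangle-suc f g (suc n) = trans (+-congˡ (triangle-suc (f ∘ suc) g n))
    (solve 5 (λ a s b t c → a :* (s :+ b) :+ (t :+ c) := (a :* s :+ t) :+ (a :* b :+ c)) refl
      (f 0) (partialSum g (suc n)) (g (suc n)) (triangle (f ∘ suc) g n) (convolution (f ∘ suc) g n))

  convolution-cong : ∀ {f f′ g g′} → (∀ i → f i ≈ f′ i) → (∀ i → g i ≈ g′ i) →
                     ∀ n → convolution f g n ≈ convolution f′ g′ n
  convolution-cong f≈ g≈ zero    = *-cong (f≈ 0) (g≈ 0)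
  convolution-cong f≈ g≈ (suc n) = +-cong (*-cong (f≈ 0) (g≈ (suc n))) (convolution-cong (f≈ ∘ suc) g≈ n)

  convolution-+ˡ : ∀ f f′ g n → convolution (λ i → f i + f′ i) g n ≈ convolution f g n + convolution f′ g n
  convolution-+ˡ f f′ g zero    = distribʳ _ _ _
  convolution-+ˡ f f′ g (suc n) = trans (+-congˡ (convolution-+ˡ (f ∘ suc) (f′ ∘ suc) g n))
    (solve 5 (λ a a′ b c d → (a :+ a′) :* b :+ (c :+ d) := (a :* b :+ c) :+ (a′ :* b :+ d)) refl
      (f 0) (f′ 0) (g (suc n)) _ _)

  convolution-*ˡ : ∀ z f g n → convolution (λ i → z * f i) g n ≈ z * convolution f g n
  convolution-*ˡ z f g zero    = *-assoc _ _ _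
  convolution-*ˡ z f g (suc n) = trans (+-congˡ (convolution-*ˡ z (f ∘ suc) g n))
    (solve 4 (λ z a b c → z :* a :* b :+ z :* c := z :* (a :* b :+ c)) refl z (f 0) (g (suc n)) _)

  convolution-*ʳ : ∀ z f g n → convolution f (λ i → z * g i) n ≈ z * convolution f g n
  convolution-*ʳ z f g zero    = solve 3 (λ z a b → a :* (z :* b) := z :* (a :* b)) refl z (f 0) (g 0)
  convolution-*ʳ z f g (suc n) = trans (+-congˡ (convolution-*ʳ z (f ∘ suc) g n))
    (solve 4 (λ z a b c → a :* (z :* b) :+ z :* c := z :* (a :* b :+ c)) refl z (f 0) (g (suc n)) _)

  convolution-last : ∀ f g n → convolution f g (suc n) ≈ convolution f (g ∘ suc) n + f (suc n) * g 0
  convolution-last f g zero    = refl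
  convolution-last f g (suc n) = trans (+-congˡ (convolution-last (f ∘ suc) g n)) (sym (+-assoc _ _ _))

  weighted : (ℕ → Carrier) → ℕ → Carrier
  weighted f i = fromℕ i * f i

  -- The Leibniz rule for the operator x d/dx on generating functions.
  convolution-weighted : ∀ f g n → fromℕ n * convolution f g n
                       ≈ convolution (weighted f) g n + convolution f (weighted g) n
  convolution-weighted f g zero = solve 2 (λ a b → nat 0 :* (a :* b) := nat 0 :* a :* b :+ a :* (nat 0 :* b))
                                          refl (f 0) (g 0)
  convolution-weighted f g (suc n) = begin
    (1# + N) * (f 0 * g (suc n) + C)
      ≈⟨ solve 4 (λ N a b C → (:1 :+ N) :* (a :* b :+ C)
                  := nat 0 :* a :* b :+ (C :+ N :* C) :+ a :* ((:1 :+ N) :* b)) refl N (f 0) (g (suc n)) C ⟩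
    0# * f 0 * g (suc n) + (C + N * C) + f 0 * weighted g (suc n)
      ≈⟨ +-congʳ (+-congˡ (+-congˡ (convolution-weighted (f ∘ suc) g n))) ⟩
    0# * f 0 * g (suc n) + (C + (X + Y)) + f 0 * weighted g (suc n)
      ≈⟨ solve 5 (λ a c x y b → a :+ (c :+ (x :+ y)) :+ b := (a :+ (c :+ x)) :+ (b :+ y)) refl _ C X Y _ ⟩
    (0# * f 0 * g (suc n) + (C + X)) + (f 0 * weighted g (suc n) + Y)
      ≈⟨ +-congʳ (+-congˡ (trans
          (convolution-cong (λ i → solve 2 (λ N a → (:1 :+ N) :* a := a :+ N :* a) refl (fromℕ i) (f (suc i)))
            (λ _ → refl) n)
                                 (convolution-+ˡ (f ∘ suc) (weighted (f ∘ suc)) g n))) ⟨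
    (0# * f 0 * g (suc n) + convolution (weighted f ∘ suc) g n) + (f 0 * weighted g (suc n) + Y) ∎
    where
    open SetoidReasoning setoid
    N = fromℕ n
    C = convolution (f ∘ suc) g n
    X = convolution (weighted (f ∘ suc)) g n
    Y = convolution (f ∘ suc) (weighted g) n

  triangle-nonNeg : ∀ {f g} → (∀ i → 0# ≤ f i) → (∀ i → 0# ≤ g i) → ∀ n → 0# ≤ triangle f g n
  triangle-nonNeg 0≤f 0≤g zero    = ≤-refl
  triangle-nonNeg 0≤f 0≤g (suc n) = +-nonNeg
    (*-nonNeg (0≤f 0) (partialSum-mono 0≤g {0} {suc n} z≤n)) (triangle-nonNeg (0≤f ∘ suc) 0≤g n)

  -- The box i < m, j < n lies in the triangle i + j < l, and the remaining terms are nonnegative.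
  box≤triangle : ∀ {f g} → (∀ i → 0# ≤ f i) → (∀ i → 0# ≤ g i) → ∀ m n {l} → m ℕ.+ n ℕ.≤ l →
                 partialSum f m * partialSum g n ≤ triangle f g l
  box≤triangle 0≤f 0≤g zero n {l} le = ≤-respˡ-≈ (sym (zeroˡ _)) (triangle-nonNeg 0≤f 0≤g l)
  box≤triangle {f} {g} 0≤f 0≤g (suc m) n {suc l} (s≤s le) = ≤-respˡ-≈
    (trans (sym (distribʳ _ _ _)) (*-congʳ (sym (partialSum-first f m))))
    (+-mono-≤ (*-monoˡ-≤ (0≤f 0) (partialSum-mono 0≤g (ℕ.m≤n⇒m≤1+n (ℕ.m+n≤o⇒n≤o m le))))
              (box≤triangle (0≤f ∘ suc) 0≤g m n le))

  -- The triangle i + j < m lies in the box i < m, j < n, so both sides are sums over the same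
  -- region and the domination is termwise. The induction removes rows and keeps columns, hence the
  -- separate number `n`.
  box-triangle-≪ : ∀ {f g F G} → (∀ i → f i ≪ F i) → (∀ i → g i ≪ G i) → ∀ m n → m ℕ.≤ n →
                   partialSum f m * partialSum g n - triangle f g m
                     ≪ partialSum F m * partialSum G n - triangle F G m
  box-triangle-≪ f≪F g≪G zero n _ = ≪-resp-≈ (sym (zero-eq _))
    (≪-≤ (0≤x⇒x≪x ≤-refl) (≤-reflexive (sym (zero-eq _))))
    where
    zero-eq : ∀ s → 0# * s - 0# ≈ 0#
    zero-eq = solve 1 (λ s → nat 0 :* s :- nat 0 := nat 0) refl
  box-triangle-≪ {f} {g} {F} {G} f≪F g≪G (suc m) n m<n = ≪-resp-≈ (eq f g) (≪-≤
    (≪-+ (≪-* (f≪F 0) (partialSum-≪ g≪G m<n)) (box-triangle-≪ (f≪F ∘ suc) g≪G m n (ℕ.<⇒≤ m<n)))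
    (≤-reflexive (eq F G)))
    where
    eq : ∀ f g → f 0 * (partialSum g n - partialSum g (suc m))
                   + (partialSum (f ∘ suc) m * partialSum g n - triangle (f ∘ suc) g m)
               ≈ partialSum f (suc m) * partialSum g n - triangle f g (suc m)
    eq f g = trans
      (solve 5 (λ a s t u v → a :* (s :- t) :+ (u :* s :- v) := (a :+ u) :* s :- (a :* t :+ v)) refl
        (f 0) (partialSum g n) (partialSum g (suc m)) (partialSum (f ∘ suc) m) (triangle (f ∘ suc) g m))
      (+-congʳ (*-congʳ (sym (partialSum-first f m))))

  expTerm : Carrier → ℕ → Carrier
  expTerm x n = x ^ n * 1/ (n !)

  expPartialSum≈ : ∀ x n → expPartialSum x n ≈ partialSum (expTerm x) n
  expPartialSum≈ x zero    = refl
  expPartialSum≈ x (suc n) = +-congʳ (expPartialSum≈ x n)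

  expTerm-suc : ∀ x n → weighted (expTerm x) (suc n) ≈ x * expTerm x n
  expTerm-suc x n = begin
    N * (x * x ^ n * I)
      ≈⟨ solve 4 (λ N x X I → N :* (x :* X :* I) := x :* X :* (N :* I)) refl N x (x ^ n) I ⟩
    x * x ^ n * (N * I)                ≈⟨ *-congˡ N*I≈J ⟩
    x * x ^ n * J                      ≈⟨ *-assoc _ _ _ ⟩
    x * (x ^ n * J)                    ∎
    where
    open SetoidReasoning setoid
    N = fromℕ (suc n)
    M = fromℕ (n !)
    I = 1/ (suc n !)
    J = 1/ (n !)
    N*I≈J : N * I ≈ J
    N*I≈J = begin
      N * I              ≈⟨ *-identityʳ _ ⟨
      N * I * 1#         ≈⟨ *-congˡ (1/-inverseʳ (ℕ.1≤n! n)) ⟨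
      N * I * (M * J)    ≈⟨ solve 4 (λ N I M J → N :* I :* (M :* J) := (N :* M) :* I :* J) refl N I M J ⟩
      N * M * I * J      ≈⟨ *-congʳ (*-congʳ (fromℕ-* (suc n) (n !))) ⟨
      fromℕ (suc n !) * I * J ≈⟨ *-congʳ (1/-inverseʳ (ℕ.1≤n! (suc n))) ⟩
      1# * J             ≈⟨ *-identityˡ J ⟩
      J                  ∎

  1/1≈1 : 1/ 1 ≈ 1#
  1/1≈1 = trans (sym (solve 1 (λ i → nat 1 :* i := i) refl (1/ 1))) (1/-inverseʳ {1} (s≤s z≤n))

  expTerm-0 : ∀ x → expTerm x 0 ≈ 1#
  expTerm-0 x = trans (*-identityˡ _) 1/1≈1

  expTerm-nonNeg : ∀ {x} → 0# ≤ x → ∀ n → 0# ≤ expTerm x n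
  expTerm-nonNeg 0≤x n = *-nonNeg (^-nonNeg 0≤x n) (<⇒≤ (1/-pos (ℕ.1≤n! n)))

  expTerm-≪ : ∀ {x X} → x ≪ X → ∀ n → expTerm x n ≪ expTerm X n
  expTerm-≪ x≪X n = ≪-* (≪-^ x≪X n) (0≤x⇒x≪x (<⇒≤ (1/-pos (ℕ.1≤n! n))))

  fromℕ-cancel : ∀ n {x y} → fromℕ (suc n) * x ≈ fromℕ (suc n) * y → x ≈ y
  fromℕ-cancel n {x} {y} eq = trans (sym (lemma x)) (trans (*-congˡ eq) (lemma y))
    where
    lemma : ∀ z → 1/ (suc n) * (fromℕ (suc n) * z) ≈ z
    lemma z = trans (solve 3 (λ i n z → i :* (n :* z) := (n :* i) :* z) refl (1/ (suc n)) (fromℕ (suc n)) z)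
                    (trans (*-congʳ (1/-inverseʳ {suc n} (s≤s z≤n))) (*-identityˡ z))

  -- The binomial theorem without binomial coefficients. Both sides satisfy the recursion
  -- `expTerm-suc` for `x + y`, which is the differential equation of exp in coefficients: the
  -- right-hand side does so by the Leibniz rule `convolution-weighted`, and the factor n + 1 can be
  -- cancelled.
  expTerm-+ : ∀ x y n → expTerm (x + y) n ≈ convolution (expTerm x) (expTerm y) n
  expTerm-+ x y zero    = trans (expTerm-0 (x + y))
    (sym (trans (*-cong (expTerm-0 x) (expTerm-0 y)) (*-identityˡ 1#)))
  expTerm-+ x y (suc n) = fromℕ-cancel n (begin
    weighted (expTerm (x + y)) (suc n)    ≈⟨ expTerm-suc (x + y) n ⟩
    (x + y) * expTerm (x + y) n           ≈⟨ *-congˡ (expTerm-+ x y n) ⟩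
    (x + y) * C                           ≈⟨ distribʳ C x y ⟩
    x * C + y * C                         ≈⟨ +-cong (convolution-*ˡ x _ _ n) (convolution-*ʳ y _ _ n) ⟨
    convolution (λ i → x * e x i) (e y) n + convolution (e x) (λ i → y * e y i) n
      ≈⟨ +-cong (convolution-cong (expTerm-suc x) (λ _ → refl) n) (convolution-cong (λ _ → refl) (expTerm-suc y) n) ⟨
    convolution (weighted (e x) ∘ suc) (e y) n + convolution (e x) (weighted (e y) ∘ suc) n
      ≈⟨ +-cong (trans (+-congʳ (solve 2 (λ a b → nat 0 :* a :* b := nat 0) refl _ _)) (+-identityˡ _))
                (trans (convolution-last (e x) (weighted (e y)) n)
                  (trans (+-congˡ (solve 2 (λ a b → a :* (nat 0 :* b) := nat 0) refl _ _)) (+-identityʳ _))) ⟨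
    convolution (weighted (e x)) (e y) (suc n) + convolution (e x) (weighted (e y)) (suc n)
      ≈⟨ convolution-weighted (e x) (e y) (suc n) ⟨
    fromℕ (suc n) * convolution (e x) (e y) (suc n) ∎)
    where
    open SetoidReasoning setoid
    e = expTerm
    C = convolution (e x) (e y) n

  expTriangle : ∀ x y n → triangle (expTerm x) (expTerm y) n ≈ expPartialSum (x + y) n
  expTriangle x y zero    = refl
  expTriangle x y (suc n) = trans (triangle-suc _ _ n) (+-cong (expTriangle x y n) (sym (expTerm-+ x y n)))

  exp-cong : ∀ {x y} → x ≈ y → exp x ≈ exp y
  exp-cong {x} {y} x≈y = ⟶-unique
    (⟶-resp-≈ (λ n → trans (expPartialSum≈ x n)
      (trans (partialSum-cong (λ i → *-congʳ (^-congˡ i x≈y)) n) (sym (expPartialSum≈ y n)))) refl (exp-series x))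
    (exp-series y)

  exp-+ : ∀ x y → exp (x + y) ≈ exp x * exp y
  exp-+ x y with ∃≪ x | ∃≪ y
  ... | A , x≪A | B , y≪B = ⟶-unique
    (⟶-squeeze close tail⟶0 (exp-series (x + y)))
    (⟶-* (exp-series x) (exp-series y))
    where
    X = fromℕ A
    Y = fromℕ B
    P = expPartialSum
    -- What the box has beyond the triangle is dominated by the same region for `X` and `Y`. These
    -- are nonnegative, so their box is at most the triangle of size 2n, which leaves the stretch
    -- from n to 2n of the series of `exp (X + Y)`.
    close : ∀ n → P x n * P y n - P (x + y) n ≪ P (X + Y) (n ℕ.+ n) - P (X + Y) n
    close n = ≪-resp-≈ (eq x y) (≪-≤
      (box-triangle-≪ (expTerm-≪ x≪A) (expTerm-≪ y≪B) n n ℕ.≤-refl)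
      (+-mono-≤
        (≤-respʳ-≈ (expTriangle X Y (n ℕ.+ n))
          (box≤triangle (expTerm-nonNeg (fromℕ-nonNeg A)) (expTerm-nonNeg (fromℕ-nonNeg B)) n n ℕ.≤-refl))
        (≤-reflexive (-‿cong (expTriangle X Y n)))))
      where
      eq : ∀ x y → partialSum (expTerm x) n * partialSum (expTerm y) n - triangle (expTerm x) (expTerm y) n
                 ≈ P x n * P y n - P (x + y) n
      eq x y = +-cong (sym (*-cong (expPartialSum≈ x n) (expPartialSum≈ y n))) (-‿cong (expTriangle x y n))
    tail⟶0 : (λ n → P (X + Y) (n ℕ.+ n) - P (X + Y) n) ⟶ 0#
    tail⟶0 = ⟶-resp-≈
      (λ n → trans (+-congˡ (solve 1 (λ p → :- nat 1 :* p := :- p) refl (P (X + Y) n))) refl)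
      (solve 1 (λ l → l :+ :- nat 1 :* l := nat 0) refl (exp (X + Y)))
      (⟶-+ (⟶-subsequence (λ n → n ℕ.+ n) (λ n → ℕ.m≤m+n n n) (exp-series (X + Y)))
           (⟶-* (⟶-const (- fromℕ 1)) (exp-series (X + Y))))

  1+x≤exp : ∀ {x} → 0# ≤ x → 1# + x ≤ exp x
  1+x≤exp {x} 0≤x = ⟶-mono-≤ 2 lower (⟶-const (1# + x)) (exp-series x)
    where
    lower : ∀ n → 2 ℕ.≤ n → 1# + x ≤ expPartialSum x n
    lower n 2≤n = ≤-respʳ-≈ (sym (expPartialSum≈ x n)) (≤-respˡ-≈
      (trans (+-cong (trans (+-identityˡ _) (expTerm-0 x))
        (trans (*-congˡ 1/1≈1) (solve 1 (λ x → x :* :1 :* :1 := x) refl x))) refl)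
      (partialSum-mono (expTerm-nonNeg 0≤x) 2≤n))

  exp-linear : ∀ k x y → exp (fromℕ k * x + y) ≈ exp x ^ k * exp y
  exp-linear zero    x y = trans (exp-cong (solve 2 (λ x y → nat 0 :* x :+ y := y) refl x y)) (sym (*-identityˡ _))
  exp-linear (suc k) x y = begin
    exp ((1# + fromℕ k) * x + y)
      ≈⟨ exp-cong (solve 3 (λ k x y → (:1 :+ k) :* x :+ y := x :+ (k :* x :+ y)) refl (fromℕ k) x y) ⟩
    exp (x + (fromℕ k * x + y))       ≈⟨ exp-+ x _ ⟩
    exp x * exp (fromℕ k * x + y)     ≈⟨ *-congˡ (exp-linear k x y) ⟩
    exp x * (exp x ^ k * exp y)       ≈⟨ *-assoc _ _ _ ⟨
    exp x ^ suc k * exp y             ∎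
    where
    open SetoidReasoning setoid

  -- `ln` is given as a right inverse of `exp`, so the argument takes place on the side of `exp`: if
  -- `t`, the sum of `fromℕ k * ln r` and `ln m`, were positive, then `1# + t ≤ exp t`, while
  -- `exp t` is `r ^ k * m ≤ 1#`.
  ln-bound : ∀ k {r m} (0<r : 0# < r) (0<m : 0# < m) → r ^ k * m ≤ 1# → fromℕ k * ln r 0<r ≤ - ln m 0<m
  ln-bound k {r} {m} 0<r 0<m rᵏm≤1 lt = 1+t≤1 1<1+t
    where
    t = fromℕ k * ln r 0<r + ln m 0<m
    0<t : 0# < t
    0<t = <-respʳ-≈ (solve 2 (λ a b → a :- :- b := a :+ b) refl _ _) (x<y⇒0<y-x lt)
    1<1+t : 1# < 1# + t
    1<1+t = <-respˡ-≈ (+-identityʳ 1#) (+-monoʳ-< 1# 0<t)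
    1+t≤1 : 1# + t ≤ 1#
    1+t≤1 = ≤-trans (1+x≤exp (<⇒≤ 0<t)) (≤-respˡ-≈
      (sym (trans (exp-linear k _ _) (*-cong (^-congˡ k (exp-ln r 0<r)) (exp-ln m 0<m)))) rᵏm≤1)

-- Finite sums and indicators

module FiniteSums {c ℓ₁ ℓ₂} (ℛ : RealField c ℓ₁ ℓ₂) where
  open RealField ℛ
  open OrderedFieldProperties archimedeanField

  private variable
    a : Level
    A B : Set a
    P Q : Set a

  ∑ : List A → (A → Carrier) → Carrier
  ∑ xs f = sum (List.map f xs)

  [_]ᵢ : Dec P → Carrier
  [ P? ]ᵢ = if does P? then 1# else 0#

  abstract
    ∑-cong : ∀ (xs : List A) {f g} → (∀ {x} → x ∈ˡ xs → f x ≈ g x) → ∑ xs f ≈ ∑ xs g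
    ∑-cong []       f≈g = refl
    ∑-cong (x ∷ xs) f≈g = +-cong (f≈g (here ≡.refl)) (∑-cong xs (f≈g ∘ there))

    ∑-mono : ∀ (xs : List A) {f g} → (∀ {x} → x ∈ˡ xs → f x ≤ g x) → ∑ xs f ≤ ∑ xs g
    ∑-mono []       f≤g = ≤-refl
    ∑-mono (x ∷ xs) f≤g = +-mono-≤ (f≤g (here ≡.refl)) (∑-mono xs (f≤g ∘ there))

    ∑-nonNeg : ∀ (xs : List A) {f} → (∀ {x} → x ∈ˡ xs → 0# ≤ f x) → 0# ≤ ∑ xs f
    ∑-nonNeg []       0≤f = ≤-refl
    ∑-nonNeg (x ∷ xs) 0≤f = +-nonNeg (0≤f (here ≡.refl)) (∑-nonNeg xs (0≤f ∘ there))

    ∑-0 : ∀ (xs : List A) {f} → (∀ {x} → x ∈ˡ xs → f x ≈ 0#) → ∑ xs f ≈ 0#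
    ∑-0 []       f≈0 = refl
    ∑-0 (x ∷ xs) f≈0 = trans (+-cong (f≈0 (here ≡.refl)) (∑-0 xs (f≈0 ∘ there))) (+-identityˡ 0#)

    ∑-++ : ∀ (xs ys : List A) f → ∑ (xs ++ ys) f ≈ ∑ xs f + ∑ ys f
    ∑-++ []       ys f = sym (+-identityˡ _)
    ∑-++ (x ∷ xs) ys f = trans (+-congˡ (∑-++ xs ys f)) (sym (+-assoc _ _ _))

    ∑-map : ∀ (h : A → B) xs f → ∑ (List.map h xs) f ≡ ∑ xs (f ∘ h)
    ∑-map h xs f = ≡.cong sum (≡.sym (List.map-∘ xs))

    ∑-concatMap : ∀ (h : A → List B) xs f → ∑ (concatMap h xs) f ≈ ∑ xs (λ x → ∑ (h x) f)
    ∑-concatMap h []       f = refl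
    ∑-concatMap h (x ∷ xs) f = trans (∑-++ (h x) (concatMap h xs) f) (+-congˡ (∑-concatMap h xs f))

    ∑-+ : ∀ (xs : List A) f g → ∑ xs (λ x → f x + g x) ≈ ∑ xs f + ∑ xs g
    ∑-+ []       f g = sym (+-identityˡ 0#)
    ∑-+ (x ∷ xs) f g = trans (+-congˡ (∑-+ xs f g))
      (solve 4 (λ a b s t → (a :+ b) :+ (s :+ t) := (a :+ s) :+ (b :+ t)) refl (f x) (g x) (∑ xs f) (∑ xs g))

    ∑-*ˡ : ∀ (xs : List A) z f → ∑ xs (λ x → z * f x) ≈ z * ∑ xs f
    ∑-*ˡ []       z f = sym (zeroʳ z)
    ∑-*ˡ (x ∷ xs) z f = trans (+-congˡ (∑-*ˡ xs z f)) (sym (distribˡ z _ _))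

    ∑-const : ∀ (xs : List A) z → ∑ xs (λ _ → z) ≈ fromℕ (length xs) * z
    ∑-const []       z = sym (zeroˡ z)
    ∑-const (x ∷ xs) z = trans (+-cong (sym (*-identityˡ z)) (∑-const xs z)) (sym (distribʳ z 1# _))

    ∑-swap : ∀ (xs : List A) (ys : List B) (f : A → B → Carrier) → ∑ xs (λ x → ∑ ys (f x)) ≈ ∑ ys (λ y → ∑ xs (λ x → f x y))
    ∑-swap []       ys f = sym (∑-0 ys (λ _ → refl))
    ∑-swap (x ∷ xs) ys f = trans (+-congˡ (∑-swap xs ys f)) (sym (∑-+ ys (f x) (λ y → ∑ xs (λ x → f x y))))

    -- Every element of `xs` is struck from `ys` once; uniqueness keeps the others available. With
    -- the constant 1 this compares a number of distinct objects with the length of a list that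
    -- enumerates them, possibly with repetitions.
    ∑-⊆ : ∀ {xs ys : List A} {f} → Unique xs → (∀ {x} → x ∈ˡ xs → x ∈ˡ ys) → (∀ x → 0# ≤ f x) →
          ∑ xs f ≤ ∑ ys f
    ∑-⊆ {xs = []}     {ys} {f} xs! xs⊆ys 0≤f = ∑-nonNeg ys (λ {x} _ → 0≤f x)
    ∑-⊆ {xs = x ∷ xs} {ys} {f} (x∉xs ∷ xs!) xs⊆ys 0≤f with ∈-∃++ (xs⊆ys (here ≡.refl))
    ... | us , vs , ≡.refl = ≤-respʳ-≈ (sym eq) (+-monoʳ-≤ (f x) (∑-⊆ xs! rest 0≤f))
      where
      rest : ∀ {y} → y ∈ˡ xs → y ∈ˡ us ++ vs
      rest y∈xs with ∈-++⁻ us (xs⊆ys (there y∈xs))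
      ... | inj₁ y∈us         = ∈-++⁺ˡ y∈us
      ... | inj₂ (here ≡.refl) = ⊥-elim (All.lookup x∉xs y∈xs ≡.refl)
      ... | inj₂ (there y∈vs) = ∈-++⁺ʳ us y∈vs
      eq : ∑ (us ++ x ∷ vs) f ≈ f x + ∑ (us ++ vs) f
      eq = trans (∑-++ us (x ∷ vs) f) (trans
        (solve 3 (λ u a v → u :+ (a :+ v) := a :+ (u :+ v)) refl (∑ us f) (f x) (∑ vs f))
        (+-congˡ (sym (∑-++ us vs f))))

    ∑-∈ : ∀ {x} {xs : List A} {f} → x ∈ˡ xs → (∀ x → 0# ≤ f x) → f x ≤ ∑ xs f
    ∑-∈ {f = f} x∈xs 0≤f = ≤-respˡ-≈ (+-identityʳ _) (∑-⊆ {f = f} ([] ∷ []) (λ { (here ≡.refl) → x∈xs }) 0≤f)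

    -- Cotransitivity at the first term: either it is positive, or it lies below the whole sum and
    -- the rest is positive. This finds a positive term without testing signs, and later makes the
    -- maximum positive.
    0<∑⇒∃ : ∀ (xs : List A) {f} → 0# < ∑ xs f → ∃ λ x → x ∈ˡ xs × 0# < f x
    0<∑⇒∃ []       0<0 = ⊥-elim (<-irrefl refl 0<0)
    0<∑⇒∃ (x ∷ xs) {f} 0<∑ with <-cotrans 0<∑ (f x)
    ... | inj₁ 0<fx = x , here ≡.refl , 0<fx
    ... | inj₂ fx<∑ with 0<∑⇒∃ xs (+-cancelˡ-< (f x) (<-respˡ-≈ (sym (+-identityʳ (f x))) fx<∑))
    ...   | y , y∈xs , 0<fy = y , there y∈xs , 0<fy

    ind-yes : (P? : Dec P) → P → [ P? ]ᵢ ≈ 1#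
    ind-yes (yes _) _ = refl
    ind-yes (no ¬p) p = ⊥-elim (¬p p)

    ind-no : (P? : Dec P) → ¬ P → [ P? ]ᵢ ≈ 0#
    ind-no (yes p) ¬p = ⊥-elim (¬p p)
    ind-no (no _)  _  = refl

    ind-nonNeg : (P? : Dec P) → 0# ≤ [ P? ]ᵢ
    ind-nonNeg (yes _) = 0≤1
    ind-nonNeg (no _)  = ≤-refl

    ind-≤1 : (P? : Dec P) → [ P? ]ᵢ ≤ 1#
    ind-≤1 (yes _) = ≤-refl
    ind-≤1 (no _)  = 0≤1

    ind-mono : (P? : Dec P) (Q? : Dec Q) → (P → Q) → [ P? ]ᵢ ≤ [ Q? ]ᵢ
    ind-mono (no _)  Q? P⇒Q = ind-nonNeg Q?
    ind-mono (yes p) Q? P⇒Q = ≤-reflexive (sym (ind-yes Q? (P⇒Q p)))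

    ind-cong : (P? : Dec P) (Q? : Dec Q) → (P → Q) → (Q → P) → [ P? ]ᵢ ≈ [ Q? ]ᵢ
    ind-cong P? Q? P⇒Q Q⇒P = ≤-antisym (ind-mono P? Q? P⇒Q) (ind-mono Q? P? Q⇒P)

    ind-≤ : (P? : Dec P) {x : Carrier} → 0# ≤ x → (P → 1# ≤ x) → [ P? ]ᵢ ≤ x
    ind-≤ (yes p) _   1≤x = 1≤x p
    ind-≤ (no _)  0≤x _   = 0≤x

    ∑-indicator-≤1 : ∀ (_≟_ : DecidableEquality A) {xs} → Unique xs → ∀ y → ∑ xs (λ x → [ x ≟ y ]ᵢ) ≤ 1#
    ∑-indicator-≤1 _≟_ {[]}     _            y = 0≤1
    ∑-indicator-≤1 _≟_ {x ∷ xs} (x∉xs ∷ xs!) y with x ≟ y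
    ... | no  _      = ≤-respˡ-≈ (sym (+-identityˡ _)) (∑-indicator-≤1 _≟_ xs! y)
    ... | yes ≡.refl = ≤-reflexive (trans
      (+-congˡ (∑-0 xs λ {z} z∈xs → ind-no (z ≟ y) (λ { ≡.refl → All.lookup x∉xs z∈xs ≡.refl })))
      (+-identityʳ 1#))

    ∑-indicator : ∀ (_≟_ : DecidableEquality A) {xs} → Unique xs → ∀ {y} → y ∈ˡ xs →
                  ∑ xs (λ x → [ x ≟ y ]ᵢ) ≈ 1#
    ∑-indicator _≟_ xs! {y} y∈xs = ≤-antisym (∑-indicator-≤1 _≟_ xs! y)
      (≤-respˡ-≈ (ind-yes (y ≟ y) ≡.refl) (∑-∈ {f = λ x → [ x ≟ y ]ᵢ} y∈xs (λ x → ind-nonNeg (x ≟ y))))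

    ∑-filter : ∀ {P : A → Set a} (P? : ∀ x → Dec (P x)) xs f →
               ∑ (filter P? xs) f ≈ ∑ xs (λ x → f x * [ P? x ]ᵢ)
    ∑-filter P? []       f = refl
    ∑-filter P? (x ∷ xs) f with P? x
    ... | yes _ = +-cong (sym (*-identityʳ _)) (∑-filter P? xs f)
    ... | no _  = trans (∑-filter P? xs f) (sym (trans (+-congʳ (zeroʳ _)) (+-identityˡ _)))

-- Expectations, independent draws, and the effect of one resampling

module Expectation {c ℓ₁ ℓ₂} (ℛ : RealField c ℓ₁ ℓ₂)
                   {n k b : ℕ} (G : Graph n) (𝓟 : Partition n k b) (0<b : 0 ℕ.< b) where
  open RealField ℛ hiding (zero)
  open OrderedFieldProperties archimedeanField
  open FiniteSums ℛ
  open MoserTardos ℛ G 𝓟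
  open Partition 𝓟
  open Graph G using (edges)

  private variable
    A B : Set

  -- A `Dist` may carry negative weights, so their nonnegativity travels together with an invariant
  -- of the outcomes; the monotonicity of `E` rests on both. Total mass is tracked separately.
  record Supported (d : Dist A) (P : Pred A 0ℓ) : Set (c Level.⊔ ℓ₂) where
    constructor supported
    field support : ∀ {a p} → (a , p) ∈ˡ d → 0# ≤ p × P a
  open Supported

  abstract
    E : Dist A → (A → Carrier) → Carrier
    E d φ = ∑ d (λ (a , p) → p * φ a)

    E-0 : ∀ (d : Dist A) → E d (λ _ → 0#) ≈ 0#
    E-0 d = ∑-0 d λ _ → zeroʳ _

    E-mono : ∀ {d : Dist A} {P φ ψ} → Supported d P → (∀ {a} → P a → φ a ≤ ψ a) → E d φ ≤ E d ψ
    E-mono {d = d} d-supp φ≤ψ = ∑-mono d λ ap∈d →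
      let 0≤p , Pa = support d-supp ap∈d in *-monoˡ-≤ 0≤p (φ≤ψ Pa)

    E-cong : ∀ {d : Dist A} {P φ ψ} → Supported d P → (∀ {a} → P a → φ a ≈ ψ a) → E d φ ≈ E d ψ
    E-cong {d = d} d-supp φ≈ψ = ∑-cong d λ ap∈d → *-congˡ (φ≈ψ (proj₂ (support d-supp ap∈d)))

    E-+ : ∀ (d : Dist A) φ ψ → E d (λ a → φ a + ψ a) ≈ E d φ + E d ψ
    E-+ d φ ψ = trans (∑-cong d λ _ → distribˡ _ _ _) (∑-+ d _ _)

    E-*ˡ : ∀ (d : Dist A) z φ → E d (λ a → z * φ a) ≈ z * E d φ
    E-*ˡ d z φ = trans
      (∑-cong d λ { {a , p} _ → solve 3 (λ p z x → p :* (z :* x) := z :* (p :* x)) refl p z (φ a) })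
      (∑-*ˡ d z _)

    E-∑ : ∀ (d : Dist A) (xs : List B) (φ : A → B → Carrier) →
          E d (λ a → ∑ xs (φ a)) ≈ ∑ xs (λ x → E d (λ a → φ a x))
    E-∑ d xs φ = trans (∑-cong d λ _ → sym (∑-*ˡ xs _ _)) (∑-swap d xs _)

    E-return : ∀ (a : A) φ → E (return a) φ ≈ φ a
    E-return a φ = trans (+-identityʳ _) (*-identityˡ _)

    E->>= : ∀ (d : Dist A) (f : A → Dist B) φ → E (d >>= f) φ ≈ E d (λ a → E (f a) φ)
    E->>= d f φ = trans (∑-concatMap _ d _) (∑-cong d λ { {a , p} _ → begin
      ∑ (List.map (λ (b , q) → b , p * q) (f a)) (λ (b , r) → r * φ b)
        ≡⟨ ∑-map _ (f a) _ ⟩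
      ∑ (f a) (λ (b , q) → p * q * φ b)
        ≈⟨ ∑-cong (f a) (λ _ → *-assoc _ _ _) ⟩
      ∑ (f a) (λ (b , q) → p * (q * φ b))
        ≈⟨ ∑-*ˡ (f a) p _ ⟩
      p * E (f a) φ ∎ })
      where open SetoidReasoning setoid

    Pr≈E : ∀ (d : Dist A) {P : Pred A 0ℓ} (P? : Decidable₁ P) → Pr d P? ≈ E d (λ a → [ P? a ]ᵢ)
    Pr≈E d P? = ∑-filter (P? ∘ proj₁) d proj₂

    return-supported : ∀ (a : A) {P : Pred A 0ℓ} → P a → Supported (return a) P
    return-supported a Pa = supported λ { (here ≡.refl) → 0≤1 , Pa }

    >>=-supported : ∀ {d : Dist A} {f : A → Dist B} {P : Pred A 0ℓ} {Q : Pred B 0ℓ} → Supported d P →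
                    (∀ {a} → P a → Supported (f a) Q) → Supported (d >>= f) Q
    >>=-supported {d = d} {f} {P} {Q} d-supp f-supp = supported λ bq∈ → go d-supp (∈-concatMap⁻ _ {xs = d} bq∈)
      where
      go : ∀ {d b q} → Supported d P →
           Any (λ (a , p) → (b , q) ∈ˡ List.map (λ (b , q) → b , p * q) (f a)) d → 0# ≤ q × Q b
      go d-supp (here bq∈) with ∈-map⁻ _ bq∈ | support d-supp (here ≡.refl)
      ... | (b′ , q′) , bq′∈ , ≡.refl | 0≤p , Pa with support (f-supp Pa) bq′∈
      ...   | 0≤q′ , Qb = *-nonNeg 0≤p 0≤q′ , Qb
      go d-supp (there any) = go (supported (support d-supp ∘ there)) any

    >>=-mass : ∀ {d : Dist A} {f : A → Dist B} {P : Pred A 0ℓ} → Supported d P →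
              (∀ {a} → P a → E (f a) (λ _ → 1#) ≈ 1#) → E d (λ _ → 1#) ≈ 1# → E (d >>= f) (λ _ → 1#) ≈ 1#
    >>=-mass {d = d} {f} d-supp f-mass d-mass =
      trans (E->>= d f _) (trans (E-cong d-supp f-mass) d-mass)

    E-≤1 : ∀ {d : Dist A} {P : Pred A 0ℓ} {φ} → Supported d P → E d (λ _ → 1#) ≈ 1# →
           (∀ {a} → P a → φ a ≤ 1#) → E d φ ≤ 1#
    E-≤1 d-supp d-mass φ≤1 = ≤-respʳ-≈ d-mass (E-mono d-supp φ≤1)

    E-weighted : ∀ (w : A → Carrier) as φ → E (List.map (λ a → a , w a) as) φ ≈ ∑ as (λ a → w a * φ a)
    E-weighted w as φ = reflexive (∑-map _ as _)

  q : Carrier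
  q = 1/ b

  q-nonNeg : 0# ≤ q
  q-nonNeg = <⇒≤ (1/-pos 0<b)

  length-filter-∈? : ∀ {n} (p : Subset n) → length (filter (_∈? p) (allFin n)) ≡ ∣ p ∣
  length-filter-∈? {zero}  []      = ≡.refl
  length-filter-∈? {suc n} (s ∷ p) = ≡.trans (≡.cong (length ∘ filter (_∈? (s ∷ p)) ∘ (zero ∷_))
    (≡.sym (List.map-tabulate (λ i → i) suc))) (first s)
    where
    shift : ∀ s xs → length (filter (_∈? (s ∷ p)) (List.map suc xs)) ≡ length (filter (_∈? p) xs)
    shift s []       = ≡.refl
    shift s (x ∷ xs) with does (x ∈? p)
    ... | true  = ≡.cong suc (shift s xs)
    ... | false = shift s xs
    first : ∀ s → length (filter (_∈? (s ∷ p)) (zero ∷ List.map suc (allFin n))) ≡ ∣ s ∷ p ∣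
    first inside  = ≡.cong suc (≡.trans (shift inside (allFin n)) (length-filter-∈? p))
    first outside = ≡.trans (shift outside (allFin n)) (length-filter-∈? p)

  ∈V⇒block : ∀ {i v} → v ∈ V i → block v ≡ i
  ∈V⇒block {i} {v} v∈V with block v Fin.≟ i | ≡.trans (≡.sym (Vec.lookup∘tabulate _ v)) (Vec.[]=⇒lookup v∈V)
  ... | yes eq | _ = eq

  block⇒∈V : ∀ v → v ∈ V (block v)
  block⇒∈V v = Vec.lookup⇒[]= v _ (≡.trans (Vec.lookup∘tabulate _ v) (dec-true (block v Fin.≟ block v) ≡.refl))

  length-members : ∀ i → length (members i) ≡ b
  length-members i = ≡.trans (length-filter-∈? (V i)) (∣V∣≡b i)

  ∈members⇒block : ∀ {i v} → v ∈ˡ members i → block v ≡ i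
  ∈members⇒block {i} {v} v∈ = ∈V⇒block (proj₂ (∈-filter⁻ (_∈? V i) {xs = allFin n} v∈))

  abstract
    E-draw : ∀ i φ → E (draw i) φ ≈ q * ∑ (members i) φ
    E-draw i φ = trans (trans (E-weighted _ (members i) φ) (∑-*ˡ (members i) (1/ length (members i)) φ))
      (reflexive (≡.cong (λ l → 1/ l * ∑ (members i) φ) (length-members i)))

    draw-mass : ∀ i → E (draw i) (λ _ → 1#) ≈ 1#
    draw-mass i = begin
      E (draw i) (λ _ → 1#)               ≈⟨ E-draw i _ ⟩
      q * ∑ (members i) (λ _ → 1#)        ≈⟨ *-congˡ (∑-const (members i) 1#) ⟩
      q * (fromℕ (length (members i)) * 1#) ≡⟨ ≡.cong (λ l → q * (fromℕ l * 1#)) (length-members i) ⟩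
      q * (fromℕ b * 1#)                  ≈⟨ solve 2 (λ q b → q :* (b :* :1) := b :* q) refl q (fromℕ b) ⟩
      fromℕ b * q                         ≈⟨ 1/-inverseʳ 0<b ⟩
      1#                                  ∎
      where open SetoidReasoning setoid

    draw-supported : ∀ i → Supported (draw i) (λ v → block v ≡ i)
    draw-supported i = supported λ {v} {p} vp∈ → go vp∈
      where
      go : ∀ {v p} → (v , p) ∈ˡ draw i → 0# ≤ p × block v ≡ i
      go vp∈ with ∈-map⁻ _ vp∈
      ... | v , v∈ , ≡.refl =
        ≡.subst (λ l → 0# ≤ 1/ l) (≡.sym (length-members i)) q-nonNeg , ∈members⇒block v∈

    draw-point : ∀ i v → E (draw i) (λ u → [ u Fin.≟ v ]ᵢ) ≤ q
    draw-point i v = ≤-respˡ-≈ (sym (E-draw i _)) (≤-respʳ-≈ (*-identityʳ q)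
      (*-monoˡ-≤ q-nonNeg (∑-indicator-≤1 Fin._≟_
        (Unique.filter⁺ (_∈? V i) (Unique.allFin⁺ n)) v)))

  -- Nothing in the type `Selection` ties entry `i` to block `i`. This invariant does; it holds
  -- initially and is kept by every redraw.
  Legit : Pred Selection 0ℓ
  Legit x = ∀ i → block (lookup x i) ≡ i

  independently-supported : ∀ {m} (ds : Vec (Dist A) m) {P : Fin m → Pred A 0ℓ} →
    (∀ i → Supported (lookup ds i) (P i)) → Supported (independently ds) (λ as → ∀ i → P i (lookup as i))
  independently-supported []       supp = return-supported [] λ ()
  independently-supported (d ∷ ds) supp = >>=-supported (supp zero) λ {a} Pa →
    >>=-supported (independently-supported ds (supp ∘ suc)) λ {as} Pas →
    return-supported (a ∷ as) λ { zero → Pa ; (suc i) → Pas i }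

  independently-mass : ∀ {m} (ds : Vec (Dist A) m) {P : Fin m → Pred A 0ℓ} →
    (∀ i → Supported (lookup ds i) (P i)) → (∀ i → E (lookup ds i) (λ _ → 1#) ≈ 1#) →
    E (independently ds) (λ _ → 1#) ≈ 1#
  independently-mass []    supp mass = E-return [] _
  independently-mass (d ∷ ds) supp mass = >>=-mass (supp zero)
    (λ _ → >>=-mass (independently-supported ds (supp ∘ suc)) (λ _ → E-return _ _)
      (independently-mass ds (supp ∘ suc) (mass ∘ suc)))
    (mass zero)

  -- Iterated expectation for independent draws: for fixed `a` the inner one is at most `φ a * s`,
  -- and the outer one then contributes `r`.
  E-product-≤ : ∀ {d : Dist A} {d′ : Dist B} {P : Pred A 0ℓ} {P′ : Pred B 0ℓ} {φ ψ r s} {χ : A → B → Carrier} →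
    Supported d P → Supported d′ P′ → (∀ a → 0# ≤ φ a) → 0# ≤ s →
    E d φ ≤ r → E d′ ψ ≤ s → (∀ a b → χ a b ≤ φ a * ψ b) →
    E d (λ a → E d′ (χ a)) ≤ r * s
  E-product-≤ {d = d} {d′} {φ = φ} {ψ} {r} {s} {χ} d-supp d′-supp 0≤φ 0≤s Eφ≤r Eψ≤s χ≤ = begin
    E d (λ a → E d′ (χ a))      ≲⟨ E-mono d-supp (λ {a} _ → inner a) ⟩
    E d (λ a → s * φ a)         ≈⟨ E-*ˡ d s φ ⟩
    s * E d φ                   ≲⟨ *-monoˡ-≤ 0≤s Eφ≤r ⟩
    s * r                       ≈⟨ *-comm s r ⟩
    r * s                       ∎
    where
    open ≤-Reasoning
    inner : ∀ a → E d′ (χ a) ≤ s * φ a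
    inner a = begin
      E d′ (χ a)                  ≲⟨ E-mono d′-supp (λ {b} _ → χ≤ a b) ⟩
      E d′ (λ b → φ a * ψ b)      ≈⟨ E-*ˡ d′ (φ a) ψ ⟩
      φ a * E d′ ψ                ≲⟨ *-monoˡ-≤ (0≤φ a) Eψ≤s ⟩
      φ a * s                     ≈⟨ *-comm _ s ⟩
      s * φ a                     ∎

  independently-point : ∀ {m} (ds : Vec (Dist Vertex) m) {P : Fin m → Pred Vertex 0ℓ} →
    (∀ i → Supported (lookup ds i) (P i)) →
    (∀ i v → E (lookup ds i) (λ u → [ u Fin.≟ v ]ᵢ) ≤ q) → ∀ ys →
    E (independently ds) (λ xs → [ Vec.≡-dec Fin._≟_ xs ys ]ᵢ) ≤ q ^ m
  independently-point []    supp point [] = ≤-reflexive (E-return [] _)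
  independently-point {m = suc m} (d ∷ ds) supp point (y ∷ ys) = ≤-respˡ-≈
    (sym (trans (E->>= d _ _) (E-cong (supp zero) λ _ → trans (E->>= (independently ds) _ _)
      (E-cong (independently-supported ds (supp ∘ suc)) λ _ → E-return _ _))))
    (E-product-≤ (supp zero) (independently-supported ds (supp ∘ suc)) (λ x → ind-nonNeg (x Fin.≟ y))
      (^-nonNeg q-nonNeg m) (point zero y) (independently-point ds (supp ∘ suc) (point ∘ suc) ys)
      λ x xs → ind-≤ (Vec.≡-dec Fin._≟_ (x ∷ xs) (y ∷ ys))
        (*-nonNeg (ind-nonNeg (x Fin.≟ y)) (ind-nonNeg (Vec.≡-dec Fin._≟_ xs ys)))
        λ eq → ≤-reflexive (sym (trans (*-cong (ind-yes (x Fin.≟ y) (Vec.∷-injectiveˡ eq))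
          (ind-yes (Vec.≡-dec Fin._≟_ xs ys) (Vec.∷-injectiveʳ eq))) (*-identityˡ 1#))))

  initial : Dist Selection
  initial = independently (tabulate draw)

  private
    lookup-draw : ∀ {r} (R : Fin k → Dist Vertex → Set r) → (∀ i → R i (draw i)) → ∀ i → R i (lookup (tabulate draw) i)
    lookup-draw R Rdraw i = ≡.subst (R i) (≡.sym (Vec.lookup∘tabulate draw i)) (Rdraw i)

    tabulate-draw-supported : ∀ i → Supported (lookup (tabulate draw) i) (λ v → block v ≡ i)
    tabulate-draw-supported = lookup-draw (λ i d → Supported d (λ v → block v ≡ i)) draw-supported

  initial-supported : Supported initial Legit
  initial-supported = independently-supported (tabulate draw) tabulate-draw-supported

  initial-mass : E initial (λ _ → 1#) ≈ 1#
  initial-mass = independently-mass (tabulate draw) tabulate-draw-supported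
    (lookup-draw (λ i d → E d (λ _ → 1#) ≈ 1#) draw-mass)

  initial-point : ∀ y → E initial (λ x → [ x ≟ˢ y ]ᵢ) ≤ q ^ k
  initial-point = independently-point (tabulate draw) tabulate-draw-supported
    (lookup-draw (λ i d → ∀ v → E d (λ u → [ u Fin.≟ v ]ᵢ) ≤ q) draw-point)

  Legit-update : ∀ x {i v} → Legit x → block v ≡ i → Legit (x [ i ]≔ v)
  Legit-update x {i} {v} legit block≡ j with j Fin.≟ i
  ... | yes ≡.refl = ≡.trans (≡.cong block (Vec.lookup∘update i x v)) block≡
  ... | no  j≢i    = ≡.trans (≡.cong block (Vec.lookup∘update′ j≢i x v)) (legit j)

  redraw-supported : ∀ e x → Legit x → Supported (redraw e x) Legit
  redraw-supported (u , v) x legit = >>=-supported (draw-supported (block u)) λ {u′} bu →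
    >>=-supported (draw-supported (block v)) λ bv →
    return-supported _ (Legit-update (x [ block u ]≔ u′) (Legit-update x legit bu) bv)

  redraw-mass : ∀ e x → E (redraw e x) (λ _ → 1#) ≈ 1#
  redraw-mass (u , v) x = >>=-mass (draw-supported (block u))
    (λ _ → >>=-mass (draw-supported (block v)) (λ _ → E-return _ _) (draw-mass (block v)))
    (draw-mass (block u))

  restore : Event → Selection → Selection
  restore (u , v) y = y [ block u ]≔ u [ block v ]≔ v

  -- Both `u` and `v` were selected, so putting them back into the outcome recovers `x`. From that
  -- one `x`, two independent draws must hit prescribed values, at cost `q` each; from any other `x`
  -- the outcome `y` is impossible.
  redraw-point : ∀ {u v x} → block u ≢ block v → Selected x u → Selected x v → ∀ y →
    E (redraw (u , v) x) (λ x′ → [ x′ ≟ˢ y ]ᵢ) ≤ q * q * [ restore (u , v) y ≟ˢ x ]ᵢ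
  redraw-point {u} {v} {x} bu≢bv xu xv y with restore (u , v) y ≟ˢ x
  ... | yes _ = ≤-respʳ-≈ (sym (*-identityʳ _)) (≤-respˡ-≈ (sym expand)
    (E-product-≤ (draw-supported (block u)) (draw-supported (block v))
      (λ u′ → ind-nonNeg (u′ Fin.≟ lookup y (block u))) q-nonNeg
      (draw-point (block u) (lookup y (block u))) (draw-point (block v) (lookup y (block v)))
      λ u′ v′ → ind-≤ ((x [ block u ]≔ u′ [ block v ]≔ v′) ≟ˢ y)
        (*-nonNeg (ind-nonNeg (u′ Fin.≟ lookup y (block u))) (ind-nonNeg (v′ Fin.≟ lookup y (block v))))
        λ { ≡.refl → ≤-reflexive (sym (trans
          (*-cong (ind-yes (u′ Fin.≟ _) (≡.sym (≡.trans
                    (Vec.lookup∘update′ bu≢bv (x [ block u ]≔ u′) v′) (Vec.lookup∘update (block u) x u′))))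
                  (ind-yes (v′ Fin.≟ _) (≡.sym (Vec.lookup∘update (block v) (x [ block u ]≔ u′) v′))))
          (*-identityˡ 1#))) }))
    where
    expand : E (redraw (u , v) x) (λ x′ → [ x′ ≟ˢ y ]ᵢ)
           ≈ E (draw (block u)) (λ u′ → E (draw (block v)) (λ v′ → [ (x [ block u ]≔ u′ [ block v ]≔ v′) ≟ˢ y ]ᵢ))
    expand = trans (E->>= (draw (block u)) _ _) (E-cong (draw-supported (block u)) λ _ →
      trans (E->>= (draw (block v)) _ _) (E-cong (draw-supported (block v)) λ _ → E-return _ _))
  ... | no restore≢x = ≤-reflexive (trans
    (trans (E->>= (draw (block u)) _ _) (trans (E-cong (draw-supported (block u)) λ {u′} _ →
      trans (E->>= (draw (block v)) _ _) (trans (E-cong (draw-supported (block v)) λ {v′} _ →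
        trans (E-return _ _) (ind-no ((x [ block u ]≔ u′ [ block v ]≔ v′) ≟ˢ y) (impossible u′ v′)))
        (E-0 (draw (block v))))) (E-0 (draw (block u)))))
    (sym (zeroʳ _)))
    where
    impossible : ∀ u′ v′ → x [ block u ]≔ u′ [ block v ]≔ v′ ≢ y
    impossible u′ v′ ≡.refl = restore≢x (≡.trans
      (≡.cong (_[ block v ]≔ v) (≡.trans
        (Vec.[]≔-commutes (x [ block u ]≔ u′) (block v) (block u) (bu≢bv ∘ ≡.sym))
        (≡.cong (_[ block v ]≔ v′) (≡.trans (Vec.[]≔-idempotent x (block u))
          (≡.trans (≡.cong (x [ block u ]≔_) (≡.sym xu)) (Vec.[]≔-lookup x (block u)))))))
      (≡.trans (Vec.[]≔-idempotent x (block v))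
        (≡.trans (≡.cong (x [ block v ]≔_) (≡.sym xv)) (Vec.[]≔-lookup x (block v)))))

-- Heaps of edges over the blocks, and canonical words for them

updateAt-injective : ∀ {a} {A : Set a} {n} {f : A → A} → (∀ {x y} → f x ≡ f y → x ≡ y) →
                     ∀ (i : Fin n) {xs ys} → updateAt xs i f ≡ updateAt ys i f → xs ≡ ys
updateAt-injective f-inj zero    {_ ∷ _} {_ ∷ _} eq =
  ≡.cong₂ _∷_ (f-inj (Vec.∷-injectiveˡ eq)) (Vec.∷-injectiveʳ eq)
updateAt-injective f-inj (suc i) {_ ∷ _} {_ ∷ _} eq =
  ≡.cong₂ _∷_ (Vec.∷-injectiveˡ eq) (updateAt-injective f-inj i (Vec.∷-injectiveʳ eq))

unless : ∀ {a p} {A : Set a} {P : Set p} → Dec P → List A → List A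
unless (yes _) xs = []
unless (no _)  xs = xs

unless-no : ∀ {a p} {A : Set a} {P : Set p} (P? : Dec P) {xs : List A} → ¬ P → unless P? xs ≡ xs
unless-no (yes p) ¬p = ⊥-elim (¬p p)
unless-no (no _)  ¬p = ≡.refl

unless-yes : ∀ {a p} {A : Set a} {P : Set p} (P? : Dec P) {xs : List A} → P → unless P? xs ≡ []
unless-yes (yes _) p = ≡.refl
unless-yes (no ¬p) p = ⊥-elim (¬p p)

module Heaps {n k b : ℕ} (G : Graph n) (𝓟 : Partition n k b) where
  open Graph G using (edges)
  open Partition 𝓟 using (block)

  Edge : Set
  Edge = Fin n × Fin n

  -- Edges within a block are left out: their events never occur (`trueEvent⇒crossing`), and the two
  -- blocks of a piece have to be distinct for `∏-increase-two`.
  links : List Edge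
  links = filter (λ (u , v) → ¬? (block u Fin.≟ block v)) edges

  blocks : Edge → List (Fin k)
  blocks (u , v) = block u ∷ block v ∷ []

  open DecMembership (Fin._≟_ {k}) using () renaming (_∈?_ to _∈ˡ?_)

  linksAt : Fin k → List Edge
  linksAt i = filter (λ e → i ∈ˡ? blocks e) links

  Touches : Edge → List (Fin k) → Set
  Touches e S = Any (_∈ˡ S) (blocks e)

  touches? : ∀ e S → Dec (Touches e S)
  touches? e S = any? (_∈ˡ? S) (blocks e)

  Touches-mono : ∀ {e S S′} → S ⊆ˡ S′ → Touches e S → Touches e S′
  Touches-mono S⊆S′ = Any.map S⊆S′

  -- Block i carries the stack of the vertices of the edges piled on it, the
  -- uppermost one in the first component.  The resamplings of a run are piled
  -- up backwards in time, starting from the final selection at the base.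
  Heap : Set
  Heap = Vec (Fin n × List (Fin n)) k

  _≟ʰ_ : DecidableEquality Heap
  _≟ʰ_ = Vec.≡-dec (Product.≡-dec Fin._≟_ (List.≡-dec Fin._≟_))

  push : Fin n → Heap → Heap
  push v h = updateAt h (block v) λ (a , as) → v , a ∷ as

  add : Edge → Heap → Heap
  add (u , v) h = push v (push u h)

  addAll : List Edge → Heap → Heap
  addAll w h = foldr add h w

  empty : Vec (Fin n) k → Heap
  empty = Vec.map λ v → v , []

  tops : Heap → Vec (Fin n) k
  tops = Vec.map proj₁

  tops-empty : ∀ y → tops (empty y) ≡ y
  tops-empty y = ≡.trans (≡.sym (Vec.map-∘ proj₁ _ y)) (Vec.map-id y)

  tops-push : ∀ v h → tops (push v h) ≡ tops h [ block v ]≔ v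
  tops-push v h = Vec.map-updateAt h (block v) ≡.refl

  tops-add : ∀ u v h → tops (add (u , v) h) ≡ tops h [ block u ]≔ u [ block v ]≔ v
  tops-add u v h = ≡.trans (tops-push v (push u h)) (≡.cong (_[ block v ]≔ v) (tops-push u h))

  push-injective : ∀ v {h h′} → push v h ≡ push v h′ → h ≡ h′
  push-injective v = updateAt-injective
    (λ eq → ≡.cong₂ _,_ (List.∷-injectiveˡ (Product.,-injectiveʳ eq)) (List.∷-injectiveʳ (Product.,-injectiveʳ eq)))
    (block v)

  add-injective : ∀ e {h h′} → add e h ≡ add e h′ → h ≡ h′
  add-injective (u , v) eq = push-injective u (push-injective v eq)

  push-comm : ∀ u v h → block u ≢ block v → push u (push v h) ≡ push v (push u h)
  push-comm u v h bu≢bv = Vec.updateAt-commutes (block u) (block v) bu≢bv h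

  add-comm : ∀ e f h → ¬ Touches e (blocks f) → add e (add f h) ≡ add f (add e h)
  add-comm (u , v) (s , t) h apart = begin
    push v (push u (push t (push s h)))    ≡⟨ ≡.cong (push v) (push-comm u t (push s h) λ eq → apart (here (there (here eq)))) ⟩
    push v (push t (push u (push s h)))    ≡⟨ ≡.cong (push v ∘ push t) (push-comm u s h λ eq → apart (here (here eq))) ⟩
    push v (push t (push s (push u h)))    ≡⟨ push-comm v t (push s (push u h)) (λ eq → apart (there (here (there (here eq))))) ⟩
    push t (push v (push s (push u h)))    ≡⟨ ≡.cong (push t) (push-comm v s (push u h) λ eq → apart (there (here (here eq)))) ⟩
    push t (push s (push v (push u h)))    ∎
    where open ≡-Reasoning

  -- Words that differ by swapping edges with disjoint blocks build equal stacks (`add-comm`);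
  -- `deduplicate` makes them count once.
  heaps : Vec (Fin n) k → ℕ → List Heap
  heaps y zero    = empty y ∷ []
  heaps y (suc m) = deduplicate _≟ʰ_ (concatMap (λ e → List.map (add e) (heaps y m)) links)

  heaps-unique : ∀ y m → Unique (heaps y m)
  heaps-unique y zero    = [] ∷ []
  heaps-unique y (suc m) = UniqueDec.deduplicate-! _≟ʰ_ _

  ∈-heaps-suc⁺ : ∀ {y m e h} → e ∈ˡ links → h ∈ˡ heaps y m → add e h ∈ˡ heaps y (suc m)
  ∈-heaps-suc⁺ {e = e} e∈ h∈ = ∈-deduplicate⁺ _≟ʰ_
    (∈-concatMap⁺ _ (Any.map (λ { ≡.refl → ∈-map⁺ (add e) h∈ }) e∈))

  ∈-heaps⁻ : ∀ {y h} m → h ∈ˡ heaps y m →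
             ∃ λ w → length w ≡ m × All (_∈ˡ links) w × h ≡ addAll w (empty y)
  ∈-heaps⁻ zero    (here ≡.refl) = [] , ≡.refl , [] , ≡.refl
  ∈-heaps⁻ {y} (suc m) h∈
    with find (∈-concatMap⁻ (λ e → List.map (add e) (heaps y m)) {xs = links} (∈-deduplicate⁻ _≟ʰ_ _ h∈))
  ... | e , e∈ , h∈′ with ∈-map⁻ (add e) h∈′
  ...   | h′ , h′∈ , ≡.refl with ∈-heaps⁻ m h′∈
  ...     | w , ≡.refl , w∈ , ≡.refl = e ∷ w , ≡.refl , e∈ ∷ w∈ , ≡.refl

  -- Words of m edges, the uppermost edge first, in which every edge that can be
  -- moved to the end (the base of the heap) belongs to E or touches S.  Every
  -- such heap has at least one word here: it is found by deciding for each edge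
  -- of E in turn whether it lies at the base, and then by replacing a block i
  -- of S by the edges at i.
  words : ℕ → List Edge → List (Fin k) → List (List Edge)
  words zero    E       S       = [] ∷ []
  words (suc m) []      []      = []
  words (suc m) []      (i ∷ S) = words (suc m) (linksAt i) S
  words (suc m) (f ∷ E) S       = words (suc m) E S ++
    unless (touches? f S) (List.map (_++ f ∷ []) (words m E (blocks f ++ S)))

  support : List Edge → List (Fin k)
  support = concatMap blocks

  -- Read from the end of the word, which is the base: an edge that meets neither the edges after it
  -- nor `S` could slide down to the base, where only edges of `E` are allowed. Stating this edge by
  -- edge lets it be carried through inductions on the word.
  data Covered (E : List Edge) (S : List (Fin k)) : List Edge → Set where
    []   : Covered E S []
    cons : ∀ {e w} → e ∈ˡ links → e ∈ˡ E ⊎ Touches e (support w ++ S) → Covered E S w → Covered E S (e ∷ w)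

  Covered-map : ∀ {E E′ S S′ w} →
                (∀ {e w} → e ∈ˡ links → e ∈ˡ E ⊎ Touches e (support w ++ S) → e ∈ˡ E′ ⊎ Touches e (support w ++ S′)) →
                Covered E S w → Covered E′ S′ w
  Covered-map f []             = []
  Covered-map f (cons {w = w} e∈ c cs) = cons e∈ (f {w = w} e∈ c) (Covered-map (λ {e} {w} → f {e} {w}) cs)

  ++⁺-⊆ : ∀ {a} {A : Set a} (xs : List A) {xs′ ys ys′} → xs ⊆ˡ xs′ → ys ⊆ˡ ys′ → xs ++ ys ⊆ˡ xs′ ++ ys′
  ++⁺-⊆ xs {xs′} xs⊆ ys⊆ z∈ with ∈-++⁻ xs z∈
  ... | inj₁ z∈xs = ∈-++⁺ˡ (xs⊆ z∈xs)
  ... | inj₂ z∈ys = ∈-++⁺ʳ xs′ (ys⊆ z∈ys)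

  Covered-none : ∀ {w} → Covered [] [] w → w ≡ []
  Covered-none []                     = ≡.refl
  Covered-none (cons _ (inj₂ t) cs) with Covered-none cs
  ... | ≡.refl with Any.satisfied t
  ...   | _ , ()

  Covered-linksAt : ∀ {i S w} → Covered [] (i ∷ S) w → Covered (linksAt i) S w
  Covered-linksAt {i} {S} = Covered-map λ {e} {w} → go {e} {w}
    where
    go : ∀ {e w} → e ∈ˡ links → e ∈ˡ [] ⊎ Touches e (support w ++ i ∷ S) → e ∈ˡ linksAt i ⊎ Touches e (support w ++ S)
    go {e} {w} e∈ (inj₂ t) with i ∈ˡ? blocks e
    ... | yes i∈e = inj₁ (∈-filter⁺ (λ e → i ∈ˡ? blocks e) e∈ i∈e)
    ... | no  i∉e = inj₂ (lemma (blocks e) i∉e t)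
      where
      lemma : ∀ js → ¬ (i ∈ˡ js) → Any (_∈ˡ support w ++ i ∷ S) js → Any (_∈ˡ support w ++ S) js
      lemma (j ∷ js) i∉ (there any) = there (lemma js (i∉ ∘ there) any)
      lemma (j ∷ js) i∉ (here j∈) with ∈-++⁻ (support w) j∈
      ... | inj₁ j∈w            = here (∈-++⁺ˡ j∈w)
      ... | inj₂ (here ≡.refl)  = ⊥-elim (i∉ (here ≡.refl))
      ... | inj₂ (there j∈S)    = here (∈-++⁺ʳ (support w) j∈S)

  addAll-add : ∀ f w h → ¬ Touches f (support w) → add f (addAll w h) ≡ addAll w (add f h)
  addAll-add f []      h apart = ≡.refl
  addAll-add f (e ∷ w) h apart = ≡.trans
    (add-comm f e (addAll w h) (apart ∘ Touches-mono ∈-++⁺ˡ))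
    (≡.cong (add e) (addAll-add f w h (apart ∘ Touches-mono (∈-++⁺ʳ (blocks e)))))

  -- Some occurrence of `f` is moved to the end of `w`. By `support-rest`, edges above that rested
  -- on `w` still rest on `rest` or on `f`; this drives the induction in `base?`.
  record AtBase (f : Edge) (E : List Edge) (S : List (Fin k)) (w : List Edge) : Set where
    constructor atBase
    field
      rest         : List Edge
      apart        : ¬ Touches f S
      length-rest  : length w ≡ suc (length rest)
      addAll-rest  : ∀ h → addAll w h ≡ addAll rest (add f h)
      Covered-rest : Covered E (blocks f ++ S) rest
      support-rest : support w ⊆ˡ support rest ++ blocks f

  -- Induction from the base upwards. Once a copy of `f` lies at the base, the edges above it are
  -- kept. Otherwise a leading `f` slides down when it touches neither what is below it nor `S`; if
  -- it does touch them, it is covered without belonging to `E`.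
  base? : ∀ {f E S w} → Covered (f ∷ E) S w → Covered E S w ⊎ AtBase f E S w
  base? [] = inj₁ []
  base? {f} {E} {S} (cons {e} {w} e∈ c cs) with base? cs
  ... | inj₂ (atBase r apart len act cov sup) = inj₂ (atBase (e ∷ r) apart (≡.cong suc len)
        (≡.cong (add e) ∘ act) (cons e∈ (c′ c) cov)
        (λ {i} i∈ → ≡.subst (i ∈ˡ_) (≡.sym (List.++-assoc (blocks e) (support r) (blocks f)))
          (++⁺-⊆ (blocks e) {blocks e} (λ i∈ → i∈) sup i∈)))
    where
    c′ : e ∈ˡ f ∷ E ⊎ Touches e (support w ++ S) → e ∈ˡ E ⊎ Touches e (support r ++ blocks f ++ S)
    -- A further copy of `f` rests on the one at the base, since both use the same blocks.
    c′ (inj₁ (here ≡.refl)) = inj₂ (here (∈-++⁺ʳ (support r) (here ≡.refl)))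
    c′ (inj₁ (there e∈E))   = inj₁ e∈E
    c′ (inj₂ t)             = inj₂ (Touches-mono (λ {i} i∈ →
      ≡.subst (i ∈ˡ_) (List.++-assoc (support r) (blocks f) S) (++⁺-⊆ (support w) sup (λ i∈ → i∈) i∈)) t)
  ... | inj₁ cov with c
  ...   | inj₂ t           = inj₁ (cons e∈ (inj₂ t) cov)
  ...   | inj₁ (there e∈E) = inj₁ (cons e∈ (inj₁ e∈E) cov)
  ...   | inj₁ (here ≡.refl) with touches? f (support w ++ S)
  ...     | yes t = inj₁ (cons e∈ (inj₂ t) cov)
  ...     | no ¬t = inj₂ (atBase w (¬t ∘ Touches-mono (∈-++⁺ʳ (support w))) ≡.refl
            (λ h → addAll-add f w h (¬t ∘ Touches-mono ∈-++⁺ˡ))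
            (Covered-map (λ {e} {w} → weaken {e} {w}) cov)
            λ i∈ → swap (∈-++⁻ (blocks f) i∈))
    where
    swap : ∀ {i} → i ∈ˡ blocks f ⊎ i ∈ˡ support w → i ∈ˡ support w ++ blocks f
    swap (inj₁ i∈f) = ∈-++⁺ʳ (support w) i∈f
    swap (inj₂ i∈w) = ∈-++⁺ˡ i∈w
    weaken : ∀ {e w} → e ∈ˡ links → e ∈ˡ E ⊎ Touches e (support w ++ S) → e ∈ˡ E ⊎ Touches e (support w ++ blocks f ++ S)
    weaken _ (inj₁ e∈E) = inj₁ e∈E
    weaken {w = w} _ (inj₂ t) = inj₂ (Touches-mono (++⁺-⊆ (support w) {support w} (λ i∈ → i∈) (∈-++⁺ʳ (blocks f))) t)

  Complete : ℕ → List Edge → List (Fin k) → Set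
  Complete m E S = ∀ {w} → length w ≡ m → Covered E S w →
                   ∃ λ w′ → w′ ∈ˡ words m E S × (∀ h → addAll w h ≡ addAll w′ h)

  -- Follows the two halves of `words`: `base?` either covers the word without `f`, or moves `f` to
  -- the end and leaves a shorter word that may rest on the blocks of `f` as well.
  words-complete-∷ : ∀ {m f E S} → Complete (suc m) E S → Complete m E (blocks f ++ S) →
                     Complete (suc m) (f ∷ E) S
  words-complete-∷ {m} {f} {E} {S} without including len cov with base? cov
  ... | inj₁ cov′ with without len cov′
  ...   | w′ , w′∈ , eq = w′ , ∈-++⁺ˡ w′∈ , eq
  words-complete-∷ {m} {f} {E} {S} without including len cov | inj₂ (atBase r apart len′ act cov′ _)
    with including (ℕ.suc-injective (≡.trans (≡.sym len′) len)) cov′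
  ... | w′ , w′∈ , eq = w′ ++ f ∷ [] ,
    ∈-++⁺ʳ (words (suc m) E S)
      (≡.subst (_ ∈ˡ_) (≡.sym (unless-no (touches? f S) apart)) (∈-map⁺ (_++ f ∷ []) w′∈)) ,
    λ h → ≡.trans (act h) (≡.trans (eq (add f h)) (≡.sym (List.foldr-++ add h w′ (f ∷ []))))

  words-complete : ∀ m E S → Complete m E S
  words-complete zero    E       S       {[]}    len cov = [] , here ≡.refl , λ _ → ≡.refl
  words-complete (suc m) []      []      {_ ∷ _} len cov with Covered-none cov
  ... | ()
  words-complete (suc m) []      (i ∷ S) len cov = words-complete (suc m) (linksAt i) S len (Covered-linksAt cov)
  words-complete (suc m) (f ∷ E) S               =
    words-complete-∷ (words-complete (suc m) E S) (words-complete m E (blocks f ++ S))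

  -- For `E = links` and `S = []`, being covered only says that all edges are links, so every heap
  -- has one of the canonical words. This bounds the number of heaps by a number that obeys a
  -- recursion.
  heaps⊆words : ∀ {y h} m → h ∈ˡ heaps y m → h ∈ˡ List.map (λ w → addAll w (empty y)) (words m links [])
  heaps⊆words {y} m h∈ with ∈-heaps⁻ m h∈
  ... | w , len , w∈ , ≡.refl with words-complete m links [] len (covered w∈)
    where
    covered : ∀ {w} → All (_∈ˡ links) w → Covered links [] w
    covered []        = []
    covered (e∈ ∷ w∈) = cons e∈ (inj₁ e∈) (covered w∈)
  ...   | w′ , w′∈ , eq = ≡.subst (_∈ˡ _) (≡.sym (eq (empty y))) (∈-map⁺ (λ w → addAll w (empty y)) w′∈)

-- Finite products and the raising of two factors

module FiniteProducts {c ℓ₁ ℓ₂} (ℛ : RealField c ℓ₁ ℓ₂) where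
  open RealField ℛ hiding (zero)
  open OrderedFieldProperties archimedeanField

  ∏ : ∀ {k} → (Fin k → Carrier) → Carrier
  ∏ {zero}  a = 1#
  ∏ {suc k} a = a zero * ∏ (a ∘ suc)

  abstract
    ∏-cong : ∀ {k} {a a′ : Fin k → Carrier} → (∀ i → a i ≈ a′ i) → ∏ a ≈ ∏ a′
    ∏-cong {zero}  a≈ = refl
    ∏-cong {suc k} a≈ = *-cong (a≈ zero) (∏-cong (a≈ ∘ suc))

    ∏-nonNeg : ∀ {k} {a : Fin k → Carrier} → (∀ i → 0# ≤ a i) → 0# ≤ ∏ a
    ∏-nonNeg {zero}  0≤a = 0≤1
    ∏-nonNeg {suc k} 0≤a = *-nonNeg (0≤a zero) (∏-nonNeg (0≤a ∘ suc))

    ∏-mono : ∀ {k} {a a′ : Fin k → Carrier} → (∀ i → 0# ≤ a i) → (∀ i → a i ≤ a′ i) → ∏ a ≤ ∏ a′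
    ∏-mono {zero}  0≤a a≤ = ≤-refl
    ∏-mono {suc k} 0≤a a≤ = *-mono-≤ (0≤a zero)
      (∏-nonNeg λ i → ≤-trans (0≤a (suc i)) (a≤ (suc i))) (a≤ zero) (∏-mono (0≤a ∘ suc) (a≤ ∘ suc))

    ∏-const : ∀ k z → ∏ {k} (λ _ → z) ≈ z ^ k
    ∏-const zero    z = refl
    ∏-const (suc k) z = *-congˡ (∏-const k z)

  without : ∀ {k} → Fin k → (Fin k → Carrier) → Fin k → Carrier
  without i a j = if does (j Fin.≟ i) then 1# else a j

  abstract
    without-nonNeg : ∀ {k} i {a : Fin k → Carrier} → (∀ j → 0# ≤ a j) → ∀ j → 0# ≤ without i a j
    without-nonNeg i 0≤a j with does (j Fin.≟ i)
    ... | true  = 0≤1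
    ... | false = 0≤a j

    without-mono : ∀ {k} i {a a′ : Fin k → Carrier} → (∀ j → a j ≤ a′ j) → ∀ j → without i a j ≤ without i a′ j
    without-mono i a≤a′ j with does (j Fin.≟ i)
    ... | true  = ≤-refl
    ... | false = a≤a′ j

    ∏-without : ∀ {k} (a : Fin k → Carrier) i → ∏ a ≈ a i * ∏ (without i a)
    ∏-without a zero    = *-congˡ (sym (*-identityˡ _))
    ∏-without a (suc i) = trans (*-congˡ (∏-without (a ∘ suc) i))
      (solve 3 (λ x y z → x :* (y :* z) := y :* (x :* z)) refl (a zero) (a (suc i)) (∏ (without i (a ∘ suc))))

    -- (x + ν)(y + ν) ≥ xy + 2ν when x, y ≥ 1.
    ∏-increase-two : ∀ {k} {a a⁰ a⁺ : Fin k → Carrier} {ν} {i j} → 0# ≤ ν → i ≢ j →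
      (∀ l → 1# ≤ a l) → (∀ l → a l ≤ a⁺ l) → a i + ν ≤ a⁺ i → a j + ν ≤ a⁺ j →
      a⁰ i ≈ 1# → a⁰ j ≈ 1# → (∀ l → l ≢ i → l ≢ j → a⁰ l ≈ a l) →
      ∏ a + (ν + ν) * ∏ a⁰ ≤ ∏ a⁺
    ∏-increase-two {k} {a = a} {a⁰} {a⁺} {ν} {i} {j} 0≤ν i≢j 1≤a a≤a⁺ ai+ν≤ aj+ν≤ a⁰i≈1 a⁰j≈1 a⁰≈a = begin
      ∏ a + (ν + ν) * ∏ a⁰
        ≈⟨ +-cong (split a) (*-congˡ (∏-cong rest-a⁰)) ⟩
      a i * (a j * X) + (ν + ν) * X
        ≲⟨ x≤x+y (*-nonNeg (+-nonNeg (+-nonNeg (*-nonNeg 0≤ν (x≤y⇒0≤y-x (1≤a i)))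
             (*-nonNeg 0≤ν (x≤y⇒0≤y-x (1≤a j)))) (*-nonNeg 0≤ν 0≤ν)) 0≤X) ⟩
      (a i * (a j * X) + (ν + ν) * X) + (ν * (a i - 1#) + ν * (a j - 1#) + ν * ν) * X
        ≈⟨ solve 4 (λ x y n X → (x :* (y :* X) :+ (n :+ n) :* X) :+ (n :* (x :- :1) :+ n :* (y :- :1) :+ n :* n) :* X
                      := (x :+ n) :* ((y :+ n) :* X)) refl (a i) (a j) ν X ⟩
      (a i + ν) * ((a j + ν) * X)
        ≲⟨ *-mono-≤ (0≤a+ν i) (*-nonNeg (0≤a⁺ j) (∏-nonNeg 0≤rest⁺)) ai+ν≤
             (*-mono-≤ (0≤a+ν j) (∏-nonNeg 0≤rest⁺) aj+ν≤ (∏-mono 0≤rest rest-mono)) ⟩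
      a⁺ i * (a⁺ j * ∏ (rest a⁺))
        ≈⟨ split a⁺ ⟨
      ∏ a⁺ ∎
      where
      open ≤-Reasoning
      rest : (Fin k → Carrier) → Fin k → Carrier
      rest a = without j (without i a)
      X : Carrier
      X = ∏ (rest a)
      0≤a : ∀ l → 0# ≤ a l
      0≤a l = ≤-trans 0≤1 (1≤a l)
      0≤a⁺ : ∀ l → 0# ≤ a⁺ l
      0≤a⁺ l = ≤-trans (0≤a l) (a≤a⁺ l)
      0≤a+ν : ∀ l → 0# ≤ a l + ν
      0≤a+ν l = +-nonNeg (0≤a l) 0≤ν
      0≤rest : ∀ l → 0# ≤ rest a l
      0≤rest = without-nonNeg j (without-nonNeg i 0≤a)
      0≤rest⁺ : ∀ l → 0# ≤ rest a⁺ l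
      0≤rest⁺ = without-nonNeg j (without-nonNeg i 0≤a⁺)
      0≤X : 0# ≤ X
      0≤X = ∏-nonNeg 0≤rest
      rest-mono : ∀ l → rest a l ≤ rest a⁺ l
      rest-mono = without-mono j (without-mono i a≤a⁺)
      rest-a⁰ : ∀ l → a⁰ l ≈ rest a l
      rest-a⁰ l with l Fin.≟ j
      ... | yes ≡.refl = a⁰j≈1
      ... | no l≢j with l Fin.≟ i
      ...   | yes ≡.refl = a⁰i≈1
      ...   | no l≢i     = a⁰≈a l l≢i l≢j
      without-≢ : ∀ a → without i a j ≈ a j
      without-≢ a with j Fin.≟ i
      ... | yes j≡i = ⊥-elim (i≢j (≡.sym j≡i))
      ... | no _    = refl
      split : ∀ a → ∏ a ≈ a i * (a j * ∏ (rest a))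
      split a = trans (∏-without a i) (*-congˡ (trans (∏-without (without i a) j) (*-congʳ (without-≢ a))))

-- Generating functions of words and their product bound

module Counting {c ℓ₁ ℓ₂} (ℛ : RealField c ℓ₁ ℓ₂) {n k b : ℕ} (G : Graph n) (𝓟 : Partition n k b) where
  open RealField ℛ hiding (zero)
  open OrderedFieldProperties archimedeanField
  open ExponentialProperties ℛ using (partialSum; partialSum-cong)
  open FiniteSums ℛ
  open FiniteProducts ℛ
  open Partition 𝓟 using (block)
  open Heaps G 𝓟
  open DecMembership (Fin._≟_ {k}) using () renaming (_∈?_ to _∈ˡ?_)

  length-words-touching : ∀ {f S} E → Touches f S → ∀ m → length (words m (f ∷ E) S) ≡ length (words m E S)
  length-words-touching         E t zero    = ≡.refl
  length-words-touching {f} {S} E t (suc m) = ≡.cong length (≡.trans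
    (≡.cong (words (suc m) E S ++_) (unless-yes (touches? f S) t)) (List.++-identityʳ _))

  length-words-apart : ∀ {f S} E → ¬ Touches f S → ∀ m →
    length (words (suc m) (f ∷ E) S) ≡ length (words (suc m) E S) ℕ.+ length (words m E (blocks f ++ S))
  length-words-apart {f} {S} E ¬t m = ≡.trans
    (≡.cong (length ∘ (words (suc m) E S ++_)) (unless-no (touches? f S) ¬t))
    (≡.trans (List.length-++ (words (suc m) E S))
      (≡.cong (length (words (suc m) E S) ℕ.+_) (List.length-map (_++ f ∷ []) (words m E (blocks f ++ S)))))

  module Weights (p : Carrier) (0≤p : 0# ≤ p) where

    wordWeight : List Edge → List (Fin k) → ℕ → Carrier
    wordWeight E S m = p ^ m * fromℕ (length (words m E S))

    -- The generating function of the words at `p`, cut off at length `T`. The cutoff keeps all sums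
    -- finite and serves as induction parameter, since every edge taken off the base lowers it by
    -- one.
    σ : ℕ → List Edge → List (Fin k) → Carrier
    σ T E S = partialSum (wordWeight E S) T

    abstract
      σ-touching : ∀ {f S} E → Touches f S → ∀ T → σ T (f ∷ E) S ≈ σ T E S
      σ-touching E t = partialSum-cong λ m →
        *-congˡ (reflexive (≡.cong fromℕ (length-words-touching E t m)))

      -- A word either has no `f` at its base or ends in `f`. Removing that `f` shortens it by one,
      -- whence the factor `p` and the cutoff `T` in place of `suc T`.
      σ-apart : ∀ {f S} E → ¬ Touches f S → ∀ T → σ (suc T) (f ∷ E) S ≈ σ (suc T) E S + p * σ T E (blocks f ++ S)
      σ-apart E ¬t zero = solve 2 (λ a p → a := a :+ p :* nat 0) refl _ p
      σ-apart {f} {S} E ¬t (suc T) = begin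
        σ (suc T) (f ∷ E) S + p * p ^ T * fromℕ (length (words (suc T) (f ∷ E) S))
          ≈⟨ +-cong (σ-apart E ¬t T) (*-congˡ (trans (reflexive (≡.cong fromℕ (length-words-apart E ¬t T)))
               (fromℕ-+ (length (words (suc T) E S)) (length (words T E (blocks f ++ S)))))) ⟩
        (σ (suc T) E S + p * σ T E (blocks f ++ S)) + p * p ^ T * (l + l′)
          ≈⟨ solve 6 (λ s p s′ x l l′ → (s :+ p :* s′) :+ p :* x :* (l :+ l′)
                        := (s :+ p :* x :* l) :+ p :* (s′ :+ x :* l′)) refl
               (σ (suc T) E S) p (σ T E (blocks f ++ S)) (p ^ T) l l′ ⟩
        σ (suc (suc T)) E S + p * σ (suc T) E (blocks f ++ S) ∎
        where
        open SetoidReasoning setoid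
        l l′ : Carrier
        l  = fromℕ (length (words (suc T) E S))
        l′ = fromℕ (length (words T E (blocks f ++ S)))

      σ-linksAt : ∀ i S T → σ T [] (i ∷ S) ≈ σ T (linksAt i) S
      σ-linksAt i S = partialSum-cong (λ { zero → refl ; (suc m) → refl })

      σ-none : ∀ T → σ T [] [] ≤ 1#
      σ-none zero    = 0≤1
      σ-none (suc T) = ≤-reflexive (go T)
        where
        go : ∀ T → σ (suc T) [] [] ≈ 1#
        go zero    = solve 0 (nat 0 :+ :1 :* (:1 :+ nat 0) := :1) refl
        go (suc T) = trans (+-cong (go T) (zeroʳ _)) (+-identityʳ 1#)

    -- `z` bounds the weight of all that can rest on one block: nothing, or one of at most `D` edges
    -- at the base, of weight `p`, with two blocks to pile on again. `ν` is half of the weight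
    -- `p * (z * z)` of such an edge, one half for each of its blocks.
    module Bounds (z ν : Carrier) (0≤ν : 0# ≤ ν) (2ν≈pz² : ν + ν ≈ p * (z * z))
                  (D : ℕ) (degree≤D : ∀ i → fromℕ (length (linksAt i)) ≤ fromℕ D)
                  (z≈1+Dpz² : z ≈ 1# + fromℕ D * (p * (z * z))) where
      abstract
        0≤pz² : 0# ≤ p * (z * z)
        0≤pz² = *-nonNeg 0≤p (square-nonNeg z)

        0≤z : 0# ≤ z
        0≤z = ≤-respʳ-≈ (sym z≈1+Dpz²) (+-nonNeg 0≤1 (*-nonNeg (fromℕ-nonNeg D) 0≤pz²))

        0≤z^ : ∀ m → 0# ≤ z ^ m
        0≤z^ = ^-nonNeg 0≤z

        -- If all the edges of E share a block then at most one of them lies at the base.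
        σ-star : ∀ T S E {i} → σ (suc T) [] S ≤ z ^ length S → (∀ S → σ T [] S ≤ z ^ length S) →
                 (∀ {e} → e ∈ˡ E → i ∈ˡ blocks e) →
                 σ (suc T) E S ≤ z ^ length S * (1# + fromℕ (length E) * (p * (z * z)))
        σ-star T S [] below _ _ = ≤-respʳ-≈
          (solve 2 (λ x y → x := x :* (:1 :+ nat 0 :* y)) refl (z ^ length S) (p * (z * z))) below
        σ-star T S (f ∷ E) {i} below earlier i∈ = by (touches? f S)
          where
          open ≤-Reasoning
          IH : σ (suc T) E S ≤ z ^ length S * (1# + fromℕ (length E) * (p * (z * z)))
          IH = σ-star T S E below earlier (i∈ ∘ there)
          drop : ∀ E S → (∀ {e} → e ∈ˡ E → i ∈ˡ blocks e) → i ∈ˡ S → σ T E S ≈ σ T [] S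
          drop []      S _  _   = refl
          drop (e ∷ E) S i∈ i∈S = trans
            (σ-touching E (Any.map (λ { ≡.refl → i∈S }) (i∈ (here ≡.refl))) T) (drop E S (i∈ ∘ there) i∈S)
          by : Dec (Touches f S) → σ (suc T) (f ∷ E) S ≤ z ^ length S * (1# + fromℕ (suc (length E)) * (p * (z * z)))
          by (yes t) = begin
            σ (suc T) (f ∷ E) S     ≈⟨ σ-touching E t (suc T) ⟩
            σ (suc T) E S           ≲⟨ IH ⟩
            z ^ length S * (1# + fromℕ (length E) * (p * (z * z)))
              ≲⟨ *-monoˡ-≤ (0≤z^ (length S)) (+-monoʳ-≤ 1# (*-monoʳ-≤ 0≤pz² (fromℕ-mono-≤ (ℕ.n≤1+n (length E))))) ⟩
            z ^ length S * (1# + fromℕ (suc (length E)) * (p * (z * z))) ∎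
          by (no ¬t) = begin
            σ (suc T) (f ∷ E) S
              ≈⟨ σ-apart E ¬t T ⟩
            σ (suc T) E S + p * σ T E (blocks f ++ S)
              ≈⟨ +-congˡ (*-congˡ (drop E (blocks f ++ S) (i∈ ∘ there) (∈-++⁺ˡ (i∈ (here ≡.refl))))) ⟩
            σ (suc T) E S + p * σ T [] (blocks f ++ S)
              ≲⟨ +-mono-≤ IH (*-monoˡ-≤ 0≤p (earlier (blocks f ++ S))) ⟩
            z ^ length S * (1# + fromℕ (length E) * (p * (z * z))) + p * (z * (z * z ^ length S))
              ≈⟨ solve 4 (λ s l p z → s :* (:1 :+ l :* (p :* (z :* z))) :+ p :* (z :* (z :* s))
                            := s :* (:1 :+ (:1 :+ l) :* (p :* (z :* z)))) refl (z ^ length S) (fromℕ (length E)) p z ⟩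
            z ^ length S * (1# + fromℕ (suc (length E)) * (p * (z * z))) ∎

        -- Lexicographic induction on `T` and `S`. A block `i` of `S` becomes the list of its edges,
        -- at most one of which lies at the base (`σ-star`); that edge contributes two blocks, but
        -- at a smaller cutoff. So it is enough that `z` satisfies its equation.
        σ-≤ : ∀ T S → σ T [] S ≤ z ^ length S
        σ-≤ zero    S       = 0≤z^ (length S)
        σ-≤ (suc T) []      = σ-none (suc T)
        σ-≤ (suc T) (i ∷ S) = begin
          σ (suc T) [] (i ∷ S)
            ≈⟨ σ-linksAt i S (suc T) ⟩
          σ (suc T) (linksAt i) S
            ≲⟨ σ-star T S (linksAt i) (σ-≤ (suc T) S) (σ-≤ T)
                 (λ e∈ → proj₂ (∈-filter⁻ (λ e → i ∈ˡ? blocks e) {xs = links} e∈)) ⟩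
          z ^ length S * (1# + fromℕ (length (linksAt i)) * (p * (z * z)))
            ≲⟨ *-monoˡ-≤ (0≤z^ (length S)) (+-monoʳ-≤ 1# (*-monoʳ-≤ 0≤pz² (degree≤D i))) ⟩
          z ^ length S * (1# + fromℕ D * (p * (z * z)))
            ≈⟨ *-congˡ z≈1+Dpz² ⟨
          z ^ length S * z
            ≈⟨ *-comm _ z ⟩
          z * z ^ length S ∎
          where open ≤-Reasoning

      load : List Edge → Fin k → Carrier
      load E l = ∑ E (λ e → ν * [ l ∈ˡ? blocks e ]ᵢ)

      -- Expanding the product of all factors yields, among other nonnegative terms, every matching
      -- of `E` that avoids `S`: each of its edges can be picked at either end, for a weight `ν + ν`
      -- equal to `p * (z * z)`. An occupied block admits no edge at the base, hence the factor 1.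
      factor : List Edge → List (Fin k) → Fin k → Carrier
      factor E S l = if does (l ∈ˡ? S) then 1# else (1# + load E l)

      abstract
        term-nonNeg : ∀ e l → 0# ≤ ν * [ l ∈ˡ? blocks e ]ᵢ
        term-nonNeg e l = *-nonNeg 0≤ν (ind-nonNeg (l ∈ˡ? blocks e))

        1≤1+load : ∀ E l → 1# ≤ 1# + load E l
        1≤1+load E l = x≤x+y (∑-nonNeg E (λ {e} _ → term-nonNeg e l))

        factor-≥1 : ∀ E S l → 1# ≤ factor E S l
        factor-≥1 E S l with does (l ∈ˡ? S)
        ... | true  = ≤-refl
        ... | false = 1≤1+load E l

        factor-mono : ∀ f E S l → factor E S l ≤ factor (f ∷ E) S l
        factor-mono f E S l with does (l ∈ˡ? S)
        ... | true  = ≤-refl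
        ... | false = +-monoʳ-≤ 1# (≤-respʳ-≈ (+-comm _ _) (x≤x+y (term-nonNeg f l)))

        factor-∈ : ∀ E {S l} → l ∈ˡ S → factor E S l ≈ 1#
        factor-∈ E {S} {l} l∈S with l ∈ˡ? S
        ... | yes _  = refl
        ... | no l∉S = ⊥-elim (l∉S l∈S)

        factor-∉ : ∀ E {S l} → ¬ (l ∈ˡ S) → factor E S l ≈ 1# + load E l
        factor-∉ E {S} {l} l∉S with l ∈ˡ? S
        ... | yes l∈S = ⊥-elim (l∉S l∈S)
        ... | no _    = refl

        factor-increase : ∀ f E {S l} → l ∈ˡ blocks f → ¬ (l ∈ˡ S) → factor E S l + ν ≤ factor (f ∷ E) S l
        factor-increase f E {S} {l} l∈f l∉S = ≤-reflexive (begin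
          factor E S l + ν                                ≈⟨ +-congʳ (factor-∉ E l∉S) ⟩
          1# + load E l + ν
            ≈⟨ solve 2 (λ L n → :1 :+ L :+ n := :1 :+ (n :* :1 :+ L)) refl (load E l) ν ⟩
          1# + (ν * 1# + load E l)
            ≈⟨ +-congˡ (+-congʳ (*-congˡ (ind-yes (l ∈ˡ? blocks f) l∈f))) ⟨
          1# + load (f ∷ E) l                             ≈⟨ factor-∉ (f ∷ E) l∉S ⟨
          factor (f ∷ E) S l                              ∎)
          where open SetoidReasoning setoid

        0≤factor : ∀ E S l → 0# ≤ factor E S l
        0≤factor E S l = ≤-trans 0≤1 (factor-≥1 E S l)

        -- Placing `f` at the base costs `p`, opens two blocks of weight `z` each, and sets the
        -- factors of these blocks to 1. Raising the same two factors by `ν` pays for this, by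
        -- `∏-increase-two`.
        σ-∏ : ∀ T E S → (∀ {u v} → (u , v) ∈ˡ E → block u ≢ block v) → σ T E S ≤ z ^ length S * ∏ (factor E S)
        σ-∏ T [] S _ = ≤-trans (σ-≤ T S) (≤-respˡ-≈ (*-identityʳ _) (*-monoˡ-≤ (0≤z^ (length S))
          (≤-respˡ-≈ (one k) (∏-mono (λ _ → 0≤1) (factor-≥1 [] S)))))
          where
          one : ∀ k → ∏ {k} (λ _ → 1#) ≈ 1#
          one zero    = refl
          one (suc k) = trans (*-identityˡ _) (one k)
        σ-∏ zero (f ∷ E) S _ = *-nonNeg (0≤z^ (length S)) (∏-nonNeg (0≤factor (f ∷ E) S))
        σ-∏ (suc T) (f@(u , v) ∷ E) S cross = by (touches? f S)
          where
          open ≤-Reasoning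
          IH : σ (suc T) E S ≤ z ^ length S * ∏ (factor E S)
          IH = σ-∏ (suc T) E S (cross ∘ there)
          by : Dec (Touches f S) → σ (suc T) (f ∷ E) S ≤ z ^ length S * ∏ (factor (f ∷ E) S)
          by (yes t) = begin
            σ (suc T) (f ∷ E) S              ≈⟨ σ-touching E t (suc T) ⟩
            σ (suc T) E S                    ≲⟨ IH ⟩
            z ^ length S * ∏ (factor E S)
              ≲⟨ *-monoˡ-≤ (0≤z^ (length S)) (∏-mono (0≤factor E S) (factor-mono f E S)) ⟩
            z ^ length S * ∏ (factor (f ∷ E) S) ∎
          by (no ¬t) = begin
            σ (suc T) (f ∷ E) S
              ≈⟨ σ-apart E ¬t T ⟩
            σ (suc T) E S + p * σ T E (blocks f ++ S)
              ≲⟨ +-mono-≤ IH (*-monoˡ-≤ 0≤p (σ-∏ T E (blocks f ++ S) (cross ∘ there))) ⟩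
            z ^ length S * ∏ (factor E S) + p * (z * (z * z ^ length S) * ∏ (factor E (blocks f ++ S)))
              ≈⟨ solve 5 (λ s P p z Q → s :* P :+ p :* (z :* (z :* s) :* Q) := s :* (P :+ (p :* (z :* z)) :* Q)) refl
                   (z ^ length S) (∏ (factor E S)) p z (∏ (factor E (blocks f ++ S))) ⟩
            z ^ length S * (∏ (factor E S) + p * (z * z) * ∏ (factor E (blocks f ++ S)))
              ≈⟨ *-congˡ (+-congˡ (*-congʳ 2ν≈pz²)) ⟨
            z ^ length S * (∏ (factor E S) + (ν + ν) * ∏ (factor E (blocks f ++ S)))
              ≲⟨ *-monoˡ-≤ (0≤z^ (length S)) (∏-increase-two 0≤ν (cross (here ≡.refl))
                   (factor-≥1 E S) (factor-mono f E S)
                   (factor-increase f E (here ≡.refl) (¬t ∘ here))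
                   (factor-increase f E (there (here ≡.refl)) (¬t ∘ there ∘ here))
                   (factor-∈ E {blocks f ++ S} (here ≡.refl)) (factor-∈ E {blocks f ++ S} (there (here ≡.refl)))
                   other) ⟩
            z ^ length S * ∏ (factor (f ∷ E) S) ∎
            where
            other : ∀ l → l ≢ block u → l ≢ block v → factor E (blocks f ++ S) l ≈ factor E S l
            other l l≢u l≢v = compare (l ∈ˡ? S)
              where
              compare : Dec (l ∈ˡ S) → factor E (blocks f ++ S) l ≈ factor E S l
              compare (yes l∈S) = trans (factor-∈ E {blocks f ++ S} (there (there l∈S))) (sym (factor-∈ E l∈S))
              compare (no l∉S)  = trans
                (factor-∉ E {blocks f ++ S} λ { (here eq) → l≢u eq ; (there (here eq)) → l≢v eq ; (there (there l∈S)) → l∉S l∈S })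
                (sym (factor-∉ E l∉S))

        load-links : ∀ l → load links l ≤ fromℕ D * ν
        load-links l = begin
          load links l                          ≈⟨ ∑-filter (λ e → l ∈ˡ? blocks e) links (λ _ → ν) ⟨
          ∑ (linksAt l) (λ _ → ν)               ≈⟨ ∑-const (linksAt l) ν ⟩
          fromℕ (length (linksAt l)) * ν        ≲⟨ *-monoʳ-≤ 0≤ν (degree≤D l) ⟩
          fromℕ D * ν                           ∎
          where open ≤-Reasoning

        σ-links : ∀ T → σ T links [] ≤ (1# + fromℕ D * ν) ^ k
        σ-links T = begin
          σ T links []                  ≲⟨ σ-∏ T links [] (λ e∈ → proj₂ (∈-filter⁻ _ {xs = edges} e∈)) ⟩
          1# * ∏ (factor links [])      ≈⟨ *-identityˡ _ ⟩
          ∏ (factor links [])           ≲⟨ ∏-mono (0≤factor links []) (λ l → +-monoʳ-≤ 1# (load-links l)) ⟩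
          ∏ {k} (λ _ → 1# + fromℕ D * ν) ≈⟨ ∏-const k _ ⟩
          (1# + fromℕ D * ν) ^ k        ∎
          where
          open ≤-Reasoning
          open Graph G using (edges)

-- The edges that meet a given block

module Links {n k b : ℕ} (G : Graph n) (𝓟 : Partition n k b) where
  open Graph G
  open Partition 𝓟
  open Heaps G 𝓟
  open DecMembership (Fin._≟_ {k}) using () renaming (_∈?_ to _∈ˡ?_)

  ∈-edges⁻ : ∀ {u v} → (u , v) ∈ˡ edges → u Fin.< v × u ~ v
  ∈-edges⁻ e∈ = proj₂ (∈-filter⁻ (λ (u , v) → (u Fin.<? v) ×-dec (u ~? v)) {xs = cartesianProduct (allFin n) (allFin n)} e∈)

  ∈-edges⁺ : ∀ {u v} → u Fin.< v → u ~ v → (u , v) ∈ˡ edges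
  ∈-edges⁺ u<v u~v = ∈-filter⁺ (λ (u , v) → (u Fin.<? v) ×-dec (u ~? v))
    (∈-cartesianProduct⁺ (∈-allFin _) (∈-allFin _)) (u<v , u~v)

  linksAt-unique : ∀ i → Unique (linksAt i)
  linksAt-unique i = Unique.filter⁺ _ (Unique.filter⁺ _ (Unique.filter⁺ _
    (Unique.cartesianProduct⁺ (Unique.allFin⁺ n) (Unique.allFin⁺ n))))

  ordered : Fin n → Fin n → Edge
  ordered u v with u Fin.<? v
  ... | yes _ = u , v
  ... | no  _ = v , u

  ordered-< : ∀ {u v} → u Fin.< v → ordered u v ≡ (u , v)
  ordered-< {u} {v} u<v with u Fin.<? v
  ... | yes _   = ≡.refl
  ... | no  u≮v = ⊥-elim (u≮v u<v)

  ordered-> : ∀ {u v} → u Fin.< v → ordered v u ≡ (u , v)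
  ordered-> {u} {v} u<v with v Fin.<? u
  ... | yes v<u = ⊥-elim (ℕ.<-asym u<v v<u)
  ... | no  _   = ≡.refl

  -- All edges with an end in block `i`, listed by that end and its neighbour. An edge inside the
  -- block appears twice, which is harmless in an upper bound.
  incident : Fin k → List Edge
  incident i = concatMap (λ u → List.map (ordered u) (filter (u ~?_) (allFin n))) (members i)

  ∈-incident : ∀ {u v} → u ~ v → ordered u v ∈ˡ incident (block u)
  ∈-incident {u} {v} u~v = ∈-concatMap⁺ (λ u → List.map (ordered u) (filter (u ~?_) (allFin n)))
    (Any.map (λ { ≡.refl → ∈-map⁺ (ordered u) (∈-filter⁺ (u ~?_) (∈-allFin v) u~v) })
      (∈-filter⁺ (_∈? V (block u)) (∈-allFin u)
        (Vec.lookup⇒[]= u _ (≡.trans (Vec.lookup∘tabulate _ u) (dec-true (block u Fin.≟ block u) ≡.refl)))))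

  linksAt⊆incident : ∀ {i e} → e ∈ˡ linksAt i → e ∈ˡ incident i
  linksAt⊆incident {i} {u , v} e∈ with ∈-filter⁻ (λ e → i ∈ˡ? blocks e) {xs = links} e∈
  ... | e∈links , i∈e with ∈-edges⁻ (proj₁ (∈-filter⁻ (λ (u , v) → ¬? (block u Fin.≟ block v)) {xs = edges} e∈links)) | i∈e
  ...   | u<v , u~v | here ≡.refl         = ≡.subst (_∈ˡ incident (block u)) (ordered-< u<v) (∈-incident u~v)
  ...   | u<v , u~v | there (here ≡.refl) = ≡.subst (_∈ˡ incident (block v)) (ordered-> u<v) (∈-incident (sym u~v))

  degree≤maxDegree : ∀ u → degree u ℕ.≤ maxDegree
  degree≤maxDegree u = All.lookup (xs≤max 0 (List.map degree (allFin n))) (∈-map⁺ degree (∈-allFin u))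

-- Superharmonic heap weights along a run

module Runs {c ℓ₁ ℓ₂} (ℛ : RealField c ℓ₁ ℓ₂) {n k b : ℕ} (G : Graph n) (𝓟 : Partition n k b)
            (0<b : 0 ℕ.< b) where
  open RealField ℛ hiding (zero)
  open OrderedFieldProperties archimedeanField
  open ExponentialProperties ℛ using
    (partialSum; partialSum-first;
    partialSum-mono-terms; partialSum-*ˡ; antitone⇒*≤partialSum)
  open FiniteSums ℛ
  open MoserTardos ℛ G 𝓟
  open Expectation ℛ G 𝓟 0<b
  open Counting ℛ G 𝓟
  open Heaps G 𝓟
  open Links G 𝓟
  open Partition 𝓟
  open Graph G using (edges; degree; maxDegree; _~?_)

  abstract
    length-linksAt : ∀ i → fromℕ (length (linksAt i)) ≤ fromℕ (b ℕ.* maxDegree)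
    length-linksAt i = begin
      fromℕ (length (linksAt i))                    ≈⟨ trans (∑-const (linksAt i) 1#) (*-identityʳ _) ⟨
      ∑ (linksAt i) (λ _ → 1#)                      ≲⟨ ∑-⊆ (linksAt-unique i) linksAt⊆incident (λ _ → 0≤1) ⟩
      ∑ (incident i) (λ _ → 1#)                     ≈⟨ ∑-concatMap _ (members i) _ ⟩
      ∑ (members i) (λ u → ∑ (List.map (ordered u) (filter (u ~?_) (allFin n))) (λ _ → 1#))
        ≲⟨ ∑-mono (members i) (λ {u} _ → neighbours u) ⟩
      ∑ (members i) (λ _ → fromℕ maxDegree)         ≈⟨ ∑-const (members i) _ ⟩
      fromℕ (length (members i)) * fromℕ maxDegree
        ≈⟨ reflexive (≡.cong (λ l → fromℕ l * fromℕ maxDegree) (length-members i)) ⟩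
      fromℕ b * fromℕ maxDegree                     ≈⟨ fromℕ-* b maxDegree ⟨
      fromℕ (b ℕ.* maxDegree)                       ∎
      where
      open ≤-Reasoning
      neighbours : ∀ u → ∑ (List.map (ordered u) (filter (u ~?_) (allFin n))) (λ _ → 1#) ≤ fromℕ maxDegree
      neighbours u = begin
        ∑ (List.map (ordered u) (filter (u ~?_) (allFin n))) (λ _ → 1#)
          ≈⟨ reflexive (∑-map (ordered u) (filter (u ~?_) (allFin n)) _) ⟩
        ∑ (filter (u ~?_) (allFin n)) (λ _ → 1#)
          ≈⟨ trans (∑-const (filter (u ~?_) (allFin n)) 1#) (*-identityʳ _) ⟩
        fromℕ (degree u)
          ≲⟨ fromℕ-mono-≤ (degree≤maxDegree u) ⟩
        fromℕ maxDegree ∎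

  Final : Pred Selection 0ℓ
  Final x = trueEvents x ≡ []

  final? : Decidable₁ Final
  final? x = terminated? ([] , x)

  ∈-trueEvents⁻ : ∀ {u v x} → (u , v) ∈ˡ trueEvents x → (u , v) ∈ˡ edges × Selected x u × Selected x v
  ∈-trueEvents⁻ {x = x} e∈ = ∈-filter⁻ (λ (u , v) → selected? x u ×-dec selected? x v) {xs = edges} e∈

  -- A block has one selected vertex, so the ends of a true event within one block would coincide,
  -- against the strict order of the pairs in `edges`.
  trueEvent⇒crossing : ∀ {u v x} → (u , v) ∈ˡ trueEvents x → block u ≢ block v
  trueEvent⇒crossing {u} {v} {x} e∈ bu≡bv with ∈-trueEvents⁻ {x = x} e∈
  ... | e∈edges , xu , xv = ℕ.<-irrefl (≡.cong Fin.toℕ (≡.trans (≡.sym xu) (≡.trans (≡.cong (lookup x) bu≡bv) xv)))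
                                       (proj₁ (∈-edges⁻ e∈edges))

  trueEvent⇒link : ∀ {e x} → e ∈ˡ trueEvents x → e ∈ˡ links
  trueEvent⇒link {x = x} e∈ = ∈-filter⁺ (λ (u , v) → ¬? (block u Fin.≟ block v))
    (proj₁ (∈-trueEvents⁻ {x = x} e∈)) (trueEvent⇒crossing {x = x} e∈)

  ∈-trueEvents⇒¬Final : ∀ {e x} → e ∈ˡ trueEvents x → ¬ Final x
  ∈-trueEvents⇒¬Final e∈ final with ≡.subst (_ ∈ˡ_) final e∈
  ... | ()

  ∈-allSelections : ∀ {m} (v : Vec Vertex m) → v ∈ˡ allSelections m
  ∈-allSelections []      = here ≡.refl
  ∈-allSelections (u ∷ v) = ∈-cartesianProductWith⁺ _∷_ (∈-allFin u) (∈-allSelections v)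

  allSelections-unique : ∀ m → Unique (allSelections m)
  allSelections-unique zero    = [] ∷ []
  allSelections-unique (suc m) = Unique.cartesianProductWith⁺ _∷_ Vec.∷-injective (Unique.allFin⁺ n) (allSelections-unique m)

  module WithRule (rule : Rule) where
    open Rule rule

    step-final : ∀ past x → Final x → step rule (past , x) ≡ return (past , x)
    step-final past x final with terminated? (past , x)
    ... | yes _ = ≡.refl
    ... | no ¬f = ⊥-elim (¬f final)

    continue : Past → Selection → Dist (Past × Selection)
    continue past x = choose past x >>= λ e → redraw e x >>= λ x′ → return ((x , e) ∷ past , x′)

    step-¬final : ∀ past x → ¬ Final x → step rule (past , x) ≡ continue past x
    step-¬final past x ¬final with terminated? (past , x)
    ... | yes f = ⊥-elim (¬final f)
    ... | no _  = ≡.refl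

    LegitState : Pred (Past × Selection) 0ℓ
    LegitState (_ , x) = Legit x

    abstract
      choose-supported : ∀ past x → Supported (choose past x) (_∈ˡ trueEvents x)
      choose-supported past x = supported go
        where
        go : ∀ {e p} → (e , p) ∈ˡ choose past x → 0# ≤ p × e ∈ˡ trueEvents x
        go ep∈ with ∈-map⁻ _ ep∈
        ... | e , e∈ , ≡.refl = nonNeg past x e e∈ , e∈

      choose-mass : ∀ past x → ¬ Final x → E (choose past x) (λ _ → 1#) ≈ 1#
      choose-mass past x ¬final = trans (E-weighted (weight past x) (trueEvents x) _)
        (trans (∑-cong (trueEvents x) (λ _ → *-identityʳ _)) (total past x ¬final))

      redraw-return-supported : ∀ e past x → Legit x →
        Supported (redraw e x >>= λ x′ → return ((x , e) ∷ past , x′)) LegitState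
      redraw-return-supported e past x legit = >>=-supported (redraw-supported e x legit)
        λ {x′} legit′ → return-supported ((x , e) ∷ past , x′) legit′

      step-supported : ∀ past x → Legit x → Supported (step rule (past , x)) LegitState
      step-supported past x legit = by (final? x)
        where
        by : Dec (Final x) → Supported (step rule (past , x)) LegitState
        by (yes f) = ≡.subst (λ d → Supported d LegitState) (≡.sym (step-final past x f)) (return-supported (past , x) legit)
        by (no ¬f) = ≡.subst (λ d → Supported d LegitState) (≡.sym (step-¬final past x ¬f))
          (>>=-supported (choose-supported past x) λ {e} _ → redraw-return-supported e past x legit)

      E-continue : ∀ past x (φ : Selection → Carrier) → Legit x →
        E (continue past x) (φ ∘ proj₂) ≈ E (choose past x) (λ e → E (redraw e x) φ)
      E-continue past x φ legit = trans (E->>= (choose past x) _ _) (E-cong (choose-supported past x) λ {e} _ →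
        trans (E->>= (redraw e x) _ _) (E-cong (redraw-supported e x legit) λ {x′} _ → E-return ((x , e) ∷ past , x′) _))

      -- The weights of the rule form a mean over the true events, so a bound for the resampling of
      -- each of them passes to the step, whatever the past was.
      step-≤ : ∀ (φ ψ : Selection → Carrier) past x → Legit x → (Final x → φ x ≤ ψ x) →
               (∀ {e} → e ∈ˡ trueEvents x → E (redraw e x) φ ≤ ψ x) →
               E (step rule (past , x)) (φ ∘ proj₂) ≤ ψ x
      step-≤ φ ψ past x legit φ≤ψ redraw≤ψ = by (final? x)
        where
        open ≤-Reasoning
        by : Dec (Final x) → E (step rule (past , x)) (φ ∘ proj₂) ≤ ψ x
        by (yes f) = begin
          E (step rule (past , x)) (φ ∘ proj₂)
            ≈⟨ reflexive (≡.cong (λ d → E d (φ ∘ proj₂)) (step-final past x f)) ⟩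
          E (return (past , x)) (φ ∘ proj₂)       ≈⟨ E-return (past , x) _ ⟩
          φ x                                     ≲⟨ φ≤ψ f ⟩
          ψ x                                     ∎
        by (no ¬f) = begin
          E (step rule (past , x)) (φ ∘ proj₂)
            ≈⟨ reflexive (≡.cong (λ d → E d (φ ∘ proj₂)) (step-¬final past x ¬f)) ⟩
          E (continue past x) (φ ∘ proj₂)         ≈⟨ E-continue past x φ legit ⟩
          E (choose past x) (λ e → E (redraw e x) φ)
            ≲⟨ E-mono (choose-supported past x) (λ e∈ → ≤-respʳ-≈ (sym (*-identityʳ _)) (redraw≤ψ e∈)) ⟩
          E (choose past x) (λ _ → ψ x * 1#)      ≈⟨ E-*ˡ (choose past x) (ψ x) _ ⟩
          ψ x * E (choose past x) (λ _ → 1#)      ≈⟨ *-congˡ (choose-mass past x ¬f) ⟩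
          ψ x * 1#                                ≈⟨ *-identityʳ _ ⟩
          ψ x                                     ∎

      step-mass : ∀ past x → Legit x → E (step rule (past , x)) (λ _ → 1#) ≈ 1#
      step-mass past x legit = by (final? x)
        where
        by : Dec (Final x) → E (step rule (past , x)) (λ _ → 1#) ≈ 1#
        by (yes f) = trans (reflexive (≡.cong (λ d → E d (λ _ → 1#)) (step-final past x f))) (E-return (past , x) _)
        by (no ¬f) = trans (reflexive (≡.cong (λ d → E d (λ _ → 1#)) (step-¬final past x ¬f)))
          (trans (E-continue past x (λ _ → 1#) legit)
            (trans (E-cong (choose-supported past x) (λ {e} _ → redraw-mass e x)) (choose-mass past x ¬f)))

      run-supported : ∀ t → Supported (run rule t) LegitState
      run-supported zero    = >>=-supported initial-supported λ {x} legit → return-supported ([] , x) legit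
      run-supported (suc t) = >>=-supported (run-supported t) λ { {past , x} legit → step-supported past x legit }

      run-mass : ∀ t → E (run rule t) (λ _ → 1#) ≈ 1#
      run-mass zero    = >>=-mass initial-supported (λ {x} _ → E-return ([] , x) _) initial-mass
      run-mass (suc t) = >>=-mass (run-supported t) (λ { {past , x} legit → step-mass past x legit }) (run-mass t)

    At : ℕ → (Selection → Carrier) → Carrier
    At t φ = E (run rule t) (φ ∘ proj₂)

    abstract
      At-mono : ∀ t {φ ψ} → (∀ {x} → Legit x → φ x ≤ ψ x) → At t φ ≤ At t ψ
      At-mono t φ≤ψ = E-mono (run-supported t) φ≤ψ

      At-cong : ∀ t {φ ψ} → (∀ {x} → Legit x → φ x ≈ ψ x) → At t φ ≈ At t ψ
      At-cong t φ≈ψ = E-cong (run-supported t) φ≈ψ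

      At-zero : ∀ φ → At 0 φ ≈ E initial φ
      At-zero φ = trans (E->>= initial _ _) (E-cong initial-supported λ {x} _ → E-return ([] , x) _)

      At-suc-≤ : ∀ t φ ψ → (∀ x → Legit x → Final x → φ x ≤ ψ x) →
                 (∀ x → Legit x → ∀ {e} → e ∈ˡ trueEvents x → E (redraw e x) φ ≤ ψ x) →
                 At (suc t) φ ≤ At t ψ
      At-suc-≤ t φ ψ φ≤ψ redraw≤ψ = ≤-respˡ-≈ (sym (E->>= (run rule t) (step rule) _))
        (E-mono (run-supported t) λ { {past , x} legit → step-≤ φ ψ past x legit (φ≤ψ x legit) (redraw≤ψ x legit) })

      -- Superharmonicity in time: undoing the last round raises the index by one, so `t` rounds
      -- lead back to the initial draw with index `t + m`.
      At-family-≤ : ∀ (φ : ℕ → Selection → Carrier) →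
                    (∀ m x → Legit x → Final x → φ m x ≤ φ (suc m) x) →
                    (∀ m x → Legit x → ∀ {e} → e ∈ˡ trueEvents x → E (redraw e x) (φ m) ≤ φ (suc m) x) →
                    ∀ t m → At t (φ m) ≤ E initial (φ (t ℕ.+ m))
      At-family-≤ φ φ≤ redraw≤ zero    m = ≤-reflexive (At-zero (φ m))
      At-family-≤ φ φ≤ redraw≤ (suc t) m = ≤-trans (At-suc-≤ t (φ m) (φ (suc m)) (φ≤ m) (redraw≤ m))
        (≤-respʳ-≈ (reflexive (≡.cong (λ l → E initial (φ l)) (ℕ.+-suc t m))) (At-family-≤ φ φ≤ redraw≤ t (suc m)))

      redraw-≤1 : ∀ {φ} e x → Legit x → (∀ x → φ x ≤ 1#) → E (redraw e x) φ ≤ 1#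
      redraw-≤1 e x legit φ≤1 = E-≤1 (redraw-supported e x legit) (redraw-mass e x) (λ {x′} _ → φ≤1 x′)

      -- A property that holds before termination can only be lost.
      At-indicator-antitone : ∀ {P : Pred Selection 0ℓ} (P? : Decidable₁ P) → (∀ x → ¬ Final x → P x) →
                              ∀ t → At (suc t) (λ x → [ P? x ]ᵢ) ≤ At t (λ x → [ P? x ]ᵢ)
      At-indicator-antitone P? ¬final⇒P t = At-suc-≤ t (λ x → [ P? x ]ᵢ) (λ x → [ P? x ]ᵢ) (λ _ _ _ → ≤-refl) λ x legit {e} e∈ →
        ≤-respʳ-≈ (sym (ind-yes (P? x) (¬final⇒P x (∈-trueEvents⇒¬Final {x = x} e∈))))
          (redraw-≤1 e x legit (λ x → ind-≤1 (P? x)))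

      At-complement : ∀ {P : Pred Selection 0ℓ} (P? : Decidable₁ P) t →
                      At t (λ x → [ P? x ]ᵢ) + At t (λ x → [ ¬? (P? x) ]ᵢ) ≈ 1#
      At-complement P? t = trans (sym (E-+ (run rule t) _ _))
        (trans (E-cong (run-supported t) (λ { {_ , x} _ → one (P? x) })) (run-mass t))
        where
        one : ∀ {P : Set} (P? : Dec P) → [ P? ]ᵢ + [ ¬? P? ]ᵢ ≈ 1#
        one (yes _) = +-identityʳ 1#
        one (no _)  = +-identityˡ 1#

    p : Carrier
    p = q * q

    0≤p : 0# ≤ p
    0≤p = *-nonNeg q-nonNeg q-nonNeg

    open Weights p 0≤p public

    -- Bounds the probability that a run from x reaches y in m rounds; runs that
    -- differ by the order of resamplings in disjoint blocks have the same heap.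
    Φ : Selection → ℕ → Selection → Carrier
    Φ y m x = p ^ m * ∑ (heaps y m) (λ h → [ x ≟ˢ tops h ]ᵢ)

    running : Selection → Carrier
    running x = [ ¬? (final? x) ]ᵢ

    abstract
      0≤p^ : ∀ m → 0# ≤ p ^ m
      0≤p^ = ^-nonNeg 0≤p

      Φ-nonNeg : ∀ y m x → 0# ≤ Φ y m x
      Φ-nonNeg y m x = *-nonNeg (0≤p^ m) (∑-nonNeg (heaps y m) (λ {h} _ → ind-nonNeg (x ≟ˢ tops h)))

      Φ-zero : ∀ y x → Φ y 0 x ≈ [ x ≟ˢ y ]ᵢ
      Φ-zero y x = trans (*-identityˡ _) (trans (+-identityʳ _)
        (reflexive (≡.cong (λ z → [ x ≟ˢ z ]ᵢ) (tops-empty y))))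

      -- For each heap `h`, `redraw-point` charges `p` and forces `x` to be the tops of `add e h`.
      -- As `add e` is injective, distinct heaps stay distinct and occur among those with one more
      -- edge.
      Φ-redraw : ∀ y m x {e} → e ∈ˡ trueEvents x → E (redraw e x) (Φ y m) ≤ Φ y (suc m) x
      Φ-redraw y m x {e@(u , v)} e∈ = begin
        E (redraw e x) (Φ y m)
          ≈⟨ E-*ˡ (redraw e x) (p ^ m) _ ⟩
        p ^ m * E (redraw e x) (λ x′ → ∑ (heaps y m) (λ h → [ x′ ≟ˢ tops h ]ᵢ))
          ≈⟨ *-congˡ (E-∑ (redraw e x) (heaps y m) _) ⟩
        p ^ m * ∑ (heaps y m) (λ h → E (redraw e x) (λ x′ → [ x′ ≟ˢ tops h ]ᵢ))
          ≲⟨ *-monoˡ-≤ (0≤p^ m) (∑-mono (heaps y m) (λ {h} _ → point h)) ⟩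
        p ^ m * ∑ (heaps y m) (λ h → p * [ x ≟ˢ tops (add e h) ]ᵢ)
          ≈⟨ *-congˡ (∑-*ˡ (heaps y m) p _) ⟩
        p ^ m * (p * ∑ (heaps y m) (λ h → [ x ≟ˢ tops (add e h) ]ᵢ))
          ≈⟨ solve 3 (λ a b c → a :* (b :* c) := b :* a :* c) refl (p ^ m) p _ ⟩
        p ^ suc m * ∑ (heaps y m) (λ h → [ x ≟ˢ tops (add e h) ]ᵢ)
          ≈⟨ *-congˡ (reflexive (∑-map (add e) (heaps y m) _)) ⟨
        p ^ suc m * ∑ (List.map (add e) (heaps y m)) (λ h → [ x ≟ˢ tops h ]ᵢ)
          ≲⟨ *-monoˡ-≤ (0≤p^ (suc m)) (∑-⊆ {f = λ h → [ x ≟ˢ tops h ]ᵢ}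
               (Unique.map⁺ (add-injective e) (heaps-unique y m)) included
               (λ h → ind-nonNeg (x ≟ˢ tops h))) ⟩
        Φ y (suc m) x ∎
        where
        open ≤-Reasoning
        point : ∀ h → E (redraw e x) (λ x′ → [ x′ ≟ˢ tops h ]ᵢ) ≤ p * [ x ≟ˢ tops (add e h) ]ᵢ
        point h with ∈-trueEvents⁻ {x = x} e∈
        ... | _ , xu , xv = ≤-trans (redraw-point (trueEvent⇒crossing {x = x} e∈) xu xv (tops h))
          (*-monoˡ-≤ 0≤p (ind-mono (restore e (tops h) ≟ˢ x) (x ≟ˢ tops (add e h))
            (λ eq → ≡.trans (≡.sym eq) (≡.sym (tops-add u v h)))))
        included : ∀ {h} → h ∈ˡ List.map (add e) (heaps y m) → h ∈ˡ heaps y (suc m)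
        included h∈ with ∈-map⁻ (add e) h∈
        ... | h′ , h′∈ , ≡.refl = ∈-heaps-suc⁺ {y} {m} (trueEvent⇒link {x = x} e∈) h′∈

      length-heaps : ∀ y m → fromℕ (length (heaps y m)) ≤ fromℕ (length (words m links []))
      length-heaps y m = begin
        fromℕ (length (heaps y m))
          ≈⟨ trans (∑-const (heaps y m) 1#) (*-identityʳ _) ⟨
        ∑ (heaps y m) (λ _ → 1#)
          ≲⟨ ∑-⊆ (heaps-unique y m) (heaps⊆words m) (λ _ → 0≤1) ⟩
        ∑ (List.map (λ w → addAll w (empty y)) (words m links [])) (λ _ → 1#)
          ≈⟨ reflexive (∑-map (λ w → addAll w (empty y)) (words m links []) (λ _ → 1#)) ⟩
        ∑ (words m links []) (λ _ → 1#)
          ≈⟨ trans (∑-const (words m links []) 1#) (*-identityʳ _) ⟩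
        fromℕ (length (words m links [])) ∎
        where open ≤-Reasoning

      -- The tops of a heap prescribe all `k` initial values, which are drawn with probability at
      -- most `q ^ k`.
      Φ-initial : ∀ y m → E initial (Φ y m) ≤ q ^ k * wordWeight links [] m
      Φ-initial y m = begin
        E initial (Φ y m)
          ≈⟨ E-*ˡ initial (p ^ m) _ ⟩
        p ^ m * E initial (λ x → ∑ (heaps y m) (λ h → [ x ≟ˢ tops h ]ᵢ))
          ≈⟨ *-congˡ (E-∑ initial (heaps y m) _) ⟩
        p ^ m * ∑ (heaps y m) (λ h → E initial (λ x → [ x ≟ˢ tops h ]ᵢ))
          ≲⟨ *-monoˡ-≤ (0≤p^ m) (∑-mono (heaps y m) (λ {h} _ → initial-point (tops h))) ⟩
        p ^ m * ∑ (heaps y m) (λ _ → q ^ k)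
          ≈⟨ *-congˡ (∑-const (heaps y m) _) ⟩
        p ^ m * (fromℕ (length (heaps y m)) * q ^ k)
          ≲⟨ *-monoˡ-≤ (0≤p^ m) (*-monoʳ-≤ (^-nonNeg q-nonNeg k) (length-heaps y m)) ⟩
        p ^ m * (fromℕ (length (words m links [])) * q ^ k)
          ≈⟨ solve 3 (λ a b c → a :* (b :* c) := c :* (a :* b)) refl (p ^ m) _ (q ^ k) ⟩
        q ^ k * wordWeight links [] m ∎
        where open ≤-Reasoning

      E-partialSum : ∀ {A : Set} (d : Dist A) (f : A → ℕ → Carrier) n →
                     E d (λ a → partialSum (f a) n) ≈ partialSum (λ m → E d (λ a → f a m)) n
      E-partialSum d f zero    = E-0 d
      E-partialSum d f (suc n) = trans (E-+ d _ _) (+-congʳ (E-partialSum d f n))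

    -- A terminated run adds no more edges, so after `t` rounds any heap of at most `t` edges is
    -- possible. While such a run waits, raising the index only adds a nonnegative term.
    Φ≤ : Selection → ℕ → Selection → Carrier
    Φ≤ y t x = partialSum (λ m → Φ y m x) (suc t)

    abstract
      Φ≤-redraw : ∀ y t x {e} → e ∈ˡ trueEvents x → E (redraw e x) (Φ≤ y t) ≤ Φ≤ y (suc t) x
      Φ≤-redraw y t x {e} e∈ = begin
        E (redraw e x) (Φ≤ y t)
          ≈⟨ E-partialSum (redraw e x) (λ x m → Φ y m x) (suc t) ⟩
        partialSum (λ m → E (redraw e x) (Φ y m)) (suc t)
          ≲⟨ partialSum-mono-terms (λ m → Φ-redraw y m x e∈) (suc t) ⟩
        partialSum (λ m → Φ y (suc m) x) (suc t)
          ≲⟨ x≤x+y (Φ-nonNeg y 0 x) ⟩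
        partialSum (λ m → Φ y (suc m) x) (suc t) + Φ y 0 x
          ≈⟨ +-comm _ _ ⟩
        Φ y 0 x + partialSum (λ m → Φ y (suc m) x) (suc t)
          ≈⟨ partialSum-first (λ m → Φ y m x) (suc t) ⟨
        Φ≤ y (suc t) x ∎
        where open ≤-Reasoning

      At-point : ∀ t y → At t (λ x → [ x ≟ˢ y ]ᵢ) ≤ q ^ k * σ (suc t) links []
      At-point t y = begin
        At t (λ x → [ x ≟ˢ y ]ᵢ)
          ≲⟨ At-mono t (λ {x} _ → ≤-reflexive (sym (trans (+-identityˡ _) (Φ-zero y x)))) ⟩
        At t (Φ≤ y 0)
          ≲⟨ At-family-≤ (Φ≤ y) (λ m x _ _ → x≤x+y (Φ-nonNeg y (suc m) x)) (λ m x _ → Φ≤-redraw y m x) t 0 ⟩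
        E initial (Φ≤ y (t ℕ.+ 0))
          ≈⟨ reflexive (≡.cong (λ l → E initial (Φ≤ y l)) (ℕ.+-identityʳ t)) ⟩
        E initial (Φ≤ y t)
          ≈⟨ E-partialSum initial (λ x m → Φ y m x) (suc t) ⟩
        partialSum (λ m → E initial (Φ y m)) (suc t)
          ≲⟨ partialSum-mono-terms (Φ-initial y) (suc t) ⟩
        partialSum (λ m → q ^ k * wordWeight links [] m) (suc t)
          ≈⟨ partialSum-*ˡ (q ^ k) (wordWeight links []) (suc t) ⟩
        q ^ k * σ (suc t) links [] ∎
        where open ≤-Reasoning

      running-final : ∀ {x} → Final x → running x ≈ 0#
      running-final {x} f = ind-no (¬? (final? x)) (λ ¬f → ¬f f)

      running-trueEvent : ∀ {x e} → e ∈ˡ trueEvents x → running x ≈ 1#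
      running-trueEvent {x} e∈ = ind-yes (¬? (final? x)) (∈-trueEvents⇒¬Final {x = x} e∈)

      running*Φ-redraw : ∀ y m x → Legit x → ∀ {e} → e ∈ˡ trueEvents x →
                  E (redraw e x) (λ x → running x * Φ y m x) ≤ running x * Φ y (suc m) x
      running*Φ-redraw y m x legit {e} e∈ = begin
        E (redraw e x) (λ x → running x * Φ y m x)
          ≲⟨ E-mono (redraw-supported e x legit) (λ {x} _ → ≤-respʳ-≈ (*-identityˡ _)
               (*-monoʳ-≤ (Φ-nonNeg y m x) (ind-≤1 (¬? (final? x))))) ⟩
        E (redraw e x) (Φ y m)         ≲⟨ Φ-redraw y m x e∈ ⟩
        Φ y (suc m) x                  ≈⟨ *-identityˡ _ ⟨
        1# * Φ y (suc m) x             ≈⟨ *-congʳ (running-trueEvent {x} e∈) ⟨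
        running x * Φ y (suc m) x            ∎
        where open ≤-Reasoning

      -- A run that has not terminated after t rounds has built a heap of
      -- exactly t edges.
      At-running-point : ∀ t y → At t (λ x → running x * [ x ≟ˢ y ]ᵢ) ≤ q ^ k * wordWeight links [] t
      At-running-point t y = begin
        At t (λ x → running x * [ x ≟ˢ y ]ᵢ)
          ≈⟨ At-cong t (λ {x} _ → *-congˡ (Φ-zero y x)) ⟨
        At t (λ x → running x * Φ y 0 x)
          ≲⟨ At-family-≤ (λ m x → running x * Φ y m x)
               -- At a terminated state `running` vanishes, so the index may rise although no edge
               -- is added.
               (λ m x _ f → ≤-reflexive (trans (trans (*-congʳ (running-final {x} f)) (zeroˡ _))
                 (sym (trans (*-congʳ (running-final {x} f)) (zeroˡ _)))))
               (λ m x → running*Φ-redraw y m x) t 0 ⟩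
        E initial (λ x → running x * Φ y (t ℕ.+ 0) x)
          ≈⟨ reflexive (≡.cong (λ l → E initial (λ x → running x * Φ y l x)) (ℕ.+-identityʳ t)) ⟩
        E initial (λ x → running x * Φ y t x)
          ≲⟨ E-mono initial-supported (λ {x} _ → ≤-respʳ-≈ (*-identityˡ _)
               (*-monoʳ-≤ (Φ-nonNeg y t x) (ind-≤1 (¬? (final? x))))) ⟩
        E initial (Φ y t)
          ≲⟨ Φ-initial y t ⟩
        q ^ k * wordWeight links [] t ∎
        where open ≤-Reasoning

    selections : Carrier
    selections = fromℕ (length (allSelections k))

    abstract
      -- A union bound over all selections: crude, but the extra factor does not depend on `t`.
      At-running : ∀ t → At t running ≤ selections * q ^ k * wordWeight links [] t
      At-running t = begin
        At t running
          ≲⟨ At-mono t (λ {x} _ → somewhere x) ⟩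
        At t (λ x → ∑ (allSelections k) (λ y → running x * [ x ≟ˢ y ]ᵢ))
          ≈⟨ E-∑ (run rule t) (allSelections k) _ ⟩
        ∑ (allSelections k) (λ y → At t (λ x → running x * [ x ≟ˢ y ]ᵢ))
          ≲⟨ ∑-mono (allSelections k) (λ {y} _ → At-running-point t y) ⟩
        ∑ (allSelections k) (λ _ → q ^ k * wordWeight links [] t)
          ≈⟨ ∑-const (allSelections k) _ ⟩
        selections * (q ^ k * wordWeight links [] t)
          ≈⟨ *-assoc _ _ _ ⟨
        selections * q ^ k * wordWeight links [] t ∎
        where
        open ≤-Reasoning
        somewhere : ∀ x → running x ≤ ∑ (allSelections k) (λ y → running x * [ x ≟ˢ y ]ᵢ)
        somewhere x = ≤-respˡ-≈ (trans (*-congˡ (ind-yes (x ≟ˢ x) ≡.refl)) (*-identityʳ _))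
          (∑-∈ {f = λ y → running x * [ x ≟ˢ y ]ᵢ} (∈-allSelections x)
            (λ y → *-nonNeg (ind-nonNeg (¬? (final? x))) (ind-nonNeg (x ≟ˢ y))))

      At-running-small : ∀ {B} → (∀ t → σ t links [] ≤ B) → ∀ t → fromℕ t * At t running ≤ selections * q ^ k * B
      At-running-small {B} σ≤B t = begin
        fromℕ t * At t running
          ≲⟨ antitone⇒*≤partialSum {λ t → At t running} (At-indicator-antitone (λ x → ¬? (final? x)) (λ _ ¬f → ¬f)) t ⟩
        partialSum (λ t → At t running) t
          ≲⟨ partialSum-mono-terms At-running t ⟩
        partialSum (λ t → selections * q ^ k * wordWeight links [] t) t
          ≈⟨ partialSum-*ˡ _ (wordWeight links []) t ⟩
        selections * q ^ k * σ t links []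
          ≲⟨ *-monoˡ-≤ (*-nonNeg (fromℕ-nonNeg (length (allSelections k))) (^-nonNeg q-nonNeg k)) (σ≤B t) ⟩
        selections * q ^ k * B ∎
        where open ≤-Reasoning

-- Terminated selections are independent transversals

module Transversals {c ℓ₁ ℓ₂} (ℛ : RealField c ℓ₁ ℓ₂) {n k b : ℕ} (G : Graph n) (𝓟 : Partition n k b)
                    (0<b : 0 ℕ.< b) where
  open MoserTardos ℛ G 𝓟
  open Expectation ℛ G 𝓟 0<b using (Legit; ∈V⇒block; block⇒∈V)
  open Runs ℛ G 𝓟 0<b using (Final)
  open Links G 𝓟
  open Graph G
  open Partition 𝓟

  ∈selectedSet⁻ : ∀ {x v} → v ∈ selectedSet x → Selected x v
  ∈selectedSet⁻ {x} {v} v∈ with selected? x v | ≡.trans (≡.sym (Vec.lookup∘tabulate _ v)) (Vec.[]=⇒lookup v∈)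
  ... | yes xv | _ = xv

  ∈selectedSet⁺ : ∀ {x v} → Selected x v → v ∈ selectedSet x
  ∈selectedSet⁺ {x} {v} xv = Vec.lookup⇒[]= v _ (≡.trans (Vec.lookup∘tabulate _ v) (dec-true (selected? x v) xv))

  final⇒independent : ∀ {x} → Final x → Independent (selectedSet x)
  final⇒independent {x} final {u} {v} u∈ v∈ u~v = by (Fin.<-cmp u v)
    where
    no-edge : ∀ {u v} → u Fin.< v → u ~ v → u ∈ selectedSet x → ¬ (v ∈ selectedSet x)
    no-edge u<v u~v u∈ v∈ with ≡.subst (_ ∈ˡ_) final
      (∈-filter⁺ (λ (u , v) → selected? x u ×-dec selected? x v) (∈-edges⁺ u<v u~v)
        (∈selectedSet⁻ {x} u∈ , ∈selectedSet⁻ {x} v∈))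
    ... | ()
    by : Tri (u Fin.< v) (u ≡ v) (v Fin.< u) → _
    by (tri< u<v _ _) = no-edge u<v u~v u∈ v∈
    by (tri≈ _ u≡v _) = irrefl u≡v u~v
    by (tri> _ _ v<u) = no-edge v<u (sym u~v) v∈ u∈

  -- In block `i` only `lookup x i` can be selected, and legitimacy puts that vertex into block `i`.
  legit⇒transversal : ∀ {x} → Legit x → ∀ i → ∣ selectedSet x ∩ V i ∣ ≡ 1
  legit⇒transversal {x} legit i = ≡.trans (≡.cong ∣_∣ (⊆-antisym ⊆⁅⁆ ⁅⁆⊆)) (∣⁅x⁆∣≡1 (lookup x i))
    where
    ⊆⁅⁆ : ∀ {v} → v ∈ selectedSet x ∩ V i → v ∈ ⁅ lookup x i ⁆
    ⊆⁅⁆ {v} v∈ with x∈p∩q⁻ (selectedSet x) (V i) v∈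
    ... | v∈x , v∈Vi with ∈V⇒block v∈Vi
    ...   | ≡.refl = ≡.subst (λ u → v ∈ ⁅ u ⁆) (≡.sym (∈selectedSet⁻ {x} v∈x)) (x∈⁅x⁆ v)
    ⁅⁆⊆ : ∀ {v} → v ∈ ⁅ lookup x i ⁆ → v ∈ selectedSet x ∩ V i
    ⁅⁆⊆ {v} v∈ with x∈⁅y⁆⇒x≡y (lookup x i) v∈
    ... | ≡.refl = x∈p∩q⁺ (∈selectedSet⁺ {x} (≡.cong (lookup x) (legit i)) ,
                           ≡.subst (λ j → lookup x i ∈ V j) (legit i) (block⇒∈V (lookup x i)))

  final⇒independentTransversal : ∀ {x} → Legit x → Final x → IsIndependentTransversal (selectedSet x)
  final⇒independentTransversal {x} legit final =
    (λ {u} {v} → final⇒independent {x} final {u} {v}) , legit⇒transversal {x} legit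

-- The output distribution as a limit

module Output {c ℓ₁ ℓ₂} (ℛ : RealField c ℓ₁ ℓ₂) {n k b : ℕ} (G : Graph n) (𝓟 : Partition n k b)
              (0<b : 0 ℕ.< b) where
  open RealField ℛ hiding (zero)
  open OrderedFieldProperties archimedeanField
  open LimitProperties archimedeanField
  open FiniteSums ℛ
  open MoserTardos ℛ G 𝓟
  open Expectation ℛ G 𝓟 0<b
  open Runs ℛ G 𝓟 0<b
  open Transversals ℛ G 𝓟 0<b
  open Heaps G 𝓟 using (links)

  independentTransversals-unique : Unique independentTransversals
  independentTransversals-unique = Unique.filter⁺ (isIndependentTransversal? ∘ selectedSet) (allSelections-unique k)

  module _ {A : Set} (S : List A) (P : A → Carrier) where
    abstract
      -- The fold defining `maximum` starts at 0, hence the condition `0# ≤ M`.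
      maximum-≤ : ∀ {M} → 0# ≤ M → (∀ x → P x ≤ M) → maximum S P ≤ M
      maximum-≤ {M} 0≤M P≤M = go S
        where
        go : ∀ S → maximum S P ≤ M
        go []      = 0≤M
        go (x ∷ S) = proj₂ (proj₂ (⊔-supremum (P x) (maximum S P))) M (P≤M x) (go S)

      ≤-maximum : ∀ {x} → x ∈ˡ S → P x ≤ maximum S P
      ≤-maximum = go S
        where
        go : ∀ S {x} → x ∈ˡ S → P x ≤ maximum S P
        go (y ∷ S) (here ≡.refl) = proj₁ (⊔-supremum (P y) (maximum S P))
        go (y ∷ S) (there x∈S)   = ≤-trans (go S x∈S) (proj₁ (proj₂ (⊔-supremum (P y) (maximum S P))))

      maximum-pos : ∑ S P ≈ 1# → 0# < maximum S P
      maximum-pos ∑≈1 with 0<∑⇒∃ S {P} (<-respʳ-≈ (sym ∑≈1) 0<1)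
      ... | x , x∈S , 0<Px = <-≤-trans 0<Px (≤-maximum x∈S)

  module Limit (rule : Rule) {B : Carrier} (σ≤B : ∀ t → WithRule.σ rule t links [] ≤ B) where
    open WithRule rule

    κ : Selection → Selection → Carrier
    κ y x = [ final? x ×-dec (x ≟ˢ y) ]ᵢ

    abstract
      running-small : ∀ ε → 0# < ε → ∃ λ N → ∀ t → N ℕ.≤ t → At t running < ε
      running-small = eventually-small (At-running-small σ≤B)

      Pr-terminated : ∀ t → Pr (run rule t) terminated? ≈ At t (λ x → [ final? x ]ᵢ)
      Pr-terminated t = trans (Pr≈E (run rule t) terminated?) (E-cong (run-supported t) λ { {past , x} _ →
        ind-cong (terminated? (past , x)) (final? x) (λ f → f) (λ f → f) })

      Pr-terminatedAt : ∀ t y → Pr (run rule t) (terminatedAt? y) ≈ At t (κ y)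
      Pr-terminatedAt t y = trans (Pr≈E (run rule t) (terminatedAt? y)) (E-cong (run-supported t) λ { {past , x} _ →
        ind-cong (terminatedAt? y (past , x)) (final? x ×-dec (x ≟ˢ y)) (λ f → f) (λ f → f) })

      terminates : TerminatesAlmostSurely rule
      terminates = ⟶-squeeze {y = λ _ → 1#}
        (λ t → ≪-resp-≈ (gap t) (≪-neg (0≤x⇒x≪x (running-nonNeg t))))
        (vanishing⇒⟶0 running-nonNeg running-small) (⟶-const 1#)
        where
        running-nonNeg : ∀ t → 0# ≤ At t running
        running-nonNeg t = ≤-respˡ-≈ (E-0 (run rule t)) (At-mono t {λ _ → 0#} {running} (λ {x} _ → ind-nonNeg (¬? (final? x))))
        gap : ∀ t → - At t running ≈ Pr (run rule t) terminated? - 1#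
        gap t = trans (solve 2 (λ a v → :- v := a :- (a :+ v)) refl (At t (λ x → [ final? x ]ᵢ)) (At t running))
          (+-cong (sym (Pr-terminated t)) (-‿cong (At-complement final? t)))

      -- Both halves use properties that contain every running state and can therefore only lose
      -- probability: the complement of having stopped at `y`, and `ω?`, still running or being at
      -- `y`. The first makes `κ` increase; the second caps its later gains by what is running at
      -- time `s`.
      growth : ∀ y {s t} → s ℕ.≤ t → At s (κ y) ≤ At t (κ y) × At t (κ y) ≤ At s (κ y) + At s running
      growth y {s} {t} s≤t = increasing , (begin
        At t (κ y)
          ≲⟨ At-mono t {κ y} {λ x → [ ω? x ]ᵢ} (λ {x} _ → ind-mono (final? x ×-dec (x ≟ˢ y)) (ω? x) (inj₂ ∘ proj₂)) ⟩
        At t (λ x → [ ω? x ]ᵢ)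
          ≲⟨ antitone {λ t → At t (λ x → [ ω? x ]ᵢ)} (At-indicator-antitone ω? (λ _ → inj₁)) s≤t ⟩
        At s (λ x → [ ω? x ]ᵢ)
          ≲⟨ At-mono s {λ x → [ ω? x ]ᵢ} {λ x → κ y x + running x} (λ {x} _ → cases x (final? x)) ⟩
        At s (λ x → κ y x + running x)
          ≈⟨ E-+ (run rule s) _ _ ⟩
        At s (κ y) + At s running ∎)
        where
        open ≤-Reasoning
        κ? : Decidable₁ (λ x → Final x × x ≡ y)
        κ? x = final? x ×-dec (x ≟ˢ y)
        ω? : Decidable₁ (λ x → ¬ Final x ⊎ x ≡ y)
        ω? x = ¬? (final? x) ⊎-dec (x ≟ˢ y)
        cases : ∀ x → Dec (Final x) → [ ω? x ]ᵢ ≤ κ y x + running x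
        cases x (no ¬f) = ≤-trans (ind-≤1 (ω? x)) (≤-respʳ-≈ (+-comm _ _)
          (≤-respˡ-≈ (ind-yes (¬? (final? x)) ¬f) (x≤x+y (ind-nonNeg (κ? x)))))
        cases x (yes f) = ≤-trans
          (ind-mono (ω? x) (κ? x) λ { (inj₁ ¬f) → ⊥-elim (¬f f) ; (inj₂ eq) → f , eq })
          (x≤x+y (ind-nonNeg (¬? (final? x))))
        complement : ∀ t → At t (κ y) ≈ 1# - At t (λ x → [ ¬? (κ? x) ]ᵢ)
        complement t = trans (solve 2 (λ a v → a := (a :+ v) :- v) refl (At t (κ y)) (At t (λ x → [ ¬? (κ? x) ]ᵢ)))
          (+-congʳ (At-complement κ? t))
        increasing : At s (κ y) ≤ At t (κ y)
        increasing = ≤-respˡ-≈ (sym (complement s)) (≤-respʳ-≈ (sym (complement t)) (+-monoʳ-≤ 1# (neg-mono-≤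
          (antitone {λ t → At t (λ x → [ ¬? (κ? x) ]ᵢ)} (At-indicator-antitone (λ x → ¬? (κ? x)) (λ x ¬f → ¬f ∘ proj₁)) s≤t))))

      Pr-Cauchy : ∀ y → Cauchy (λ t → Pr (run rule t) (terminatedAt? y))
      Pr-Cauchy y = bounded-growth⇒Cauchy {u = λ t → At t running} (λ {s} {t} s≤t →
        let inc , gro = growth y s≤t in
        ≤-respˡ-≈ (sym (Pr-terminatedAt s y)) (≤-respʳ-≈ (sym (Pr-terminatedAt t y)) inc) ,
        ≤-respˡ-≈ (sym (Pr-terminatedAt t y)) (≤-respʳ-≈ (+-congʳ (sym (Pr-terminatedAt s y))) gro)) running-small

    Ω : Selection → Carrier
    Ω y = proj₁ (complete _ (Pr-Cauchy y))

    Ω-output : IsOutputDistribution rule Ω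
    Ω-output y = proj₂ (complete _ (Pr-Cauchy y))

    abstract
      κ-nonNeg : ∀ t y → 0# ≤ Pr (run rule t) (terminatedAt? y)
      κ-nonNeg t y = ≤-respʳ-≈ (sym (Pr-terminatedAt t y)) (≤-respˡ-≈ (E-0 (run rule t))
        (At-mono t {λ _ → 0#} {κ y} (λ {x} _ → ind-nonNeg (final? x ×-dec (x ≟ˢ y)))))

      ∑-⟶ : ∀ ys → (λ t → ∑ ys (λ y → Pr (run rule t) (terminatedAt? y))) ⟶ ∑ ys Ω
      ∑-⟶ []       = ⟶-const 0#
      ∑-⟶ (y ∷ ys) = ⟶-+ (Ω-output y) (∑-⟶ ys)

      -- A stopped run is legitimate, so its selection occurs in the list of independent
      -- transversals, and exactly once because the list has no repetitions.
      ∑-Pr : ∀ t → Pr (run rule t) terminated? ≈ ∑ independentTransversals (λ y → Pr (run rule t) (terminatedAt? y))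
      ∑-Pr t = begin
        Pr (run rule t) terminated?
          ≈⟨ Pr-terminated t ⟩
        At t (λ x → [ final? x ]ᵢ)
          ≈⟨ At-cong t {λ x → [ final? x ]ᵢ} {λ x → ∑ independentTransversals (λ y → κ y x)}
               (λ {x} legit → split x legit (final? x)) ⟩
        At t (λ x → ∑ independentTransversals (λ y → κ y x))
          ≈⟨ E-∑ (run rule t) independentTransversals _ ⟩
        ∑ independentTransversals (λ y → At t (κ y))
          ≈⟨ ∑-cong independentTransversals (λ {y} _ → Pr-terminatedAt t y) ⟨
        ∑ independentTransversals (λ y → Pr (run rule t) (terminatedAt? y)) ∎
        where
        open SetoidReasoning setoid
        split : ∀ x → Legit x → Dec (Final x) → [ final? x ]ᵢ ≈ ∑ independentTransversals (λ y → κ y x)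
        split x legit (no ¬f) = trans (ind-no (final? x) ¬f) (sym (∑-0 independentTransversals
          (λ {y} _ → ind-no (final? x ×-dec (x ≟ˢ y)) (¬f ∘ proj₁))))
        split x legit (yes f) = trans (ind-yes (final? x) f) (sym (trans
          (∑-cong independentTransversals (λ {y} _ → ind-cong (final? x ×-dec (x ≟ˢ y)) (y ≟ˢ x)
            (≡.sym ∘ proj₂) (λ eq → f , ≡.sym eq)))
          (∑-indicator _≟ˢ_ independentTransversals-unique
            (∈-filter⁺ (isIndependentTransversal? ∘ selectedSet) (∈-allSelections x)
              (final⇒independentTransversal {x} legit f)))))

      Ω-nonNeg : ∀ y → 0# ≤ Ω y
      Ω-nonNeg y = ⟶-mono-≤ 0 (λ t _ → κ-nonNeg t y) (⟶-const 0#) (Ω-output y)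

      Ω-support : ∀ y → y ∉ independentTransversals → Ω y ≈ 0#
      Ω-support y y∉ = ⟶-unique (Ω-output y) (⟶-resp-≈ (λ t → sym (zero-Pr t)) refl (⟶-const 0#))
        where
        zero-Pr : ∀ t → Pr (run rule t) (terminatedAt? y) ≈ 0#
        zero-Pr t = trans (Pr-terminatedAt t y) (trans
          (At-cong t {κ y} {λ _ → 0#} (λ {x} legit → ind-no (final? x ×-dec (x ≟ˢ y)) λ { (f , ≡.refl) →
            y∉ (∈-filter⁺ (isIndependentTransversal? ∘ selectedSet) (∈-allSelections x)
              (final⇒independentTransversal {x} legit f)) }))
          (E-0 (run rule t)))

      -- The sum is finite, so it commutes with the limit; the sums before the limit are the
      -- termination probabilities, which tend to 1.
      Ω-total : ∑ independentTransversals Ω ≈ 1#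
      Ω-total = ⟶-unique (∑-⟶ independentTransversals) (⟶-resp-≈ ∑-Pr refl terminates)

      Ω-≤ : ∀ y → Ω y ≤ q ^ k * B
      Ω-≤ y = ⟶-mono-≤ 0 (λ t _ → bound t) (Ω-output y) (⟶-const (q ^ k * B))
        where
        bound : ∀ t → Pr (run rule t) (terminatedAt? y) ≤ q ^ k * B
        bound t = begin
          Pr (run rule t) (terminatedAt? y)       ≈⟨ Pr-terminatedAt t y ⟩
          At t (κ y)
            ≲⟨ At-mono t {κ y} {λ x → [ x ≟ˢ y ]ᵢ} (λ {x} _ → ind-mono (final? x ×-dec (x ≟ˢ y)) (x ≟ˢ y) proj₂) ⟩
          At t (λ x → [ x ≟ˢ y ]ᵢ)                ≲⟨ At-point t y ⟩
          q ^ k * σ (suc t) links []              ≲⟨ *-monoˡ-≤ (^-nonNeg q-nonNeg k) (σ≤B (suc t)) ⟩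
          q ^ k * B                               ∎
          where open ≤-Reasoning

    Ω-distribution : IsDistributionOn independentTransversals Ω
    Ω-distribution = record { nonNeg = Ω-nonNeg ; support = Ω-support ; total = Ω-total }

-- The constants of the entropy bound

module Constants {c ℓ₁ ℓ₂} (ℛ : RealField c ℓ₁ ℓ₂) {b Δ : ℕ} (0<b : 0 ℕ.< b)
                 (0<Δ : 0 ℕ.< Δ) (4Δ≤b : 4 ℕ.* Δ ℕ.≤ b) where
  open RealField ℛ hiding (zero)
  open OrderedFieldProperties archimedeanField
  open Bound ℛ 0<Δ 4Δ≤b
  open Algebra.Properties.Semiring.Exp semiring using (^-congˡ)
  open Algebra.Properties.CommutativeSemiring.Exp commutativeSemiring using (^-distrib-*)
  open SetoidReasoning setoid

  -- `ν` is half the weight q²z² of an edge together with what lies on its two blocks, and `base`,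
  -- which equals (1 + z)/2, is the bound per block. Four times `base` is 2 + α - s, the denominator
  -- in the theorem, so that `q * base` is the inverse of `ratio`.
  q h s z ν base : Carrier
  q    = 1/ b
  h    = 1/ 2
  s    = √ radicand radicand-nonNeg
  z    = (α - s) * h
  ν    = h * (q * q * (z * z))
  base = 1# + fromℕ (b ℕ.* Δ) * ν

  abstract
    2h≈1 : fromℕ 2 * h ≈ 1#
    2h≈1 = 1/-inverseʳ {2} (s≤s z≤n)

    -- z is the smaller root of z² − α z + α.
    z-root : α + z * z ≈ α * z
    z-root = begin
      α + z * z
        ≈⟨ +-congʳ (trans (*-congˡ (trans (*-cong 2h≈1 2h≈1) (*-identityˡ 1#))) (*-identityʳ α)) ⟨
      α * (fromℕ 2 * h * (fromℕ 2 * h)) + z * z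
        ≈⟨ solve 3 (λ a s h → a :* (nat 2 :* h :* (nat 2 :* h)) :+ (a :- s) :* h :* ((a :- s) :* h)
                      := (nat 4 :* a :+ (a :* a :- nat 2 :* a :* s)) :* h :* h :+ s :* s :* h :* h) refl α s h ⟩
      (fromℕ 4 * α + (α * α - fromℕ 2 * α * s)) * h * h + s * s * h * h
        ≈⟨ +-congˡ (*-congʳ (*-congʳ (√-square radicand radicand-nonNeg))) ⟩
      (fromℕ 4 * α + (α * α - fromℕ 2 * α * s)) * h * h + (α * α - fromℕ 4 * α) * h * h
        ≈⟨ solve 3 (λ a s h → (nat 4 :* a :+ (a :* a :- nat 2 :* a :* s)) :* h :* h :+ (a :* a :- nat 4 :* a) :* h :* h
                      := a :* ((a :- s) :* h) :* (nat 2 :* h)) refl α s h ⟩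
      α * z * (fromℕ 2 * h)
        ≈⟨ *-congˡ 2h≈1 ⟩
      α * z * 1#
        ≈⟨ *-identityʳ _ ⟩
      α * z ∎

    Dp≈Δq : ∀ y → fromℕ (b ℕ.* Δ) * (q * q * y) ≈ fromℕ Δ * q * y
    Dp≈Δq y = begin
      fromℕ (b ℕ.* Δ) * (q * q * y)          ≈⟨ *-congʳ (fromℕ-* b Δ) ⟩
      fromℕ b * fromℕ Δ * (q * q * y)
        ≈⟨ solve 4 (λ b d q y → b :* d :* (q :* q :* y) := b :* q :* (d :* q :* y)) refl (fromℕ b) (fromℕ Δ) q y ⟩
      fromℕ b * q * (fromℕ Δ * q * y)        ≈⟨ *-congʳ (1/-inverseʳ 0<b) ⟩
      1# * (fromℕ Δ * q * y)                 ≈⟨ *-identityˡ _ ⟩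
      fromℕ Δ * q * y                        ∎

    Δqα≈1 : fromℕ Δ * q * α ≈ 1#
    Δqα≈1 = begin
      fromℕ Δ * q * (fromℕ b * 1/ Δ)
        ≈⟨ solve 4 (λ d q b e → d :* q :* (b :* e) := b :* q :* (d :* e)) refl (fromℕ Δ) q (fromℕ b) (1/ Δ) ⟩
      fromℕ b * q * (fromℕ Δ * 1/ Δ)         ≈⟨ *-cong (1/-inverseʳ 0<b) (1/-inverseʳ 0<Δ) ⟩
      1# * 1#                                ≈⟨ *-identityˡ 1# ⟩
      1#                                     ∎

    -- This is `z-root` divided by α: with D = bΔ and q = 1/b, both Dq² and Δq equal 1/α.
    z≈1+Dpz² : z ≈ 1# + fromℕ (b ℕ.* Δ) * (q * q * (z * z))
    z≈1+Dpz² = begin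
      z                                      ≈⟨ *-identityˡ z ⟨
      1# * z                                 ≈⟨ *-congʳ Δqα≈1 ⟨
      fromℕ Δ * q * α * z                    ≈⟨ *-assoc _ _ _ ⟩
      fromℕ Δ * q * (α * z)                  ≈⟨ *-congˡ z-root ⟨
      fromℕ Δ * q * (α + z * z)              ≈⟨ distribˡ _ _ _ ⟩
      fromℕ Δ * q * α + fromℕ Δ * q * (z * z) ≈⟨ +-cong Δqα≈1 (sym (Dp≈Δq (z * z))) ⟩
      1# + fromℕ (b ℕ.* Δ) * (q * q * (z * z)) ∎

    2ν≈pz² : ν + ν ≈ q * q * (z * z)
    2ν≈pz² = trans (solve 2 (λ h y → h :* y :+ h :* y := nat 2 :* h :* y) refl h (q * q * (z * z)))
                   (trans (*-congʳ 2h≈1) (*-identityˡ _))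

    0≤ν : 0# ≤ ν
    0≤ν = *-nonNeg (<⇒≤ (1/-pos {2} (s≤s z≤n)))
      (*-nonNeg (square-nonNeg q) (square-nonNeg z))

    0≤base : 0# ≤ base
    0≤base = +-nonNeg 0≤1 (*-nonNeg (fromℕ-nonNeg (b ℕ.* Δ)) 0≤ν)

    4base≈denominator : fromℕ 4 * base ≈ denominator
    4base≈denominator = begin
      fromℕ 4 * (1# + D * (h * X))
        ≈⟨ solve 3 (λ d h x → nat 4 :* (:1 :+ d :* (h :* x)) := nat 2 :+ nat 2 :* (:1 :+ (nat 2 :* h) :* (d :* x))) refl D h X ⟩
      fromℕ 2 + fromℕ 2 * (1# + fromℕ 2 * h * (D * X))
        ≈⟨ +-congˡ (*-congˡ (+-congˡ (trans (*-congʳ 2h≈1) (*-identityˡ _)))) ⟩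
      fromℕ 2 + fromℕ 2 * (1# + D * X)
        ≈⟨ +-congˡ (*-congˡ z≈1+Dpz²) ⟨
      fromℕ 2 + fromℕ 2 * ((α - s) * h)
        ≈⟨ solve 3 (λ a s h → nat 2 :+ nat 2 :* ((a :- s) :* h) := nat 2 :+ (a :- s) :* (nat 2 :* h)) refl α s h ⟩
      fromℕ 2 + (α - s) * (fromℕ 2 * h)
        ≈⟨ +-congˡ (trans (*-congˡ 2h≈1) (*-identityʳ _)) ⟩
      fromℕ 2 + (α - s)
        ≈⟨ +-assoc _ _ _ ⟨
      denominator ∎
      where
      D X : Carrier
      D = fromℕ (b ℕ.* Δ)
      X = q * q * (z * z)

    ratio*q*base≈1 : ratio * (q * base) ≈ 1#
    ratio*q*base≈1 = begin
      fromℕ 4 * fromℕ b * inv denominator-pos * (q * base)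
        ≈⟨ solve 5 (λ f b i q c → f :* b :* i :* (q :* c) := b :* q :* (f :* c :* i)) refl
             (fromℕ 4) (fromℕ b) (inv denominator-pos) q base ⟩
      fromℕ b * q * (fromℕ 4 * base * inv denominator-pos)
        ≈⟨ *-cong (1/-inverseʳ 0<b) (trans (*-congʳ 4base≈denominator) (*-inverseʳ denominator-pos)) ⟩
      1# * 1#
        ≈⟨ *-identityˡ 1# ⟩
      1# ∎

    1^≈1 : ∀ k → 1# ^ k ≈ 1#
    1^≈1 zero    = refl
    1^≈1 (suc k) = trans (*-identityˡ _) (1^≈1 k)

    ratio^*≤1 : ∀ k {m} → m ≤ q ^ k * base ^ k → ratio ^ k * m ≤ 1#
    ratio^*≤1 k {m} m≤ = ≤-respʳ-≈ (begin
      ratio ^ k * (q ^ k * base ^ k)    ≈⟨ *-congˡ (^-distrib-* q base k) ⟨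
      ratio ^ k * (q * base) ^ k        ≈⟨ ^-distrib-* ratio (q * base) k ⟨
      (ratio * (q * base)) ^ k          ≈⟨ ^-congˡ k ratio*q*base≈1 ⟩
      1# ^ k                            ≈⟨ 1^≈1 k ⟩
      1#                                ∎)
      (*-monoˡ-≤ (^-nonNeg (<⇒≤ ratio-pos) k) m≤)

proposition7p5 :
  ∀ {c ℓ₁ ℓ₂} (ℛ : RealField c ℓ₁ ℓ₂) {n k b Δ : ℕ}
  (G : Graph n) (𝓟 : Partition n k b) →
  Graph.maxDegree G ≡ Δ →
  (0<Δ : 0 ℕ.< Δ) (4Δ≤b : 4 ℕ.* Δ ℕ.≤ b) →
  let open RealField ℛ
      open MoserTardos ℛ G 𝓟
      open Bound ℛ 0<Δ 4Δ≤b
  in (rule : Rule) →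
  TerminatesAlmostSurely rule ×
  (∃[ Ω′ ] IsOutputDistribution rule Ω′ ×
           IsDistributionOn independentTransversals Ω′ ×
           (Σ[ 0<max ∈ 0# < maximum independentTransversals Ω′ ]
              entropyBound k ≤ minEntropy independentTransversals Ω′ 0<max))
proposition7p5 ℛ {k = k} {b} {Δ} G 𝓟 ≡.refl 0<Δ 4Δ≤b rule =
  terminates , Ω , Ω-output , Ω-distribution , 0<max ,
  -- Every value of `Ω` is at most `q ^ k * base ^ k`, the inverse of `ratio ^ k`; the maximum
  -- inherits this bound.
  ExponentialProperties.ln-bound ℛ k ratio-pos 0<max
    (ratio^*≤1 k (maximum-≤ independentTransversals Ω
      (*-nonNeg (^-nonNeg q-nonNeg k) (^-nonNeg 0≤base k)) Ω-≤))
  where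
  0<b : 0 ℕ.< b
  0<b = ℕ.<-≤-trans 0<Δ (ℕ.≤-trans (ℕ.m≤n*m Δ 4) 4Δ≤b)
  open RealField ℛ hiding (zero)
  open OrderedFieldProperties archimedeanField
  open MoserTardos ℛ G 𝓟
  open Bound ℛ 0<Δ 4Δ≤b using (ratio-pos)
  open Constants ℛ 0<b 0<Δ 4Δ≤b
  open Expectation ℛ G 𝓟 0<b using (q-nonNeg)
  open Runs ℛ G 𝓟 0<b using (length-linksAt; module WithRule)
  open WithRule rule using (module Bounds)
  open Bounds z ν 0≤ν 2ν≈pz² (b ℕ.* Δ) length-linksAt z≈1+Dpz² using (σ-links)
  open Output ℛ G 𝓟 0<b
  open Limit rule σ-links

  0<max : 0# < maximum independentTransversals Ω
  0<max = maximum-pos independentTransversals Ω Ω-total
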